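{- Let $n,k,m$ be positive integers with $m\le k\le n$, let $\omega\in S_n$, and let $c[k,m]$ denote the $(m+1)$-cycle $(k-m+1\ \ k-m+2\ \ \ldots\ \ k\ \ k+1)$. Let $c[k,m]\cdot\mathcal T_\omega$ be the set of those elements of $k_{(m)}\cdot\mathcal T_\omega$, with labels $(1,a_1,b_1),\ldots,(m,a_m,b_m)$, such that $b_1\ge b_2\ge\cdots\ge b_m$ and the numbers $a_1,\ldots,a_m$ are pairwise distinct. Then $$\mathfrak S_\omega\,\mathfrak S_{c[k,m]}=\sum_{\mathcal T\in c[k,m]\cdot\mathcal T_\omega}\mathfrak S_{\omega_{\mathcal T}},$$ where $\omega_{\mathcal T}$ is the permutation whose tower diagram is the underlying diagram of $\mathcal T$.
   Context: $\mathfrak S_w$ is the Schubert polynomial of $w$. Permutations are composed as functions, $(\sigma\tau)(x)=\sigma(\tau(x))$; $t_{a,b}$ is the transposition of $a$ and $b$; $\ell$ is Coxeter length; a cycle $(c_1\,\ldots\,c_p)$ maps $c_1\mapsto c_2\mapsto\cdots\mapsto c_p\mapsto c_1$. A tower diagram is a sequence $(\mathcal T_1,\mathcal T_2,\ldots)$ of nonnegative integers, almost all zero. Sliding a positive integer $i$ into $\mathcal T$: set $s:=i$ and examine towers $p=1,2,\ldots$ with $h=\mathcal T_p$: if $s>p+h$ go on; if $s=p+h$ increase $\mathcal T_p$ by one and stop; if $h\ge 1$ and $s=p+h-1$ decrease $\mathcal T_p$ by one and stop; if $s<p+h-1$ set $s:=s+1$ and go on. A word is slid letter by letter from left to right. The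 tower diagram $\mathcal T_w$ of a permutation $w$ is the result of sliding a reduced word $\alpha$ of $w$ ($w=s_{\alpha_1}\cdots s_{\alpha_l}$, $l=\ell(w)$, $s_p=t_{p,p+1}$) into the empty diagram; this is independent of the reduced word and $w\mapsto\mathcal T_w$ is a bijection with inverse $\mathcal T\mapsto\omega_{\mathcal T}$. A saturated $k$-Bruhat chain of length $m$ from $\omega$ is a sequence $(a_1,b_1),\ldots,(a_m,b_m)$ of pairs of positive integers with $a_q\le k<b_q$ and $\ell(\omega^{(q)})=\ell(\omega^{(q-1)})+1$ for all $q$, where $\omega^{(0)}=\omega$, $\omega^{(q)}=\omega^{(q-1)}t_{a_q,b_q}$. The set $k_{(m)}\cdot\mathcal T_\omega$ consists, for each such chain, of the diagram $\mathcal T_{\omega^{(m)}}$ labelled by $(1,a_1,b_1),\ldots,(m,a_m,b_m)$ (distinct chains give distinct elements). -}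

module Defs where

open import Data.Nat using (ℕ; zero; suc; _+_; _∸_; _≤ᵇ_; _<ᵇ_; _≡ᵇ_; _≤_; _<_; _⊔_)
import Data.Nat as N
open import Data.Integer as ℤ using (ℤ; +_; -_)
open import Data.Bool using (Bool; true; false; if_then_else_; _∧_)
open import Data.List using (List; []; _∷_; map; concatMap; concat; length; upTo)
open import Data.Product using (_×_; _,_; proj₁; proj₂)
open import Data.Maybe using (Maybe; just; nothing)
open import Data.Unit using (⊤)
open import Data.List.Relation.Binary.Permutation.Propositional using (_↭_)
open import Data.List.Relation.Unary.Unique.Propositional using (Unique)
open import Relation.Binary.PropositionalEquality using (_≡_)

-- Polynomials in x₁, x₂, … with integer coefficients.
-- A monomial is its exponent list (e₁, e₂, …); trailing zeros are
-- irrelevant.  A polynomial is a finite formal sum of terms.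

Monomial : Set
Monomial = List ℕ

Poly : Set
Poly = List (ℤ × Monomial)

-- 0-based access / update of exponents (padding with zeros)
atZ : Monomial → ℕ → ℕ
atZ []       _       = 0
atZ (x ∷ xs) zero    = x
atZ (x ∷ xs) (suc i) = atZ xs i

setZ : Monomial → ℕ → ℕ → Monomial
setZ []       zero    v = v ∷ []
setZ []       (suc i) v = 0 ∷ setZ [] i v
setZ (x ∷ xs) zero    v = v ∷ xs
setZ (x ∷ xs) (suc i) v = x ∷ setZ xs i v

addMono : Monomial → Monomial → Monomial
addMono []       ys       = ys
addMono (x ∷ xs) []       = x ∷ xs
addMono (x ∷ xs) (y ∷ ys) = (x + y) ∷ addMono xs ys

sameMono : Monomial → Monomial → Bool
sameMono []       []       = true
sameMono []       (y ∷ ys) = (y ≡ᵇ 0) ∧ sameMono [] ys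
sameMono (x ∷ xs) []       = (x ≡ᵇ 0) ∧ sameMono xs []
sameMono (x ∷ xs) (y ∷ ys) = (x ≡ᵇ y) ∧ sameMono xs ys

coeff : Poly → Monomial → ℤ
coeff []            e = + 0
coeff ((c , f) ∷ p) e = (if sameMono f e then c else + 0) ℤ.+ coeff p e

infix 4 _≈P_
_≈P_ : Poly → Poly → Set
p ≈P q = ∀ e → coeff p e ≡ coeff q e

infixl 7 _*P_
_*P_ : Poly → Poly → Poly
p *P q = concatMap (λ { (c , e) → map (λ { (d , f) → (c ℤ.* d , addMono e f) }) q }) p

sumP : List Poly → Poly
sumP = concat

-- divided difference ∂ᵢ (i ≥ 1), acting on the variables xᵢ, xᵢ₊₁:
-- ∂ᵢ f = (f − sᵢ f)/(xᵢ − xᵢ₊₁), computed monomial by monomial: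
-- ∂ᵢ(xᵢ^a xᵢ₊₁^b) = Σ_{j<a-b} xᵢ^{a-1-j} xᵢ₊₁^{b+j}  if a > b,
--                 = − ∂ᵢ(xᵢ^b xᵢ₊₁^a)               if a < b,
--                 = 0                                 if a = b.
ddMono : ℕ → Monomial → Poly
ddMono i e =
  let p = i ∸ 1
      a = atZ e p
      b = atZ e i
  in if b <ᵇ a
     then map (λ j → (+ 1 , setZ (setZ e p (a ∸ 1 ∸ j)) i (b + j))) (upTo (a ∸ b))
     else (if a <ᵇ b
           then map (λ j → (- (+ 1) , setZ (setZ e p (b ∸ 1 ∸ j)) i (a + j))) (upTo (b ∸ a))
           else [])

dd : ℕ → Poly → Poly
dd i p = concatMap (λ { (c , e) → map (λ { (d , f) → (c ℤ.* d , f) }) (ddMono i e) }) p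

-- Permutations of {1,2,…} with finite support, in one-line notation:
-- the list [w(1), …, w(N)]; w(i) = i for i > N.

IsPerm : ℕ → List ℕ → Set
IsPerm n w = (length w ≡ n) × (w ↭ map suc (upTo n))

lookup1 : List ℕ → ℕ → ℕ      -- 1-based, 0 if out of range
lookup1 []       _             = 0
lookup1 (x ∷ xs) zero          = 0
lookup1 (x ∷ xs) (suc zero)    = x
lookup1 (x ∷ xs) (suc (suc i)) = lookup1 xs (suc i)

app : List ℕ → ℕ → ℕ
app w i = if i ≤ᵇ length w then lookup1 w i else i

-- w ∘ t_{a,b}  (composition as functions: (w t)(a) = w(b))
swapPos : ℕ → ℕ → List ℕ → List ℕ
swapPos a b w =
  map (λ j → let i = suc j in
              if i ≡ᵇ a then app w b else (if i ≡ᵇ b then app w a else app w i))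
      (upTo (length w ⊔ (a ⊔ b)))

countLess : ℕ → List ℕ → ℕ
countLess x []       = 0
countLess x (y ∷ ys) = (if y <ᵇ x then 1 else 0) + countLess x ys

len : List ℕ → ℕ
len []       = 0
len (x ∷ xs) = countLess x xs + len xs

-- Schubert polynomials via divided differences:
-- 𝔖_{w₀} = x₁^{N-1} x₂^{N-2} ⋯ x_{N-1} for the longest w₀ ∈ S_N, and
-- 𝔖_w = ∂ᵢ 𝔖_{w sᵢ} whenever w(i) < w(i+1) (i.e. ℓ(w sᵢ) = ℓ(w)+1).
-- We always take the smallest such i; the fuel N*N exceeds ℓ(w₀).

firstAscent : ℕ → List ℕ → Maybe ℕ
firstAscent i []           = nothing
firstAscent i (x ∷ [])     = nothing
firstAscent i (x ∷ y ∷ ys) = if x <ᵇ y then just i else firstAscent (suc i) (y ∷ ys)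

staircase : ℕ → Poly
staircase N = (+ 1 , map (λ j → N ∸ suc j) (upTo N)) ∷ []

schubertGo : ℕ → List ℕ → Poly
schubertGo zero    w = []
schubertGo (suc f) w with firstAscent 1 w
... | nothing = staircase (length w)
... | just i  = dd i (schubertGo f (swapPos i (suc i) w))

𝔖 : List ℕ → Poly
𝔖 w = schubertGo (length w N.* length w) w

cycleFun : ℕ → ℕ → ℕ → ℕ
cycleFun k m i =
  if i ≤ᵇ (k ∸ m) then i else (if i ≤ᵇ k then suc i else suc (k ∸ m))

cyc : ℕ → ℕ → List ℕ
cyc k m = map (λ j → cycleFun k m (suc j)) (upTo (suc k))

-- Saturated k-Bruhat chains (a₁,b₁),…,(a_m,b_m) from ω

SatChain : ℕ → List ℕ → List (ℕ × ℕ) → Set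
SatChain k ω []             = ⊤
SatChain k ω ((a , b) ∷ ch) =
  (1 ≤ a) × (a ≤ k) × (k < b) ×
  (len (swapPos a b ω) ≡ suc (len ω)) × SatChain k (swapPos a b ω) ch

endPerm : List ℕ → List (ℕ × ℕ) → List ℕ
endPerm ω []             = ω
endPerm ω ((a , b) ∷ ch) = endPerm (swapPos a b ω) ch

WeaklyDecr : List ℕ → Set
WeaklyDecr []           = ⊤
WeaklyDecr (x ∷ [])     = ⊤
WeaklyDecr (x ∷ y ∷ ys) = (y ≤ x) × WeaklyDecr (y ∷ ys)

-- the chains indexing the elements of c[k,m]·𝒯_ω
InCycleSet : ℕ → ℕ → List ℕ → List (ℕ × ℕ) → Set
InCycleSet k m ω ch =
  (length ch ≡ m) × SatChain k ω ch ×
  WeaklyDecr (map proj₂ ch) × Unique (map proj₁ ch)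

{-# OPTIONS --safe #-}
module Submission where

-- The proof follows Postnikov's argument for the quantum Pieri formula.  Polynomials are compared through linear
-- functionals φ on monomials.  The twisted Leibniz rule alone gives ∂ᵢ² = 0 and the braid relations by induction on
-- monomials, hence 𝔖_w = ∂ᵢ 𝔖_{w sᵢ} at every ascent i, and then Monk's rule
-- x_κ 𝔖_w = Σ_{b>κ} 𝔖_{w t_{κb}} − Σ_{a<κ} 𝔖_{w t_{aκ}} (sums over Bruhat covers) by descending induction on length.
-- The operators T a b that multiply by t_{a,b} if this gives a cover, and vanish otherwise, satisfy the quadratic
-- relations of the Fomin–Kirillov algebra.
-- Write Z_b = Σ_{a≤k} T a b, where a may be used only once along a chain.  The series Π_b (1 − t Z_b)⁻¹ over decreasing
-- b > k enumerates the chains of the theorem, and the quadratic relations turn the passage from k to k + 1 into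
-- multiplication by 1 + t x_{k+1}, so the series is multiplication by Π_{i≤k} (1 + t xᵢ), the generating function of
-- the elementary symmetric polynomials.  Monk's rule also gives 𝔖_{c[k,m]} = e_m(x₁, …, x_k).

open import Defs
open import Data.Nat as ℕ using (ℕ; zero; suc; _∸_; _⊔_; _≤_; _<_; z≤n; s≤s; _≡ᵇ_; _≤ᵇ_; _<ᵇ_)
open import Data.Nat.Properties
import Data.Nat.Tactic.RingSolver as ℕSolver
open import Data.Integer as ℤ using (ℤ; 0ℤ; 1ℤ; -1ℤ)
import Data.Integer.Properties as ℤₚ
open import Data.Integer.Tactic.RingSolver using (solve-∀)
open import Algebra.Bundles using (module AbelianGroup)
open import Algebra.Properties.Group (AbelianGroup.group ℤₚ.+-0-abelianGroup) using (∙-cancelʳ)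
open import Data.Bool using (Bool; true; false; if_then_else_; _∧_)
open import Data.Maybe using (just; nothing)
open import Data.Vec using (Vec; []; _∷_; replicate)
open import Data.List using (List; []; _∷_; _++_; map; length; upTo; applyUpTo; downFrom)
import Data.List.Properties as Listₚ
open import Data.List.Membership.Propositional using (_∈_)
open import Data.List.Membership.Propositional.Properties using (∈-++⁺ˡ; ∈-++⁺ʳ; ∈-++⁻; ∈-map⁺; ∈-map⁻; ∈-upTo⁻)
open import Data.List.Relation.Unary.Any using (here; there)
open import Data.List.Relation.Unary.All as All using (All; []; _∷_)
open import Data.List.Relation.Unary.AllPairs using ([]; _∷_)
open import Data.List.Relation.Unary.Unique.Propositional using (Unique)
import Data.List.Relation.Unary.Unique.Propositional.Properties as Uniqueₚ
open import Data.List.Relation.Binary.Permutation.Propositional using (↭-sym; ↭⇒↭ₛ)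
open import Data.List.Relation.Binary.Permutation.Propositional.Properties using (∈-resp-↭)
import Data.List.Relation.Binary.Permutation.Setoid.Properties as PermSetoidₚ
open import Data.Product using (Σ; _×_; _,_; proj₁; proj₂; ∃-syntax)
open import Data.Sum using (_⊎_; inj₁; inj₂; map₂)
open import Data.Unit using (tt)
open import Data.Empty using (⊥; ⊥-elim)
open import Function.Bundles using (_⇔_; mk⇔)
open import Relation.Nullary using (¬_; Dec; yes; no)
open import Relation.Binary.Definitions using (Tri; tri<; tri≈; tri>)
open import Relation.Binary.PropositionalEquality

-- Two obstacles shape the argument. A permutation is a list, `𝔖` starts from the staircase of that
-- list's length, and `swapPos` may lengthen the list along a chain. The computation therefore moves
-- to one symmetric group S_N, which rests on the stability of Schubert polynomials under appended
-- fixed points. There Monk's rule, with its sum cut off at N, is complete only for permutations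
-- that fix N. Since a cover t_{a,b} with a ≤ k pushes the support up by at most one place, a count
-- of the covers still to come, kept in `Room`, guarantees this. The other obstacle is the
-- distinctness of the a's. It makes different columns Z_b commute, but for a < κ < b the quadratic
-- relation T_{aκ} T_{κb} = T_{κb} T_{ab} + T_{ab} T_{aκ} has a last term that uses a twice. The
-- operator `Q`, which runs over the used indices, absorbs such terms. In the passage from k to k +
-- 1 two terms with `Q` remain: one vanishes because nothing is used at the start and within a
-- single column no index can come up twice; the other cancels against the `Q` term that Monk's rule
-- produces.

-- Formal sums of monomials and linear functionals

module Functionals where
  open import Data.Integer using (_+_; _*_)

  infix 4 _∼_
  record _∼_ (f g : Monomial) : Set where
    constructor same
    field
      exponent : ∀ i → atZ f i ≡ atZ g i
  open _∼_ public

  ≡ᵇ-refl : ∀ x → (x ≡ᵇ x) ≡ true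
  ≡ᵇ-refl zero    = refl
  ≡ᵇ-refl (suc x) = ≡ᵇ-refl x

  ≡ᵇ-sound : ∀ x y → (x ≡ᵇ y) ≡ true → x ≡ y
  ≡ᵇ-sound zero    zero    _ = refl
  ≡ᵇ-sound (suc x) (suc y) p = cong suc (≡ᵇ-sound x y p)

  ∧-split : ∀ {a b} → (a ∧ b) ≡ true → a ≡ true × b ≡ true
  ∧-split {true} p = refl , p

  sameMono-sound : ∀ f e → sameMono f e ≡ true → ∀ i → atZ f i ≡ atZ e i
  sameMono-sound []       []       _ i       = refl
  sameMono-sound []       (y ∷ ys) p zero    = sym (≡ᵇ-sound y 0 (proj₁ (∧-split p)))
  sameMono-sound []       (y ∷ ys) p (suc i) = sameMono-sound [] ys (proj₂ (∧-split {y ≡ᵇ 0} p)) i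
  sameMono-sound (x ∷ xs) []       p zero    = ≡ᵇ-sound x 0 (proj₁ (∧-split p))
  sameMono-sound (x ∷ xs) []       p (suc i) = sameMono-sound xs [] (proj₂ (∧-split {x ≡ᵇ 0} p)) i
  sameMono-sound (x ∷ xs) (y ∷ ys) p zero    = ≡ᵇ-sound x y (proj₁ (∧-split p))
  sameMono-sound (x ∷ xs) (y ∷ ys) p (suc i) = sameMono-sound xs ys (proj₂ (∧-split {x ≡ᵇ y} p)) i

  ≡ᵇ-complete : ∀ {x y} → x ≡ y → (x ≡ᵇ y) ≡ true
  ≡ᵇ-complete {x} refl = ≡ᵇ-refl x

  sameMono-complete : ∀ f e → (∀ i → atZ f i ≡ atZ e i) → sameMono f e ≡ true
  sameMono-complete []       []       _ = refl
  sameMono-complete []       (y ∷ ys) p = cong₂ _∧_ (≡ᵇ-complete (sym (p 0))) (sameMono-complete [] ys (λ i → p (suc i)))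
  sameMono-complete (x ∷ xs) []       p = cong₂ _∧_ (≡ᵇ-complete (p 0)) (sameMono-complete xs [] (λ i → p (suc i)))
  sameMono-complete (x ∷ xs) (y ∷ ys) p = cong₂ _∧_ (≡ᵇ-complete (p 0)) (sameMono-complete xs ys (λ i → p (suc i)))

  -- Exponent lists that differ by trailing zeros denote one monomial, so only functions that cannot
  -- tell them apart descend to polynomials.
  record Functional : Set where
    constructor functional
    field
      at   : Monomial → ℤ
      respects : ∀ {f g} → f ∼ g → at f ≡ at g
  open Functional public

  ev : (Monomial → ℤ) → Poly → ℤ
  ev φ []            = 0ℤ
  ev φ ((c , f) ∷ p) = c * φ f + ev φ p

  ev-++ : ∀ φ p q → ev φ (p ++ q) ≡ ev φ p + ev φ q
  ev-++ φ []            q = sym (ℤₚ.+-identityˡ _)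
  ev-++ φ ((c , f) ∷ p) q = trans (cong (λ z → c * φ f + z) (ev-++ φ p q)) (sym (ℤₚ.+-assoc (c * φ f) _ _))

  ev-cong : ∀ {φ ψ} → (∀ f → φ f ≡ ψ f) → ∀ p → ev φ p ≡ ev ψ p
  ev-cong φ≗ψ []            = refl
  ev-cong φ≗ψ ((c , f) ∷ p) = cong₂ _+_ (cong (λ z → c * z) (φ≗ψ f)) (ev-cong φ≗ψ p)

  ev-map : ∀ φ c (g : Monomial → Monomial) {h : ℤ × Monomial → ℤ × Monomial} →
           (∀ d f → h (d , f) ≡ (c * d , g f)) →
           ∀ q → ev φ (map h q) ≡ c * ev (λ f → φ (g f)) q
  ev-map φ c g h≡ []            = sym (ℤₚ.*-zeroʳ c)
  ev-map φ c g h≡ ((d , f) ∷ q) rewrite h≡ d f | ev-map φ c g h≡ q = lemma c d (φ (g f)) _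
    where
    lemma : ∀ c d x y → c * d * x + c * y ≡ c * (d * x + y)
    lemma = solve-∀

  ev-+ : ∀ φ ψ p → ev (λ f → φ f + ψ f) p ≡ ev φ p + ev ψ p
  ev-+ φ ψ []            = refl
  ev-+ φ ψ ((c , f) ∷ p) rewrite ev-+ φ ψ p = lemma c (φ f) (ψ f) (ev φ p) (ev ψ p)
    where
    lemma : ∀ c x y u v → c * (x + y) + (u + v) ≡ c * x + u + (c * y + v)
    lemma = solve-∀

  ev-* : ∀ c φ p → ev (λ f → c * φ f) p ≡ c * ev φ p
  ev-* c φ []            = sym (ℤₚ.*-zeroʳ c)
  ev-* c φ ((d , f) ∷ p) rewrite ev-* c φ p = lemma c d (φ f) (ev φ p)
    where
    lemma : ∀ c d x y → d * (c * x) + c * y ≡ c * (d * x + y)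
    lemma = solve-∀

  χ : Monomial → Monomial → ℤ
  χ e f = if sameMono f e then 1ℤ else 0ℤ

  coeff-ev : ∀ p e → coeff p e ≡ ev (χ e) p
  coeff-ev []            e = refl
  coeff-ev ((c , f) ∷ p) e = cong₂ _+_ (head (sameMono f e)) (coeff-ev p e)
    where
    head : ∀ b → (if b then c else 0ℤ) ≡ c * (if b then 1ℤ else 0ℤ)
    head true  = sym (ℤₚ.*-identityʳ c)
    head false = sym (ℤₚ.*-zeroʳ c)

  χ-respects : ∀ e {f g} → f ∼ g → χ e f ≡ χ e g
  χ-respects e {f} {g} f∼g with sameMono f e in p | sameMono g e in q
  ... | true  | true  = refl
  ... | false | false = refl
  ... | true  | false = case (trans (sym q) (sameMono-complete g e (λ i → trans (sym (exponent f∼g i)) (sameMono-sound f e p i))))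
    where case : false ≡ true → _
          case ()
  ... | false | true  = case (trans (sym p) (sameMono-complete f e (λ i → trans (exponent f∼g i) (sameMono-sound g e q i))))
    where case : false ≡ true → _
          case ()

  coefficient : Monomial → Functional
  coefficient e = functional (χ e) (χ-respects e)

  remove : Monomial → Poly → Poly
  remove f []            = []
  remove f ((c , g) ∷ p) = if sameMono g f then remove f p else (c , g) ∷ remove f p

  ev-remove : ∀ (φ : Functional) f p → ev (at φ) p ≡ ev (χ f) p * at φ f + ev (at φ) (remove f p)
  ev-remove φ f []            = refl
  ev-remove φ f ((c , g) ∷ p) with sameMono g f in eq
  ... | true  = trans (cong₂ (λ x y → c * x + y) (respects φ (same (sameMono-sound g f eq))) (ev-remove φ f p))
                      (lemma c (at φ f) (ev (χ f) p) _)
    where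
    lemma : ∀ c x y z → c * x + (y * x + z) ≡ (c * 1ℤ + y) * x + z
    lemma = solve-∀
  ... | false = trans (cong (λ y → c * at φ g + y) (ev-remove φ f p)) (lemma c (at φ g) (at φ f) (ev (χ f) p) _)
    where
    lemma : ∀ c x x' y z → c * x + (y * x' + z) ≡ (c * 0ℤ + y) * x' + (c * x + z)
    lemma = solve-∀

  remove-length : ∀ f p → length (remove f p) ≤ length p
  remove-length f []            = z≤n
  remove-length f ((c , g) ∷ p) with sameMono g f
  ... | true  = m≤n⇒m≤1+n (remove-length f p)
  ... | false = s≤s (remove-length f p)

  -- Several terms may denote the same monomial and cancel each other, so the claim does not hold
  -- term by term. The hypothesis at the leading monomial says that its whole group of terms
  -- cancels; the group can then be deleted for all functionals at once, and what is left is shorter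
  -- and still has zero coefficients.
  ev-zero : ∀ n (φ : Functional) p → length p ≤ n → (∀ e → ev (χ e) p ≡ 0ℤ) → ev (at φ) p ≡ 0ℤ
  ev-zero n       φ []            _         _  = refl
  ev-zero (suc n) φ ((c , f) ∷ p) (s≤s p≤n) p0 =
    trans (ev-split φ) (ev-zero n φ (remove f q) shorter (λ e → trans (sym (ev-split (coefficient e))) (p0 e)))
    where
    q = (c , f) ∷ p
    ev-split : ∀ ψ → ev (at ψ) q ≡ ev (at ψ) (remove f q)
    ev-split ψ = trans (ev-remove ψ f q)
      (trans (cong (λ z → z * at ψ f + ev (at ψ) (remove f q)) (p0 f)) (ℤₚ.+-identityˡ _))
    shorter : length (remove f q) ≤ n
    shorter rewrite sameMono-complete f f (λ _ → refl) = ≤-trans (remove-length f p) p≤n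

  negP : Poly → Poly
  negP = map λ { (c , f) → (ℤ.-1ℤ * c , f) }

  ev-negP : ∀ φ p → ev φ (negP p) ≡ ℤ.-1ℤ * ev φ p
  ev-negP φ p = ev-map φ ℤ.-1ℤ (λ f → f) (λ _ _ → refl) p

  -- Allows one representative of a polynomial to be exchanged for another under every functional,
  -- not only under extraction of a coefficient. It is the vanishing criterion `ev-zero` for the
  -- difference.
  ev-respects : ∀ (φ : Functional) {p q} → p ≈P q → ev (at φ) p ≡ ev (at φ) q
  ev-respects φ {p} {q} p≈q = lemma _ _ (trans (sym (split (at φ))) (ev-zero _ φ (p ++ negP q) ≤-refl zeros))
    where
    split : ∀ ψ → ev ψ (p ++ negP q) ≡ ev ψ p + ℤ.-1ℤ * ev ψ q
    split ψ = trans (ev-++ ψ p _) (cong (λ z → ev ψ p + z) (ev-negP ψ q))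
    cancel : ∀ x → x + ℤ.-1ℤ * x ≡ 0ℤ
    cancel = solve-∀
    zeros : ∀ e → ev (χ e) (p ++ negP q) ≡ 0ℤ
    zeros e = trans (split (χ e))
      (trans (cong (λ z → z + ℤ.-1ℤ * ev (χ e) q)
                   (trans (sym (coeff-ev p e)) (trans (p≈q e) (coeff-ev q e))))
             (cancel (ev (χ e) q)))
    regroup : ∀ x y → x ≡ x + ℤ.-1ℤ * y + y
    regroup = solve-∀
    lemma : ∀ x y → x + ℤ.-1ℤ * y ≡ 0ℤ → x ≡ y
    lemma x y h = trans (regroup x y) (trans (cong (_+ y) h) (ℤₚ.+-identityˡ y))

  ≈P-ext : ∀ {p q} → (∀ (φ : Functional) → ev (at φ) p ≡ ev (at φ) q) → p ≈P q
  ≈P-ext {p} {q} h e = trans (coeff-ev p e) (trans (h (coefficient e)) (sym (coeff-ev q e)))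

open Functionals

-- Divided differences: Leibniz rule, nilpotence and braid relations

module DividedDifferences where
  open import Data.Integer using (_+_; _*_)
  open import Data.Bool using (T)

  atZ-setZ-≡ : ∀ e p v → atZ (setZ e p v) p ≡ v
  atZ-setZ-≡ []      zero    v = refl
  atZ-setZ-≡ []      (suc p) v = atZ-setZ-≡ [] p v
  atZ-setZ-≡ (x ∷ e) zero    v = refl
  atZ-setZ-≡ (x ∷ e) (suc p) v = atZ-setZ-≡ e p v

  atZ-setZ-≢ : ∀ e p v q → q ≢ p → atZ (setZ e p v) q ≡ atZ e q
  atZ-setZ-≢ e       zero    v zero    q≢p = ⊥-elim (q≢p refl)
  atZ-setZ-≢ []      zero    v (suc q) _   = refl
  atZ-setZ-≢ []      (suc p) v zero    _   = refl
  atZ-setZ-≢ []      (suc p) v (suc q) q≢p = atZ-setZ-≢ [] p v q (λ q≡p → q≢p (cong suc q≡p))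
  atZ-setZ-≢ (x ∷ e) zero    v (suc q) _   = refl
  atZ-setZ-≢ (x ∷ e) (suc p) v zero    _   = refl
  atZ-setZ-≢ (x ∷ e) (suc p) v (suc q) q≢p = atZ-setZ-≢ e p v q (λ q≡p → q≢p (cong suc q≡p))

  bump : ℕ → Monomial → Monomial
  bump q e = setZ e q (suc (atZ e q))

  bump-≡ : ∀ q e → atZ (bump q e) q ≡ suc (atZ e q)
  bump-≡ q e = atZ-setZ-≡ e q _

  bump-≢ : ∀ q e r → r ≢ q → atZ (bump q e) r ≡ atZ e r
  bump-≢ q e = atZ-setZ-≢ e q _

  bump-cong : ∀ q {e f} → e ∼ f → bump q e ∼ bump q f
  exponent (bump-cong q {e} {f} e∼f) r with r ℕ.≟ q
  ... | yes refl = trans (bump-≡ r e) (trans (cong suc (exponent e∼f r)) (sym (bump-≡ r f)))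
  ... | no  r≢q  = trans (bump-≢ q e r r≢q) (trans (exponent e∼f r) (sym (bump-≢ q f r r≢q)))

  Sum : ℕ → (ℕ → ℤ) → ℤ
  Sum zero    g = 0ℤ
  Sum (suc n) g = g 0 + Sum n (λ j → g (suc j))

  Sum-cong : ∀ n {g h} → (∀ j → j < n → g j ≡ h j) → Sum n g ≡ Sum n h
  Sum-cong zero    _   = refl
  Sum-cong (suc n) g≗h = cong₂ _+_ (g≗h 0 (s≤s z≤n)) (Sum-cong n (λ j j<n → g≗h (suc j) (s≤s j<n)))

  Sum-last : ∀ n g → Sum (suc n) g ≡ Sum n g + g n
  Sum-last zero    g = ℤₚ.+-comm (g 0) 0ℤ
  Sum-last (suc n) g = trans (cong (g 0 +_) (Sum-last n (λ j → g (suc j)))) (sym (ℤₚ.+-assoc (g 0) _ _))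

  ev-upTo : ∀ φ c (F : ℕ → Monomial) n → ev φ (map (λ j → (c , F j)) (upTo n)) ≡ c * Sum n (λ j → φ (F j))
  ev-upTo φ c F n = trans (cong (ev φ) (Listₚ.map-upTo (λ j → (c , F j)) n)) (go F n)
    where
    go : ∀ F n → ev φ (applyUpTo (λ j → (c , F j)) n) ≡ c * Sum n (λ j → φ (F j))
    go F zero    = sym (ℤₚ.*-zeroʳ c)
    go F (suc n) = trans (cong (λ z → c * φ (F 0) + z) (go (λ j → F (suc j)) n)) (sym (ℤₚ.*-distribˡ-+ c _ _))

  -- The value of a functional on ∂(xᵃyᵇ) when g u v is its value on xᵘyᵛ.
  half diff : (ℕ → ℕ → ℤ) → ℕ → ℕ → ℤ
  half g a b = Sum (a ∸ b) (λ j → g (a ∸ 1 ∸ j) (b ℕ.+ j))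
  diff g a b = half g a b + -1ℤ * half g b a

  diff-cong : ∀ {g h} → (∀ u v → g u v ≡ h u v) → ∀ a b → diff g a b ≡ diff h a b
  diff-cong g≗h a b = cong₂ (λ x y → x + -1ℤ * y) (Sum-cong (a ∸ b) (λ j _ → g≗h _ _)) (Sum-cong (b ∸ a) (λ j _ → g≗h _ _))

  half-≤ : ∀ g {a b} → a ≤ b → half g a b ≡ 0ℤ
  half-≤ g {a} {b} a≤b rewrite m≤n⇒m∸n≡0 a≤b = refl

  suc-∸ : ∀ {a b} → b ≤ a → suc a ∸ b ≡ suc (a ∸ b)
  suc-∸ b≤a = +-∸-assoc 1 b≤a

  half-first : ∀ g {a b} → b ≤ a → half g (suc a) b ≡ g a b + half (λ u v → g u (suc v)) a b
  half-first g {a} {b} b≤a rewrite suc-∸ b≤a = cong₂ _+_ (cong (g a) (+-identityʳ b))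
    (Sum-cong (a ∸ b) (λ j _ → cong₂ g (sym (∸-+-assoc a 1 j)) (+-suc b j)))

  half-last : ∀ g {a b} → b ≤ a → half g (suc a) b ≡ half (λ u v → g (suc u) v) a b + g b a
  half-last g {a} {b} b≤a rewrite suc-∸ b≤a =
    trans (Sum-last (a ∸ b) (λ j → g (a ∸ j) (b ℕ.+ j)))
      (cong₂ _+_ (Sum-cong (a ∸ b) (λ j j<n → cong (λ u → g u (b ℕ.+ j)) (step (<-≤-trans j<n (m∸n≤m a b)))))
                 (cong₂ g (m∸[m∸n]≡n b≤a) (m+[n∸m]≡n b≤a)))
    where
    step : ∀ {a j} → j < a → a ∸ j ≡ suc (a ∸ 1 ∸ j)
    step {suc a} {j} (s≤s j≤a) = suc-∸ j≤a

  half-last′ : ∀ g {a b} → b < a → half (λ u v → g u (suc v)) a b ≡ half g a (suc b) + g b a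
  half-last′ g {suc a} {b} (s≤s b≤a) rewrite suc-∸ b≤a =
    trans (Sum-last (a ∸ b) (λ j → g (a ∸ j) (suc (b ℕ.+ j))))
      (cong (Sum (a ∸ b) (λ j → g (a ∸ j) (suc (b ℕ.+ j))) +_)
            (cong₂ g (m∸[m∸n]≡n b≤a) (cong suc (m+[n∸m]≡n b≤a))))

  half-first′ : ∀ g {a b} → b < a → half (λ u v → g (suc u) v) a b ≡ g a b + half g a (suc b)
  half-first′ g {suc a} {b} (s≤s b≤a) rewrite suc-∸ b≤a = cong₂ _+_ (cong (g (suc a)) (+-identityʳ b))
    (Sum-cong (a ∸ b) (λ j j<n → cong₂ g (step (<-≤-trans j<n (m∸n≤m a b))) (+-suc b j)))
    where
    step : ∀ {a j} → j < a → suc (a ∸ suc j) ≡ a ∸ j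
    step {suc a} {j} (s≤s j≤a) = sym (suc-∸ j≤a)

  -- The rule ∂(x f) = f + y ∂f for f = x^a y^b. For b ≤ a the correction is a new first summand;
  -- for a < b it is the last summand that the shifted opposite half has in excess. The factor `1ℤ`
  -- gives the shape that `∂-linear` consumes.
  diff-sucˡ : ∀ g a b → diff g (suc a) b ≡ diff (λ u v → g u (suc v)) a b + 1ℤ * g a b
  diff-sucˡ g a b with ≤-<-connex b a
  ... | inj₁ b≤a = trans (cong₂ (λ x y → x + -1ℤ * y) (half-first g b≤a) (half-≤ g (m≤n⇒m≤1+n b≤a)))
      (trans (lemma (g a b) (half g′ a b)) (cong (λ y → half g′ a b + -1ℤ * y + 1ℤ * g a b) (sym (half-≤ g′ b≤a))))
    where
    g′ : ℕ → ℕ → ℤ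
    g′ u v = g u (suc v)
    lemma : ∀ x y → x + y + -1ℤ * 0ℤ ≡ y + -1ℤ * 0ℤ + 1ℤ * x
    lemma = solve-∀
  ... | inj₂ a<b = trans (cong (_+ -1ℤ * half g b (suc a)) (half-≤ g a<b))
      (trans (lemma (g a b) (half g b (suc a)))
        (cong₂ (λ x y → x + -1ℤ * y + 1ℤ * g a b) (sym (half-≤ (λ u v → g u (suc v)) (<⇒≤ a<b))) (sym (half-last′ g a<b))))
    where
    lemma : ∀ x y → 0ℤ + -1ℤ * y ≡ 0ℤ + -1ℤ * (y + x) + 1ℤ * x
    lemma = solve-∀

  diff-sucʳ : ∀ g a b → diff g a (suc b) ≡ diff (λ u v → g (suc u) v) a b + -1ℤ * g a b
  diff-sucʳ g a b with ≤-<-connex a b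
  ... | inj₁ a≤b = trans (cong₂ (λ x y → x + -1ℤ * y) (half-≤ g (m≤n⇒m≤1+n a≤b)) (half-last g a≤b))
      (trans (lemma (g a b) (half g′ b a)) (cong (λ x → x + -1ℤ * half g′ b a + -1ℤ * g a b) (sym (half-≤ g′ a≤b))))
    where
    g′ : ℕ → ℕ → ℤ
    g′ u v = g (suc u) v
    lemma : ∀ x y → 0ℤ + -1ℤ * (y + x) ≡ 0ℤ + -1ℤ * y + -1ℤ * x
    lemma = solve-∀
  ... | inj₂ b<a = trans (cong (λ y → half g a (suc b) + -1ℤ * y) (half-≤ g b<a))
      (trans (lemma (g a b) (half g a (suc b)))
        (cong₂ (λ x y → x + -1ℤ * y + -1ℤ * g a b) (sym (half-first′ g b<a)) (sym (half-≤ (λ u v → g (suc u) v) (<⇒≤ b<a)))))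
    where
    lemma : ∀ x y → y + -1ℤ * 0ℤ ≡ x + y + -1ℤ * 0ℤ + -1ℤ * x
    lemma = solve-∀

  -- The transpose of the divided difference. Transposition reverses composition: in `∂ p (∂ q φ)`
  -- it is the outer operator that hits the monomial first.
  ∂ : ℕ → (Monomial → ℤ) → Monomial → ℤ
  ∂ p φ f = ev φ (ddMono (suc p) f)

  set₂ : ℕ → Monomial → ℕ → ℕ → Monomial
  set₂ p f u v = setZ (setZ f p u) (suc p) v

  ∂-diff : ∀ p φ f → ∂ p φ f ≡ diff (λ u v → φ (set₂ p f u v)) (atZ f p) (atZ f (suc p))
  ∂-diff p φ f with atZ f p | atZ f (suc p)
  ... | a | b with b <ᵇ a in b<a
  ... | true = trans (ev-upTo φ 1ℤ (λ j → set₂ p f (a ∸ 1 ∸ j) (b ℕ.+ j)) (a ∸ b))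
      (trans (lemma (half g a b)) (cong (λ y → half g a b + -1ℤ * y) (sym (half-≤ g {b} {a} b≤a))))
    where
    g : ℕ → ℕ → ℤ
    g u v = φ (set₂ p f u v)
    b≤a = <⇒≤ (<ᵇ⇒< b a (subst T (sym b<a) tt))
    lemma : ∀ x → 1ℤ * x ≡ x + -1ℤ * 0ℤ
    lemma = solve-∀
  ... | false with a <ᵇ b in a<b
  ... | true = trans (ev-upTo φ -1ℤ (λ j → set₂ p f (b ∸ 1 ∸ j) (a ℕ.+ j)) (b ∸ a))
      (trans (lemma (half g b a)) (cong (λ x → x + -1ℤ * half g b a) (sym (half-≤ g a≤b))))
    where
    g : ℕ → ℕ → ℤ
    g u v = φ (set₂ p f u v)
    a≤b = <⇒≤ (<ᵇ⇒< a b (subst T (sym a<b) tt))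
    lemma : ∀ x → -1ℤ * x ≡ 0ℤ + -1ℤ * x
    lemma = solve-∀
  ... | false = sym (cong₂ (λ x y → x + -1ℤ * y) (half-≤ (λ u v → φ (set₂ p f u v)) (≮ a<b′)) (half-≤ (λ u v → φ (set₂ p f u v)) (≮ b<a′)))
    where
    a<b′ : ¬ (b < a)
    a<b′ h = subst T b<a (<⇒<ᵇ h)
    b<a′ : ¬ (a < b)
    b<a′ h = subst T a<b (<⇒<ᵇ h)
    ≮ : ∀ {x y} → ¬ (y < x) → x ≤ y
    ≮ = ≮⇒≥

  atZ-set₂ : ∀ p f u v r → r ≢ p → r ≢ suc p → atZ (set₂ p f u v) r ≡ atZ f r
  atZ-set₂ p f u v r r≢p r≢p′ = trans (atZ-setZ-≢ (setZ f p u) (suc p) v r r≢p′) (atZ-setZ-≢ f p u r r≢p)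

  atZ-set₂ˡ : ∀ p f u v → atZ (set₂ p f u v) p ≡ u
  atZ-set₂ˡ p f u v = trans (atZ-setZ-≢ (setZ f p u) (suc p) v p (λ ())) (atZ-setZ-≡ f p u)

  atZ-set₂ʳ : ∀ p f u v → atZ (set₂ p f u v) (suc p) ≡ v
  atZ-set₂ʳ p f u v = atZ-setZ-≡ (setZ f p u) (suc p) v

  ∼-at-two : ∀ p {e f} → atZ e p ≡ atZ f p → atZ e (suc p) ≡ atZ f (suc p) →
             (∀ r → r ≢ p → r ≢ suc p → atZ e r ≡ atZ f r) → e ∼ f
  exponent (∼-at-two p eqˡ eqʳ eq) r with r ℕ.≟ p | r ℕ.≟ suc p
  ... | yes refl | _        = eqˡ
  ... | no _     | yes refl = eqʳ
  ... | no r≢p   | no r≢p′  = eq r r≢p r≢p′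

  set₂-∼ : ∀ p {f g} u v → (∀ r → r ≢ p → r ≢ suc p → atZ f r ≡ atZ g r) → set₂ p f u v ∼ set₂ p g u v
  set₂-∼ p {f} {g} u v f∼g = ∼-at-two p
    (trans (atZ-set₂ˡ p f u v) (sym (atZ-set₂ˡ p g u v)))
    (trans (atZ-set₂ʳ p f u v) (sym (atZ-set₂ʳ p g u v)))
    (λ r r≢ r≢′ → trans (atZ-set₂ p f u v r r≢ r≢′) (trans (f∼g r r≢ r≢′) (sym (atZ-set₂ p g u v r r≢ r≢′))))

  ∂* : ℕ → Functional → Functional
  ∂* p φ = functional (∂ p (at φ)) λ {f} {g} f∼g → begin
    ∂ p (at φ) f
      ≡⟨ ∂-diff p (at φ) f ⟩
    diff (λ u v → at φ (set₂ p f u v)) (atZ f p) (atZ f (suc p))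
      ≡⟨ cong₂ (diff (λ u v → at φ (set₂ p f u v))) (exponent f∼g p) (exponent f∼g (suc p)) ⟩
    diff (λ u v → at φ (set₂ p f u v)) (atZ g p) (atZ g (suc p))
      ≡⟨ diff-cong (λ u v → respects φ (set₂-∼ p {f} {g} u v (λ r _ _ → exponent f∼g r))) (atZ g p) (atZ g (suc p)) ⟩
    diff (λ u v → at φ (set₂ p g u v)) (atZ g p) (atZ g (suc p))
      ≡⟨ sym (∂-diff p (at φ) g) ⟩
    ∂ p (at φ) g ∎
    where open ≡-Reasoning

  X* : ℕ → Functional → Functional
  X* q φ = functional (λ f → at φ (bump q f)) (λ {f} {g} f∼g → respects φ (bump-cong q {f} {g} f∼g))

  ∂-cong : ∀ p {φ ψ} → (∀ f → φ f ≡ ψ f) → ∀ f → ∂ p φ f ≡ ∂ p ψ f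
  ∂-cong p h f = ev-cong h (ddMono (suc p) f)

  ∂-linear : ∀ p {φ ψ θ} c → (∀ f → φ f ≡ ψ f + c * θ f) → ∀ f → ∂ p φ f ≡ ∂ p ψ f + c * ∂ p θ f
  ∂-linear p {φ} {ψ} {θ} c h f = trans (ev-cong h q) (trans (ev-+ ψ (λ g → c * θ g) q) (cong (λ y → ev ψ q + y) (ev-* c θ q)))
    where q = ddMono (suc p) f

  private
    bump-set₂ˡ : ∀ p f u v → set₂ p f (suc u) v ∼ bump p (set₂ p f u v)
    bump-set₂ˡ p f u v = ∼-at-two p
      (trans (atZ-set₂ˡ p f (suc u) v) (sym (trans (bump-≡ p (set₂ p f u v)) (cong suc (atZ-set₂ˡ p f u v)))))
      (trans (atZ-set₂ʳ p f (suc u) v) (sym (trans (bump-≢ p (set₂ p f u v) (suc p) (λ ())) (atZ-set₂ʳ p f u v))))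
      (λ r r≢ r≢′ → trans (atZ-set₂ p f (suc u) v r r≢ r≢′)
        (sym (trans (bump-≢ p (set₂ p f u v) r r≢) (atZ-set₂ p f u v r r≢ r≢′))))

    bump-set₂ʳ : ∀ p f u v → set₂ p f u (suc v) ∼ bump (suc p) (set₂ p f u v)
    bump-set₂ʳ p f u v = ∼-at-two p
      (trans (atZ-set₂ˡ p f u (suc v)) (sym (trans (bump-≢ (suc p) (set₂ p f u v) p (λ ())) (atZ-set₂ˡ p f u v))))
      (trans (atZ-set₂ʳ p f u (suc v)) (sym (trans (bump-≡ (suc p) (set₂ p f u v)) (cong suc (atZ-set₂ʳ p f u v)))))
      (λ r r≢ r≢′ → trans (atZ-set₂ p f u (suc v) r r≢ r≢′)
        (sym (trans (bump-≢ (suc p) (set₂ p f u v) r r≢′) (atZ-set₂ p f u v r r≢ r≢′))))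

    set₂-self : ∀ p f → set₂ p f (atZ f p) (atZ f (suc p)) ∼ f
    set₂-self p f = ∼-at-two p (atZ-set₂ˡ p f _ _) (atZ-set₂ʳ p f _ _) (atZ-set₂ p f _ _)

  -- ∂ touches two exponents only. With all others frozen, the functional becomes a function of
  -- these two, and the rule is `diff-sucˡ`.
  ∂-bumpˡ : ∀ p φ f → at (∂* p φ) (bump p f) ≡ at (∂* p (X* (suc p) φ)) f + 1ℤ * at φ f
  ∂-bumpˡ p φ f = begin
    ∂ p (at φ) (bump p f)
      ≡⟨ ∂-diff p (at φ) (bump p f) ⟩
    diff (λ u v → at φ (set₂ p (bump p f) u v)) (atZ (bump p f) p) (atZ (bump p f) (suc p))
      ≡⟨ cong₂ (diff (λ u v → at φ (set₂ p (bump p f) u v))) (bump-≡ p f) (bump-≢ p f (suc p) (λ ())) ⟩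
    diff (λ u v → at φ (set₂ p (bump p f) u v)) (suc a) b
      ≡⟨ diff-cong (λ u v → respects φ (set₂-∼ p {bump p f} {f} u v (λ r r≢p _ → bump-≢ p f r r≢p))) (suc a) b ⟩
    diff (λ u v → at φ (set₂ p f u v)) (suc a) b
      ≡⟨ diff-sucˡ (λ u v → at φ (set₂ p f u v)) a b ⟩
    diff (λ u v → at φ (set₂ p f u (suc v))) a b + 1ℤ * at φ (set₂ p f a b)
      ≡⟨ cong₂ (λ x y → x + 1ℤ * y)
           (trans (diff-cong (λ u v → respects φ (bump-set₂ʳ p f u v)) a b) (sym (∂-diff p (at (X* (suc p) φ)) f)))
           (respects φ (set₂-self p f)) ⟩
    ∂ p (at (X* (suc p) φ)) f + 1ℤ * at φ f ∎
    where
    open ≡-Reasoning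
    a = atZ f p
    b = atZ f (suc p)

  ∂-bumpʳ : ∀ p φ f → at (∂* p φ) (bump (suc p) f) ≡ at (∂* p (X* p φ)) f + -1ℤ * at φ f
  ∂-bumpʳ p φ f = begin
    ∂ p (at φ) (bump (suc p) f)
      ≡⟨ ∂-diff p (at φ) (bump (suc p) f) ⟩
    diff (λ u v → at φ (set₂ p (bump (suc p) f) u v)) (atZ (bump (suc p) f) p) (atZ (bump (suc p) f) (suc p))
      ≡⟨ cong₂ (diff (λ u v → at φ (set₂ p (bump (suc p) f) u v))) (bump-≢ (suc p) f p (λ ())) (bump-≡ (suc p) f) ⟩
    diff (λ u v → at φ (set₂ p (bump (suc p) f) u v)) a (suc b)
      ≡⟨ diff-cong (λ u v → respects φ (set₂-∼ p {bump (suc p) f} {f} u v (λ r _ r≢p → bump-≢ (suc p) f r r≢p))) a (suc b) ⟩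
    diff (λ u v → at φ (set₂ p f u v)) a (suc b)
      ≡⟨ diff-sucʳ (λ u v → at φ (set₂ p f u v)) a b ⟩
    diff (λ u v → at φ (set₂ p f (suc u) v)) a b + -1ℤ * at φ (set₂ p f a b)
      ≡⟨ cong₂ (λ x y → x + -1ℤ * y)
           (trans (diff-cong (λ u v → respects φ (bump-set₂ˡ p f u v)) a b) (sym (∂-diff p (at (X* p φ)) f)))
           (respects φ (set₂-self p f)) ⟩
    ∂ p (at (X* p φ)) f + -1ℤ * at φ f ∎
    where
    open ≡-Reasoning
    a = atZ f p
    b = atZ f (suc p)

  ∂-bump-≢ : ∀ p q φ f → q ≢ p → q ≢ suc p → at (∂* p φ) (bump q f) ≡ at (∂* p (X* q φ)) f
  ∂-bump-≢ p q φ f q≢p q≢p′ = begin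
    ∂ p (at φ) (bump q f)
      ≡⟨ ∂-diff p (at φ) (bump q f) ⟩
    diff (λ u v → at φ (set₂ p (bump q f) u v)) (atZ (bump q f) p) (atZ (bump q f) (suc p))
      ≡⟨ cong₂ (diff (λ u v → at φ (set₂ p (bump q f) u v))) (bump-≢ q f p (≢-sym q≢p)) (bump-≢ q f (suc p) (≢-sym q≢p′)) ⟩
    diff (λ u v → at φ (set₂ p (bump q f) u v)) a b
      ≡⟨ diff-cong (λ u v → respects φ (swap u v)) a b ⟩
    diff (λ u v → at φ (bump q (set₂ p f u v))) a b
      ≡⟨ sym (∂-diff p (at (X* q φ)) f) ⟩
    ∂ p (at (X* q φ)) f ∎
    where
    open ≡-Reasoning
    a = atZ f p
    b = atZ f (suc p)
    swap : ∀ u v → set₂ p (bump q f) u v ∼ bump q (set₂ p f u v)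
    exponent (swap u v) r with r ℕ.≟ q
    ... | yes refl = trans (atZ-set₂ p (bump r f) u v r q≢p q≢p′)
        (trans (bump-≡ r f) (sym (trans (bump-≡ r (set₂ p f u v)) (cong suc (atZ-set₂ p f u v r q≢p q≢p′)))))
    ... | no r≢q with r ℕ.≟ p | r ℕ.≟ suc p
    ... | yes refl | _ = trans (atZ-set₂ˡ p (bump q f) u v) (sym (trans (bump-≢ q (set₂ p f u v) r r≢q) (atZ-set₂ˡ p f u v)))
    ... | no _ | yes refl = trans (atZ-set₂ʳ p (bump q f) u v) (sym (trans (bump-≢ q (set₂ p f u v) r r≢q) (atZ-set₂ʳ p f u v)))
    ... | no r≢p | no r≢p′ = trans (atZ-set₂ p (bump q f) u v r r≢p r≢p′)
        (trans (bump-≢ q f r r≢q) (sym (trans (bump-≢ q (set₂ p f u v) r r≢q) (atZ-set₂ p f u v r r≢p r≢p′))))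

  bumps : ℕ → ℕ → Monomial → Monomial
  bumps q zero    e = e
  bumps q (suc n) e = bump q (bumps q n e)

  build : ℕ → Monomial → Monomial
  build s []       = []
  build s (x ∷ xs) = bumps s x (build (suc s) xs)

  bumps-≡ : ∀ q n e → atZ (bumps q n e) q ≡ n ℕ.+ atZ e q
  bumps-≡ q zero    e = refl
  bumps-≡ q (suc n) e = trans (bump-≡ q (bumps q n e)) (cong suc (bumps-≡ q n e))

  bumps-≢ : ∀ q n e r → r ≢ q → atZ (bumps q n e) r ≡ atZ e r
  bumps-≢ q zero    e r r≢q = refl
  bumps-≢ q (suc n) e r r≢q = trans (bump-≢ q (bumps q n e) r r≢q) (bumps-≢ q n e r r≢q)

  build-< : ∀ s xs q → q < s → atZ (build s xs) q ≡ 0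
  build-< s []       q q<s = refl
  build-< s (x ∷ xs) q q<s = trans (bumps-≢ s x _ q (<⇒≢ q<s)) (build-< (suc s) xs q (m<n⇒m<1+n q<s))

  build-+ : ∀ s xs q → atZ (build s xs) (s ℕ.+ q) ≡ atZ xs q
  build-+ s []       q       = refl
  build-+ s (x ∷ xs) zero    rewrite +-identityʳ s =
    trans (bumps-≡ s x _) (trans (cong (x ℕ.+_) (build-< (suc s) xs s (n<1+n s))) (+-identityʳ x))
  build-+ s (x ∷ xs) (suc q) rewrite +-suc s q =
    trans (bumps-≢ s x _ _ (λ eq → m+1+n≢m s (trans (+-suc s q) eq))) (build-+ (suc s) xs q)

  -- A monomial is a product of variables. Closure under `∼` is required because rebuilding an
  -- exponent list from the constant monomial loses its trailing zeros.
  monomial-induction : (P : Monomial → Set) → (∀ {e f} → e ∼ f → P e → P f) →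
                       P [] → (∀ q {e} → P e → P (bump q e)) → ∀ e → P e
  monomial-induction P P-resp P[] P-bump e = P-resp {build 0 e} {e} (same (build-+ 0 e)) (go 0 e)
    where
    go-bumps : ∀ q n {e} → P e → P (bumps q n e)
    go-bumps q zero    Pe = Pe
    go-bumps q (suc n) Pe = P-bump q (go-bumps q n Pe)
    go : ∀ s xs → P (build s xs)
    go s []       = P[]
    go s (x ∷ xs) = go-bumps s x (go (suc s) xs)

  -- The functional stays quantified inside the induction: carrying a variable past ∂ replaces φ by
  -- some `X* q φ`, where the hypothesis is then used. For the two variables that ∂ acts on, the
  -- Leibniz corrections of the two applications are ∂φ with opposite signs.
  ∂-∂ : ∀ p f φ → at (∂* p (∂* p φ)) f ≡ 0ℤ
  ∂-∂ p = monomial-induction (λ f → ∀ φ → at (∂* p (∂* p φ)) f ≡ 0ℤ)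
    (λ {e} {f} e∼f h φ → trans (sym (respects (∂* p (∂* p φ)) {e} {f} e∼f)) (h φ)) (λ φ → refl) step
    where
    cancel₁ : ∀ x y → x ≡ 0ℤ → x + -1ℤ * y + 1ℤ * y ≡ 0ℤ
    cancel₁ x y refl = lemma y
      where
      lemma : ∀ y → 0ℤ + -1ℤ * y + 1ℤ * y ≡ 0ℤ
      lemma = solve-∀
    cancel₂ : ∀ x y → x ≡ 0ℤ → x + 1ℤ * y + -1ℤ * y ≡ 0ℤ
    cancel₂ x y refl = lemma y
      where
      lemma : ∀ y → 0ℤ + 1ℤ * y + -1ℤ * y ≡ 0ℤ
      lemma = solve-∀
    step : ∀ q {e} → (∀ φ → at (∂* p (∂* p φ)) e ≡ 0ℤ) → ∀ φ → at (∂* p (∂* p φ)) (bump q e) ≡ 0ℤ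
    step q {e} h φ with q ℕ.≟ p | q ℕ.≟ suc p
    ... | yes refl | _ = trans (∂-bumpˡ p (∂* p φ) e)
        (trans (cong (_+ 1ℤ * ∂ p (at φ) e) (∂-linear p -1ℤ (∂-bumpʳ p φ) e)) (cancel₁ _ (∂ p (at φ) e) (h (X* p φ))))
    ... | no _ | yes refl = trans (∂-bumpʳ p (∂* p φ) e)
        (trans (cong (_+ -1ℤ * ∂ p (at φ) e) (∂-linear p 1ℤ (∂-bumpˡ p φ) e)) (cancel₂ _ (∂ p (at φ) e) (h (X* (suc p) φ))))
    ... | no q≢p | no q≢p′ = trans (∂-bump-≢ p q (∂* p φ) e q≢p q≢p′)
        (trans (∂-cong p (λ f → ∂-bump-≢ p q φ f q≢p q≢p′) e) (h (X* q φ)))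

  ∂-comm : ∀ p q → suc p < q → ∀ f φ → at (∂* p (∂* q φ)) f ≡ at (∂* q (∂* p φ)) f
  ∂-comm p q p<q = monomial-induction (λ f → ∀ φ → at (∂* p (∂* q φ)) f ≡ at (∂* q (∂* p φ)) f)
    (λ {e} {f} e∼f h φ → trans (sym (respects (∂* p (∂* q φ)) {e} {f} e∼f))
                       (trans (h φ) (respects (∂* q (∂* p φ)) {e} {f} e∼f))) (λ φ → refl) step
    where
    p≢q : p ≢ q
    p≢q eq = <-irrefl eq (<-trans (n<1+n p) p<q)
    p≢q′ : p ≢ suc q
    p≢q′ eq = <-irrefl eq (<-trans (n<1+n p) (m<n⇒m<1+n p<q))
    p′≢q : suc p ≢ q
    p′≢q eq = <-irrefl eq p<q
    p′≢q′ : suc p ≢ suc q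
    p′≢q′ eq = <-irrefl eq (m<n⇒m<1+n p<q)
    step : ∀ r {e} → (∀ φ → at (∂* p (∂* q φ)) e ≡ at (∂* q (∂* p φ)) e) →
           ∀ φ → at (∂* p (∂* q φ)) (bump r e) ≡ at (∂* q (∂* p φ)) (bump r e)
    step r {e} h φ with r ℕ.≟ p | r ℕ.≟ suc p
    ... | yes refl | _ = trans (∂-bumpˡ p (∂* q φ) e) (trans
        (cong (_+ 1ℤ * ∂ q (at φ) e) (trans (∂-cong p (λ f → ∂-bump-≢ q (suc p) φ f p′≢q p′≢q′) e) (h (X* (suc p) φ))))
        (sym (trans (∂-bump-≢ q p (∂* p φ) e p≢q p≢q′) (∂-linear q 1ℤ (∂-bumpˡ p φ) e))))
    ... | no _ | yes refl = trans (∂-bumpʳ p (∂* q φ) e) (trans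
        (cong (_+ -1ℤ * ∂ q (at φ) e) (trans (∂-cong p (λ f → ∂-bump-≢ q p φ f p≢q p≢q′) e) (h (X* p φ))))
        (sym (trans (∂-bump-≢ q (suc p) (∂* p φ) e p′≢q p′≢q′) (∂-linear q -1ℤ (∂-bumpʳ p φ) e))))
    ... | no r≢p | no r≢p′ with r ℕ.≟ q | r ℕ.≟ suc q
    ... | yes refl | _ = trans (∂-bump-≢ p q (∂* q φ) e r≢p r≢p′) (trans (∂-linear p 1ℤ (∂-bumpˡ q φ) e)
        (trans (cong (_+ 1ℤ * ∂ p (at φ) e) (h (X* (suc q) φ)))
        (sym (trans (∂-bumpˡ q (∂* p φ) e) (cong (_+ 1ℤ * ∂ p (at φ) e)
           (∂-cong q (λ f → ∂-bump-≢ p (suc q) φ f (≢-sym p≢q′) (≢-sym p′≢q′)) e))))))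
    ... | no _ | yes refl = trans (∂-bump-≢ p (suc q) (∂* q φ) e r≢p r≢p′) (trans (∂-linear p -1ℤ (∂-bumpʳ q φ) e)
        (trans (cong (_+ -1ℤ * ∂ p (at φ) e) (h (X* q φ)))
        (sym (trans (∂-bumpʳ q (∂* p φ) e) (cong (_+ -1ℤ * ∂ p (at φ) e)
           (∂-cong q (λ f → ∂-bump-≢ p q φ f (≢-sym p≢q) (≢-sym p′≢q)) e))))))
    ... | no r≢q | no r≢q′ = trans (∂-bump-≢ p r (∂* q φ) e r≢p r≢p′)
        (trans (∂-cong p (λ f → ∂-bump-≢ q r φ f r≢q r≢q′) e) (trans (h (X* r φ))
        (sym (trans (∂-bump-≢ q r (∂* p φ) e r≢q r≢q′) (∂-cong q (λ f → ∂-bump-≢ p r φ f r≢p r≢p′) e)))))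

  -- For each of the three variables moved by the braid, both sides produce a main term, equal by
  -- induction, and two corrections. Corrections containing a square vanish by `∂-∂`, and the others
  -- coincide.
  ∂-braid : ∀ p f φ → at (∂* p (∂* (suc p) (∂* p φ))) f ≡ at (∂* (suc p) (∂* p (∂* (suc p) φ))) f
  ∂-braid i = monomial-induction (λ f → ∀ φ → lhs φ f ≡ rhs φ f)
    (λ {e} {f} e∼f h φ → trans (sym (respects (∂* i (∂* j (∂* i φ))) {e} {f} e∼f))
                       (trans (h φ) (respects (∂* j (∂* i (∂* j φ))) {e} {f} e∼f))) (λ φ → refl) step
    where
    j = suc i
    k = suc j
    lhs rhs : Functional → Monomial → ℤ
    lhs φ f = at (∂* i (∂* j (∂* i φ))) f
    rhs φ f = at (∂* j (∂* i (∂* j φ))) f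
    i≢j : i ≢ j
    i≢j ()
    i≢k : i ≢ k
    i≢k ()
    k≢i : k ≢ i
    k≢i ()
    k≢j : k ≢ j
    k≢j eq = 1+n≢n eq
    lemma₁ : ∀ x y z w → y ≡ 0ℤ → z ≡ 0ℤ → x + 1ℤ * y + 1ℤ * w ≡ x + 1ℤ * w + 1ℤ * z
    lemma₁ x y z w refl refl = l x w
      where
      l : ∀ x w → x + 1ℤ * 0ℤ + 1ℤ * w ≡ x + 1ℤ * w + 1ℤ * 0ℤ
      l = solve-∀
    lemma₂ : ∀ x y z → x + 1ℤ * y + -1ℤ * z ≡ x + -1ℤ * z + 1ℤ * y
    lemma₂ = solve-∀
    lemma₃ : ∀ x y z w → y ≡ 0ℤ → z ≡ 0ℤ → x + -1ℤ * w + -1ℤ * y ≡ x + -1ℤ * z + -1ℤ * w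
    lemma₃ x y z w refl refl = l x w
      where
      l : ∀ x w → x + -1ℤ * w + -1ℤ * 0ℤ ≡ x + -1ℤ * 0ℤ + -1ℤ * w
      l = solve-∀
    step : ∀ r {e} → (∀ φ → lhs φ e ≡ rhs φ e) → ∀ φ → lhs φ (bump r e) ≡ rhs φ (bump r e)
    step r {e} h φ with r ℕ.≟ i | r ℕ.≟ j | r ℕ.≟ k
    ... | yes refl | _ | _ = begin
      lhs φ (bump i e)
        ≡⟨ ∂-bumpˡ i (∂* j (∂* i φ)) e ⟩
      ∂ i (at (X* j (∂* j (∂* i φ)))) e + 1ℤ * ∂ j (∂ i (at φ)) e
        ≡⟨ cong (_+ 1ℤ * ∂ j (∂ i (at φ)) e) (∂-linear i 1ℤ (λ f → trans (∂-bumpˡ j (∂* i φ) f)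
             (cong (_+ 1ℤ * ∂ i (at φ) f) (∂-cong j (λ g → ∂-bump-≢ i k φ g k≢i k≢j) f))) e) ⟩
      lhs (X* k φ) e + 1ℤ * ∂ i (∂ i (at φ)) e + 1ℤ * ∂ j (∂ i (at φ)) e
        ≡⟨ lemma₁ (lhs (X* k φ) e) _ _ (∂ j (∂ i (at φ)) e) (∂-∂ i e φ) (∂-∂ j e φ) ⟩
      lhs (X* k φ) e + 1ℤ * ∂ j (∂ i (at φ)) e + 1ℤ * ∂ j (∂ j (at φ)) e
        ≡⟨ cong (λ x → x + 1ℤ * ∂ j (∂ i (at φ)) e + 1ℤ * ∂ j (∂ j (at φ)) e) (h (X* k φ)) ⟩
      rhs (X* k φ) e + 1ℤ * ∂ j (∂ i (at φ)) e + 1ℤ * ∂ j (∂ j (at φ)) e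
        ≡⟨ cong (_+ 1ℤ * ∂ j (∂ j (at φ)) e) (sym (∂-linear j 1ℤ (∂-linear i 1ℤ (∂-bumpˡ j φ)) e)) ⟩
      ∂ j (∂ i (at (X* j (∂* j φ)))) e + 1ℤ * ∂ j (∂ j (at φ)) e
        ≡⟨ sym (trans (∂-bump-≢ j i (∂* i (∂* j φ)) e i≢j i≢k) (∂-linear j 1ℤ (∂-bumpˡ i (∂* j φ)) e)) ⟩
      rhs φ (bump i e) ∎
      where open ≡-Reasoning
    ... | no _ | yes refl | _ = begin
      lhs φ (bump j e)
        ≡⟨ ∂-bumpʳ i (∂* j (∂* i φ)) e ⟩
      ∂ i (at (X* i (∂* j (∂* i φ)))) e + -1ℤ * ∂ j (∂ i (at φ)) e
        ≡⟨ cong (_+ -1ℤ * ∂ j (∂ i (at φ)) e) (∂-linear i 1ℤ (λ f → trans (∂-bump-≢ j i (∂* i φ) f i≢j i≢k)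
             (∂-linear j 1ℤ (∂-bumpˡ i φ) f)) e) ⟩
      lhs (X* j φ) e + 1ℤ * ∂ i (∂ j (at φ)) e + -1ℤ * ∂ j (∂ i (at φ)) e
        ≡⟨ lemma₂ (lhs (X* j φ) e) (∂ i (∂ j (at φ)) e) _ ⟩
      lhs (X* j φ) e + -1ℤ * ∂ j (∂ i (at φ)) e + 1ℤ * ∂ i (∂ j (at φ)) e
        ≡⟨ cong (λ x → x + -1ℤ * ∂ j (∂ i (at φ)) e + 1ℤ * ∂ i (∂ j (at φ)) e) (h (X* j φ)) ⟩
      rhs (X* j φ) e + -1ℤ * ∂ j (∂ i (at φ)) e + 1ℤ * ∂ i (∂ j (at φ)) e
        ≡⟨ cong (_+ 1ℤ * ∂ i (∂ j (at φ)) e) (sym (∂-linear j -1ℤ (λ f → trans (∂-bump-≢ i k (∂* j φ) f k≢i k≢j)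
             (∂-linear i -1ℤ (∂-bumpʳ j φ) f)) e)) ⟩
      ∂ j (at (X* k (∂* i (∂* j φ)))) e + 1ℤ * ∂ i (∂ j (at φ)) e
        ≡⟨ sym (∂-bumpˡ j (∂* i (∂* j φ)) e) ⟩
      rhs φ (bump j e) ∎
      where open ≡-Reasoning
    ... | no _ | no _ | yes refl = begin
      lhs φ (bump k e)
        ≡⟨ ∂-bump-≢ i k (∂* j (∂* i φ)) e k≢i k≢j ⟩
      ∂ i (at (X* k (∂* j (∂* i φ)))) e
        ≡⟨ ∂-linear i -1ℤ (∂-bumpʳ j (∂* i φ)) e ⟩
      ∂ i (∂ j (at (X* j (∂* i φ)))) e + -1ℤ * ∂ i (∂ i (at φ)) e
        ≡⟨ cong (_+ -1ℤ * ∂ i (∂ i (at φ)) e) (∂-linear i -1ℤ (∂-linear j -1ℤ (∂-bumpʳ i φ)) e) ⟩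
      lhs (X* i φ) e + -1ℤ * ∂ i (∂ j (at φ)) e + -1ℤ * ∂ i (∂ i (at φ)) e
        ≡⟨ lemma₃ (lhs (X* i φ) e) _ _ (∂ i (∂ j (at φ)) e) (∂-∂ i e φ) (∂-∂ j e φ) ⟩
      lhs (X* i φ) e + -1ℤ * ∂ j (∂ j (at φ)) e + -1ℤ * ∂ i (∂ j (at φ)) e
        ≡⟨ cong (λ x → x + -1ℤ * ∂ j (∂ j (at φ)) e + -1ℤ * ∂ i (∂ j (at φ)) e) (h (X* i φ)) ⟩
      rhs (X* i φ) e + -1ℤ * ∂ j (∂ j (at φ)) e + -1ℤ * ∂ i (∂ j (at φ)) e
        ≡⟨ cong (_+ -1ℤ * ∂ i (∂ j (at φ)) e) (sym (∂-linear j -1ℤ (λ f → trans (∂-bumpʳ i (∂* j φ) f)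
             (cong (_+ -1ℤ * ∂ j (at φ) f) (∂-cong i (λ g → ∂-bump-≢ j i φ g i≢j i≢k) f))) e)) ⟩
      ∂ j (at (X* j (∂* i (∂* j φ)))) e + -1ℤ * ∂ i (∂ j (at φ)) e
        ≡⟨ sym (∂-bumpʳ j (∂* i (∂* j φ)) e) ⟩
      rhs φ (bump k e) ∎
      where open ≡-Reasoning
    ... | no r≢i | no r≢j | no r≢k =
      trans (∂-bump-≢ i r (∂* j (∂* i φ)) e r≢i r≢j)
      (trans (∂-cong i (λ f → trans (∂-bump-≢ j r (∂* i φ) f r≢j r≢k) (∂-cong j (λ g → ∂-bump-≢ i r φ g r≢i r≢j) f)) e)
      (trans (h (X* r φ))
      (sym (trans (∂-bump-≢ j r (∂* i (∂* j φ)) e r≢j r≢k)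
        (∂-cong j (λ f → trans (∂-bump-≢ i r (∂* j φ) f r≢i r≢j) (∂-cong i (λ g → ∂-bump-≢ j r φ g r≢j r≢k) f)) e)))))

open DividedDifferences

-- Products under functionals and elementary symmetric polynomials

module Products where
  open import Data.Integer using (_+_; _*_)

  ev-dd : ∀ φ p P → ev φ (dd (suc p) P) ≡ ev (∂ p φ) P
  ev-dd φ p []            = refl
  ev-dd φ p ((c , e) ∷ P) = trans (ev-++ φ (map _ (ddMono (suc p) e)) (dd (suc p) P))
    (cong₂ _+_ (ev-map φ c (λ f → f) (λ _ _ → refl) (ddMono (suc p) e)) (ev-dd φ p P))

  mulX : ℕ → Poly → Poly
  mulX q = map λ { (c , f) → (c , bump q f) }

  ev-mulX : ∀ φ q P → ev φ (mulX q P) ≡ ev (λ f → φ (bump q f)) P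
  ev-mulX φ q []            = refl
  ev-mulX φ q ((c , f) ∷ P) = cong (λ z → c * φ (bump q f) + z) (ev-mulX φ q P)

  one : Poly
  one = (1ℤ , []) ∷ []

  ev-*P : ∀ φ P Q → ev φ (P *P Q) ≡ ev (λ e → ev (λ f → φ (addMono e f)) Q) P
  ev-*P φ []            Q = refl
  ev-*P φ ((c , e) ∷ P) Q = trans (ev-++ φ (map _ Q) (P *P Q))
    (cong₂ _+_ (ev-map φ c (addMono e) (λ _ _ → refl) Q) (ev-*P φ P Q))

  atZ-addMono : ∀ e f i → atZ (addMono e f) i ≡ atZ e i ℕ.+ atZ f i
  atZ-addMono []      f       i       = refl
  atZ-addMono (x ∷ e) []      zero    = sym (+-identityʳ x)
  atZ-addMono (x ∷ e) []      (suc i) = sym (+-identityʳ (atZ e i))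
  atZ-addMono (x ∷ e) (y ∷ f) zero    = refl
  atZ-addMono (x ∷ e) (y ∷ f) (suc i) = atZ-addMono e f i

  addMono-congʳ : ∀ e {f g} → f ∼ g → addMono e f ∼ addMono e g
  exponent (addMono-congʳ e {f} {g} f∼g) i =
    trans (atZ-addMono e f i) (trans (cong (atZ e i ℕ.+_) (exponent f∼g i)) (sym (atZ-addMono e g i)))

  addMono-[]ʳ : ∀ e → addMono e [] ∼ e
  exponent (addMono-[]ʳ e) i = trans (atZ-addMono e [] i) (+-identityʳ (atZ e i))

  addMono-bump : ∀ q e f → addMono e (bump q f) ∼ bump q (addMono e f)
  exponent (addMono-bump q e f) i with i ℕ.≟ q
  ... | yes refl = trans (atZ-addMono e (bump q f) q) (trans (cong (atZ e q ℕ.+_) (bump-≡ q f))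
        (trans (+-suc (atZ e q) (atZ f q)) (sym (trans (bump-≡ q (addMono e f)) (cong suc (atZ-addMono e f q))))))
  ... | no i≢q = trans (atZ-addMono e (bump q f) i) (trans (cong (atZ e i ℕ.+_) (bump-≢ q f i i≢q))
        (sym (trans (bump-≢ q (addMono e f) i i≢q) (atZ-addMono e f i))))

  shift : Monomial → Functional → Functional
  shift e φ = functional (λ f → at φ (addMono e f)) (λ f∼g → respects φ (addMono-congʳ e f∼g))

  *P-congʳ : ∀ P {Q R} → Q ≈P R → P *P Q ≈P P *P R
  *P-congʳ P {Q} {R} Q≈R = ≈P-ext {P *P Q} {P *P R} λ φ → trans (ev-*P (at φ) P Q)
    (trans (ev-cong (λ e → ev-respects (shift e φ) {Q} {R} Q≈R) P) (sym (ev-*P (at φ) P R)))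

  ev-*P-++ : ∀ φ P Q R → ev φ (P *P (Q ++ R)) ≡ ev φ (P *P Q) + ev φ (P *P R)
  ev-*P-++ φ P Q R = begin
    ev φ (P *P (Q ++ R))
      ≡⟨ ev-*P φ P (Q ++ R) ⟩
    ev (λ e → ev (λ f → φ (addMono e f)) (Q ++ R)) P
      ≡⟨ ev-cong (λ e → ev-++ (λ f → φ (addMono e f)) Q R) P ⟩
    ev (λ e → ev (λ f → φ (addMono e f)) Q + ev (λ f → φ (addMono e f)) R) P
      ≡⟨ ev-+ _ _ P ⟩
    ev (λ e → ev (λ f → φ (addMono e f)) Q) P + ev (λ e → ev (λ f → φ (addMono e f)) R) P
      ≡⟨ cong₂ _+_ (sym (ev-*P φ P Q)) (sym (ev-*P φ P R)) ⟩
    ev φ (P *P Q) + ev φ (P *P R) ∎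
    where open ≡-Reasoning

  ev-*P-mulX : ∀ (φ : Functional) P q Q → ev (at φ) (P *P mulX q Q) ≡ ev (at (X* q φ)) (P *P Q)
  ev-*P-mulX φ P q Q = begin
    ev (at φ) (P *P mulX q Q)
      ≡⟨ ev-*P (at φ) P (mulX q Q) ⟩
    ev (λ e → ev (λ f → at φ (addMono e f)) (mulX q Q)) P
      ≡⟨ ev-cong (λ e → trans (ev-mulX _ q Q) (ev-cong (λ f → respects φ (addMono-bump q e f)) Q)) P ⟩
    ev (λ e → ev (λ f → at (X* q φ) (addMono e f)) Q) P
      ≡⟨ sym (ev-*P (at (X* q φ)) P Q) ⟩
    ev (at (X* q φ)) (P *P Q) ∎
    where open ≡-Reasoning

  ev-*P-one : ∀ (φ : Functional) P → ev (at φ) (P *P one) ≡ ev (at φ) P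
  ev-*P-one φ P = trans (ev-*P (at φ) P one)
    (ev-cong (λ e → trans (ℤₚ.+-identityʳ _) (trans (ℤₚ.*-identityˡ _) (respects φ (addMono-[]ʳ e)))) P)

  ev-*P-[] : ∀ φ P → ev φ (P *P []) ≡ 0ℤ
  ev-*P-[] φ P = trans (ev-*P φ P []) (zeros P)
    where
    zeros : ∀ P → ev (λ _ → 0ℤ) P ≡ 0ℤ
    zeros []            = refl
    zeros ((c , _) ∷ P) = trans (cong₂ _+_ (ℤₚ.*-zeroʳ c) (zeros P)) refl

  -- Splitting by the last variable x_{k+1} gives the recursion that the series of chains and the
  -- Schubert polynomials of the cycles are both shown to satisfy.
  elementary : ℕ → ℕ → Poly
  elementary zero    k       = one
  elementary (suc m) zero    = []
  elementary (suc m) (suc k) = elementary (suc m) k ++ mulX k (elementary m k)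

open Products

-- One-line notation and transpositions of positions

module OneLine where
  open import Data.Nat using (_+_; _*_)
  open import Data.Bool using (T)

  ≢⇒≡ᵇ-false : ∀ {x y} → x ≢ y → (x ≡ᵇ y) ≡ false
  ≢⇒≡ᵇ-false {x} {y} x≢y with x ≡ᵇ y in eq
  ... | false = refl
  ... | true  = ⊥-elim (x≢y (≡ᵇ-sound x y eq))

  ≤⇒≤ᵇ-true : ∀ {x y} → x ≤ y → (x ≤ᵇ y) ≡ true
  ≤⇒≤ᵇ-true {x} {y} x≤y with x ≤ᵇ y in eq
  ... | true  = refl
  ... | false = ⊥-elim (subst T eq (≤⇒≤ᵇ x≤y))

  >⇒≤ᵇ-false : ∀ {x y} → y < x → (x ≤ᵇ y) ≡ false
  >⇒≤ᵇ-false {x} {y} y<x with x ≤ᵇ y in eq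
  ... | false = refl
  ... | true  = ⊥-elim (<⇒≱ y<x (≤ᵇ⇒≤ x y (subst T (sym eq) tt)))

  <⇒<ᵇ-true : ∀ {x y} → x < y → (x <ᵇ y) ≡ true
  <⇒<ᵇ-true {x} {y} x<y with x <ᵇ y in eq
  ... | true  = refl
  ... | false = ⊥-elim (subst T eq (<⇒<ᵇ x<y))

  ≥⇒<ᵇ-false : ∀ {x y} → y ≤ x → (x <ᵇ y) ≡ false
  ≥⇒<ᵇ-false {x} {y} y≤x with x <ᵇ y in eq
  ... | false = refl
  ... | true  = ⊥-elim (<⇒≱ (<ᵇ⇒< x y (subst T (sym eq) tt)) y≤x)

  lookup1-suc : ∀ w i → lookup1 w (suc i) ≡ atZ w i
  lookup1-suc []          i       = refl
  lookup1-suc (x ∷ w)     zero    = refl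
  lookup1-suc (x ∷ w)     (suc i) = lookup1-suc w i

  app-zero : ∀ w → app w 0 ≡ 0
  app-zero []      = refl
  app-zero (x ∷ w) = refl

  app-suc : ∀ w {i} → i < length w → app w (suc i) ≡ atZ w i
  app-suc w {i} i<n rewrite <⇒<ᵇ-true i<n = lookup1-suc w i

  app-> : ∀ w {i} → length w < i → app w i ≡ i
  app-> w n<i rewrite >⇒≤ᵇ-false n<i = refl

  atZ-ext : ∀ v w → length v ≡ length w → (∀ i → i < length v → atZ v i ≡ atZ w i) → v ≡ w
  atZ-ext []      []      _  _ = refl
  atZ-ext (x ∷ v) (y ∷ w) eq h =
    cong₂ _∷_ (h 0 (s≤s z≤n)) (atZ-ext v w (suc-injective eq) (λ i i<n → h (suc i) (s≤s i<n)))

  app-ext : ∀ v w → length v ≡ length w → (∀ i → app v i ≡ app w i) → v ≡ w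
  app-ext v w eq h = atZ-ext v w eq λ i i<n →
    trans (sym (app-suc v i<n)) (trans (h (suc i)) (app-suc w (subst (i <_) eq i<n)))

  atZ-applyUpTo : ∀ f n {i} → i < n → atZ (applyUpTo f n) i ≡ f i
  atZ-applyUpTo f (suc n) {zero}  _         = refl
  atZ-applyUpTo f (suc n) {suc i} (s≤s i<n) = atZ-applyUpTo (λ j → f (suc j)) n i<n

  atZ-map-upTo : ∀ f n {i} → i < n → atZ (map f (upTo n)) i ≡ f i
  atZ-map-upTo f n {i} i<n = trans (cong (λ l → atZ l i) (Listₚ.map-upTo f n)) (atZ-applyUpTo f n i<n)

  length-map-upTo : ∀ (f : ℕ → ℕ) n → length (map f (upTo n)) ≡ n
  length-map-upTo f n = trans (Listₚ.length-map f (upTo n)) (Listₚ.length-upTo n)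

  τ : ℕ → ℕ → ℕ → ℕ
  τ a b i = if i ≡ᵇ a then b else (if i ≡ᵇ b then a else i)

  τ-left : ∀ a b → τ a b a ≡ b
  τ-left a b rewrite ≡ᵇ-refl a = refl

  τ-right : ∀ a b → τ a b b ≡ a
  τ-right a b with b ≡ᵇ a in eq
  ... | true  = ≡ᵇ-sound b a eq
  ... | false rewrite ≡ᵇ-refl b = refl

  τ-other : ∀ {a b i} → i ≢ a → i ≢ b → τ a b i ≡ i
  τ-other i≢a i≢b rewrite ≢⇒≡ᵇ-false i≢a | ≢⇒≡ᵇ-false i≢b = refl

  data Position (a b i : ℕ) : Set where
    isˡ   : i ≡ a → Position a b i
    isʳ   : i ≡ b → Position a b i
    other : i ≢ a → i ≢ b → Position a b i

  position : ∀ a b i → Position a b i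
  position a b i with i ≟ a | i ≟ b
  ... | yes i≡a | _       = isˡ i≡a
  ... | no _    | yes i≡b = isʳ i≡b
  ... | no i≢a  | no i≢b  = other i≢a i≢b

  τ-involutive : ∀ a b i → τ a b (τ a b i) ≡ i
  τ-involutive a b i with position a b i
  ... | isˡ refl       = trans (cong (τ a b) (τ-left a b)) (τ-right a b)
  ... | isʳ refl       = trans (cong (τ a b) (τ-right a b)) (τ-left a b)
  ... | other i≢a i≢b = trans (cong (τ a b) (τ-other i≢a i≢b)) (τ-other i≢a i≢b)

  τ-injective : ∀ a b {i j} → τ a b i ≡ τ a b j → i ≡ j
  τ-injective a b {i} {j} eq = trans (sym (τ-involutive a b i)) (trans (cong (τ a b) eq) (τ-involutive a b j))

  τ-conj : ∀ a b c d i → τ a b (τ c d i) ≡ τ c d (τ (τ c d a) (τ c d b) i)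
  τ-conj a b c d i with position (τ c d a) (τ c d b) i
  ... | isˡ refl = trans (cong (τ a b) (τ-involutive c d a)) (trans (τ-left a b)
      (sym (trans (cong (τ c d) (τ-left (τ c d a) (τ c d b))) (τ-involutive c d b))))
  ... | isʳ refl = trans (cong (τ a b) (τ-involutive c d b)) (trans (τ-right a b)
      (sym (trans (cong (τ c d) (τ-right (τ c d a) (τ c d b))) (τ-involutive c d a))))
  ... | other i≢a i≢b = trans (τ-other (≢-back i≢a) (≢-back i≢b)) (cong (τ c d) (sym (τ-other i≢a i≢b)))
    where
    ≢-back : ∀ {e} → i ≢ τ c d e → τ c d i ≢ e
    ≢-back i≢ eq = i≢ (trans (sym (τ-involutive c d i)) (cong (τ c d) eq))

  τ-≤ : ∀ {a b i n} → a ≤ n → b ≤ n → i ≤ n → τ a b i ≤ n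
  τ-≤ {a} {b} {i} a≤n b≤n i≤n with position a b i
  ... | isˡ refl      = subst (_≤ _) (sym (τ-left a b)) b≤n
  ... | isʳ refl      = subst (_≤ _) (sym (τ-right a b)) a≤n
  ... | other i≢a i≢b = subst (_≤ _) (sym (τ-other i≢a i≢b)) i≤n

  length-swapPos : ∀ a b w → length (swapPos a b w) ≡ length w ⊔ (a ⊔ b)
  length-swapPos a b w = length-map-upTo _ (length w ⊔ (a ⊔ b))

  length-swapPos-≤ : ∀ {a b} w → a ≤ length w → b ≤ length w → length (swapPos a b w) ≡ length w
  length-swapPos-≤ {a} {b} w a≤n b≤n = trans (length-swapPos a b w) (m≥n⇒m⊔n≡m (⊔-lub a≤n b≤n))

  app-swapPos : ∀ a b w → 1 ≤ a → 1 ≤ b → ∀ i → app (swapPos a b w) i ≡ app w (τ a b i)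
  app-swapPos (suc a) (suc b) w _ _ zero    = trans (app-zero (swapPos (suc a) (suc b) w)) (sym (app-zero w))
  app-swapPos a@(suc _) b@(suc _) w _ _ (suc i) with ≤-<-connex (suc i) (length w ⊔ (a ⊔ b))
  ... | inj₁ i<n = trans (app-suc (swapPos a b w) (subst (i <_) (sym (length-swapPos a b w)) i<n))
      (trans (atZ-map-upTo _ (length w ⊔ (a ⊔ b)) i<n) (push (suc i ≡ᵇ a) (suc i ≡ᵇ b)))
    where
    push : ∀ x y → (if x then app w b else (if y then app w a else app w (suc i))) ≡
                   app w (if x then b else (if y then a else suc i))
    push true  y     = refl
    push false true  = refl
    push false false = refl
  ... | inj₂ n≤i = trans (app-> (swapPos a b w) (subst (_< suc i) (sym (length-swapPos a b w)) n≤i))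
      (sym (trans (cong (app w) (τ-other {a} {b} i≢a i≢b)) (app-> w (≤-<-trans (m≤m⊔n (length w) (a ⊔ b)) n≤i))))
    where
    a⊔b<i = ≤-<-trans (m≤n⊔m (length w) (a ⊔ b)) n≤i
    i≢a : suc i ≢ a
    i≢a eq = <-irrefl (sym eq) (≤-<-trans (m≤m⊔n a b) a⊔b<i)
    i≢b : suc i ≢ b
    i≢b eq = <-irrefl (sym eq) (≤-<-trans (m≤n⊔m a b) a⊔b<i)

  -- Injectivity of the extension to all natural numbers encodes being a permutation: positions
  -- beyond the list are fixed, so the listed values cannot leave the range.
  Inj : List ℕ → Set
  Inj w = ∀ i j → app w i ≡ app w j → i ≡ j

  Inj-swapPos : ∀ {a b w} → 1 ≤ a → 1 ≤ b → Inj w → Inj (swapPos a b w)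
  Inj-swapPos {a} {b} {w} 1≤a 1≤b inj i j eq = τ-injective a b
    (inj (τ a b i) (τ a b j) (trans (sym (app-swapPos a b w 1≤a 1≤b i)) (trans eq (app-swapPos a b w 1≤a 1≤b j))))

  -- A value above the length would be a fixed point of the extension, hence equal to its own
  -- position by injectivity, and that position is not above the length.
  app-≤ : ∀ {w i} → Inj w → i ≤ length w → app w i ≤ length w
  app-≤ {w} {i} inj i≤n with ≤-<-connex (app w i) (length w)
  ... | inj₁ le = le
  ... | inj₂ gt = ⊥-elim (<⇒≱ (subst (length w <_) (inj (app w i) i (app-> w gt)) gt) i≤n)

  1≤τ : ∀ {a b i} → 1 ≤ a → 1 ≤ b → 1 ≤ i → 1 ≤ τ a b i
  1≤τ {a} {b} {i} 1≤a 1≤b 1≤i with position a b i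
  ... | isˡ refl      = subst (1 ≤_) (sym (τ-left a b)) 1≤b
  ... | isʳ refl      = subst (1 ≤_) (sym (τ-right a b)) 1≤a
  ... | other i≢a i≢b = subst (1 ≤_) (sym (τ-other i≢a i≢b)) 1≤i

  record InRange (w : List ℕ) (a : ℕ) : Set where
    constructor inRange
    field
      1≤ : 1 ≤ a
      ≤n : a ≤ length w
  open InRange public

  swapPos-involutive : ∀ {a b w} → InRange w a → InRange w b → swapPos a b (swapPos a b w) ≡ w
  swapPos-involutive {a} {b} {w} (inRange 1≤a a≤n) (inRange 1≤b b≤n) =
    app-ext _ w (trans (length-swapPos-≤ v (subst (a ≤_) (sym |v|) a≤n) (subst (b ≤_) (sym |v|) b≤n)) |v|)
      λ i → trans (app-swapPos a b v 1≤a 1≤b i) (trans (app-swapPos a b w 1≤a 1≤b (τ a b i)) (cong (app w) (τ-involutive a b i)))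
    where
    v = swapPos a b w
    |v| : length v ≡ length w
    |v| = length-swapPos-≤ w a≤n b≤n

  -- Transpositions of positions multiply on the right, so moving t_{c,d} to the front conjugates
  -- t_{a,b}. With all positions in range no swap lengthens the list, and equality of functions
  -- becomes equality of lists.
  swapPos-conj : ∀ a b c d w → InRange w a → InRange w b → InRange w c → InRange w d →
                 swapPos c d (swapPos a b w) ≡ swapPos (τ c d a) (τ c d b) (swapPos c d w)
  swapPos-conj a b c d w (inRange 1≤a a≤n) (inRange 1≤b b≤n) (inRange 1≤c c≤n) (inRange 1≤d d≤n) =
    app-ext _ _ (trans (len≡ c d v (le |v| c≤n) (le |v| d≤n) |v|) (sym (len≡ a′ b′ u (le |u| a′≤n) (le |u| b′≤n) |u|))) λ i →
      trans (app-swapPos c d v 1≤c 1≤d i) (trans (app-swapPos a b w 1≤a 1≤b (τ c d i))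
      (trans (cong (app w) (τ-conj a b c d i))
      (sym (trans (app-swapPos a′ b′ u (1≤τ {c} {d} 1≤c 1≤d 1≤a) (1≤τ {c} {d} 1≤c 1≤d 1≤b) i) (app-swapPos c d w 1≤c 1≤d (τ a′ b′ i))))))
    where
    v = swapPos a b w
    u = swapPos c d w
    a′ = τ c d a
    b′ = τ c d b
    a′≤n = τ-≤ {c} {d} {a} c≤n d≤n a≤n
    b′≤n = τ-≤ {c} {d} {b} c≤n d≤n b≤n
    |v| : length v ≡ length w
    |v| = length-swapPos-≤ w a≤n b≤n
    |u| : length u ≡ length w
    |u| = length-swapPos-≤ w c≤n d≤n
    le : ∀ {x y z} → x ≡ y → z ≤ y → z ≤ x
    le refl z≤y = z≤y
    len≡ : ∀ x y z → x ≤ length z → y ≤ length z → length z ≡ length w → length (swapPos x y z) ≡ length w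
    len≡ x y z x≤ y≤ eq = trans (length-swapPos-≤ z x≤ y≤) eq

  splitAt-∷ : ∀ (w : List ℕ) p → p < length w → ∃[ P ] ∃[ x ] ∃[ R ] w ≡ P ++ x ∷ R × length P ≡ p
  splitAt-∷ (x ∷ w) zero    _         = [] , x , w , refl , refl
  splitAt-∷ (x ∷ w) (suc p) (s≤s p<n) with splitAt-∷ w p p<n
  ... | P , y , R , eq , |P| = x ∷ P , y , R , cong (x ∷_) eq , cong suc |P|

  atZ-at : ∀ P (x : ℕ) R → atZ (P ++ x ∷ R) (length P) ≡ x
  atZ-at []      x R = refl
  atZ-at (_ ∷ P) x R = atZ-at P x R

  atZ-after : ∀ P (x : ℕ) R j → atZ (P ++ x ∷ R) (length P + suc j) ≡ atZ R j
  atZ-after []      x R j = refl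
  atZ-after (_ ∷ P) x R j = atZ-after P x R j

  atZ-before : ∀ P R R′ {j} → j < length P → atZ (P ++ R) j ≡ atZ (P ++ R′) j
  atZ-before (_ ∷ P) R R′ {zero}  _         = refl
  atZ-before (_ ∷ P) R R′ {suc j} (s≤s j<p) = atZ-before P R R′ j<p

  atZ-++ˡ : ∀ P R {j} → j < length P → atZ (P ++ R) j ≡ atZ P j
  atZ-++ˡ P R {j} j<p = trans (atZ-before P R [] j<p) (cong (λ l → atZ l j) (Listₚ.++-identityʳ P))

  atZ-replace : ∀ P (x x′ : ℕ) {L L′} j → j ≢ length P → (∀ i → j ≡ length P + suc i → atZ L i ≡ atZ L′ i) →
                atZ (P ++ x ∷ L) j ≡ atZ (P ++ x′ ∷ L′) j
  atZ-replace P x x′ {L} {L′} j j≢p h with <-cmp j (length P)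
  ... | tri< j<p _ _ = atZ-before P _ _ j<p
  ... | tri≈ _ j≡p _ = ⊥-elim (j≢p j≡p)
  ... | tri> _ _ p<j with m≤n⇒∃[o]m+o≡n p<j
  ...   | i , eq rewrite sym eq = subst (λ k → atZ (P ++ x ∷ L) k ≡ atZ (P ++ x′ ∷ L′) k) (+-suc (length P) i)
          (trans (atZ-after P x L i) (trans (h i (sym (+-suc (length P) i))) (sym (atZ-after P x′ L′ i))))

open OneLine

-- Inversion counts and the criterion for Bruhat covers

module Length where
  open import Data.Nat using (_+_; _*_)

  lt : ℕ → ℕ → ℕ
  lt y x = if y <ᵇ x then 1 else 0

  lt-true : ∀ {x y} → x < y → lt x y ≡ 1
  lt-true x<y rewrite <⇒<ᵇ-true x<y = refl

  lt-false : ∀ {x y} → y ≤ x → lt x y ≡ 0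
  lt-false y≤x rewrite ≥⇒<ᵇ-false y≤x = refl

  lt-monoʳ : ∀ m {x y} → x ≤ y → lt m x ≤ lt m y
  lt-monoʳ m {x} {y} x≤y with ≤-<-connex x m
  ... | inj₁ x≤m = subst (_≤ lt m y) (sym (lt-false x≤m)) z≤n
  ... | inj₂ m<x = ≤-reflexive (trans (lt-true m<x) (sym (lt-true (<-≤-trans m<x x≤y))))

  lt-antiˡ : ∀ m {x y} → x ≤ y → lt y m ≤ lt x m
  lt-antiˡ m {x} {y} x≤y with ≤-<-connex m y
  ... | inj₁ m≤y = subst (_≤ lt x m) (sym (lt-false m≤y)) z≤n
  ... | inj₂ y<m = ≤-reflexive (trans (lt-true y<m) (sym (lt-true (≤-<-trans x≤y y<m))))

  cross : List ℕ → List ℕ → ℕ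
  cross []       ys = 0
  cross (x ∷ xs) ys = countLess x ys + cross xs ys

  countLess-++ : ∀ x ys zs → countLess x (ys ++ zs) ≡ countLess x ys + countLess x zs
  countLess-++ x []       zs = refl
  countLess-++ x (y ∷ ys) zs = trans (cong (lt y x +_) (countLess-++ x ys zs)) (sym (+-assoc (lt y x) _ _))

  cross-++ : ∀ xs ys zs → cross xs (ys ++ zs) ≡ cross xs ys + cross xs zs
  cross-++ []       ys zs = refl
  cross-++ (x ∷ xs) ys zs rewrite countLess-++ x ys zs | cross-++ xs ys zs =
    lemma (countLess x ys) (countLess x zs) (cross xs ys) (cross xs zs)
    where
    lemma : ∀ a b c d → a + b + (c + d) ≡ a + c + (b + d)
    lemma = ℕSolver.solve-∀

  len-++ : ∀ xs ys → len (xs ++ ys) ≡ len xs + cross xs ys + len ys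
  len-++ []       ys = refl
  len-++ (x ∷ xs) ys rewrite countLess-++ x xs ys | len-++ xs ys =
    lemma (countLess x xs) (countLess x ys) (len xs) (cross xs ys) (len ys)
    where
    lemma : ∀ a b c d e → a + b + (c + d + e) ≡ a + c + (b + d) + e
    lemma = ℕSolver.solve-∀

  countLess-swap : ∀ p x M y R → countLess p (x ∷ M ++ y ∷ R) ≡ countLess p (y ∷ M ++ x ∷ R)
  countLess-swap p x M y R rewrite countLess-++ p M (y ∷ R) | countLess-++ p M (x ∷ R) =
    lemma (lt x p) (countLess p M) (lt y p) (countLess p R)
    where
    lemma : ∀ a b c d → a + (b + (c + d)) ≡ c + (b + (a + d))
    lemma = ℕSolver.solve-∀

  cross-swap : ∀ P x M y R → cross P (x ∷ M ++ y ∷ R) ≡ cross P (y ∷ M ++ x ∷ R)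
  cross-swap []      x M y R = refl
  cross-swap (p ∷ P) x M y R = cong₂ _+_ (countLess-swap p x M y R) (cross-swap P x M y R)

  -- The part of the inversion count of … x M y … that involves x and M, x and y, or M and y.
  inner : ℕ → List ℕ → ℕ → ℕ
  inner x M y = countLess x M + lt y x + cross M (y ∷ [])

  outer : List ℕ → ℕ → List ℕ → ℕ → List ℕ → ℕ
  outer P x M y R = len P + cross P (x ∷ M ++ y ∷ R) + (countLess x R + countLess y R + len M + cross M R + len R)

  len-split : ∀ P x M y R → len (P ++ x ∷ M ++ y ∷ R) ≡ inner x M y + outer P x M y R
  len-split P x M y R = trans (len-++ P (x ∷ M ++ y ∷ R)) (trans
    (cong₂ (λ u v → len P + C + (u + v)) (countLess-++ x M (y ∷ R))
           (trans (len-++ M (y ∷ R)) (cong (λ u → len M + u + len (y ∷ R)) (cross-++ M (y ∷ []) R))))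
    (lemma (len P) C (countLess x M) (lt y x) (countLess x R) (len M) (cross M (y ∷ [])) (cross M R) (countLess y R) (len R)))
    where
    C = cross P (x ∷ M ++ y ∷ R)
    lemma : ∀ p c a b d e f g h i → p + c + (a + (b + d) + (e + (f + g) + (h + i)))
            ≡ a + b + f + (p + c + (d + h + e + g + i))
    lemma = ℕSolver.solve-∀

  outer-swap : ∀ P x M y R → outer P x M y R ≡ outer P y M x R
  outer-swap P x M y R = cong₂ (λ u v → len P + u + (v + len M + cross M R + len R))
    (cross-swap P x M y R) (+-comm (countLess x R) (countLess y R))

  countLess-mono : ∀ M {x y} → x ≤ y → countLess x M ≤ countLess y M
  countLess-mono []      x≤y = z≤n
  countLess-mono (m ∷ M) x≤y = +-mono-≤ (lt-monoʳ m x≤y) (countLess-mono M x≤y)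

  cross-anti : ∀ M {x y} → x ≤ y → cross M (y ∷ []) ≤ cross M (x ∷ [])
  cross-anti []      x≤y = z≤n
  cross-anti (m ∷ M) x≤y = +-mono-≤ (+-monoˡ-≤ 0 (lt-antiˡ m x≤y)) (cross-anti M x≤y)

  Outside : ℕ → ℕ → ℕ → Set
  Outside x y m = m < x ⊎ y < m

  Between : ℕ → ℕ → ℕ → Set
  Between x y m = x < m × m < y

  inner-outside : ∀ M {x y} → x < y → (∀ j → j < length M → Outside x y (atZ M j)) →
                  countLess y M ≡ countLess x M × cross M (x ∷ []) ≡ cross M (y ∷ [])
  inner-outside []      x<y out = refl , refl
  inner-outside (m ∷ M) x<y out with out 0 (s≤s z≤n) | inner-outside M x<y (λ j j<n → out (suc j) (s≤s j<n))
  ... | inj₁ m<x | eq₁ , eq₂ =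
    cong₂ _+_ (trans (lt-true (<-trans m<x x<y)) (sym (lt-true m<x))) eq₁ ,
    cong₂ (λ u v → u + 0 + v) (trans (lt-false (<⇒≤ m<x)) (sym (lt-false (<⇒≤ (<-trans m<x x<y))))) eq₂
  ... | inj₂ y<m | eq₁ , eq₂ =
    cong₂ _+_ (trans (lt-false (<⇒≤ y<m)) (sym (lt-false (<⇒≤ (<-trans x<y y<m))))) eq₁ ,
    cong₂ (λ u v → u + 0 + v) (trans (lt-true (<-trans x<y y<m)) (sym (lt-true y<m))) eq₂

  countLess-between : ∀ M {x y} → x ≤ y → ∀ j → j < length M → Between x y (atZ M j) → countLess x M < countLess y M
  countLess-between (m ∷ M) x≤y zero    _         (x<m , m<y) =
    +-mono-<-≤ (≤-reflexive (trans (cong suc (lt-false (<⇒≤ x<m))) (sym (lt-true m<y)))) (countLess-mono M x≤y)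
  countLess-between (m ∷ M) x≤y (suc j) (s≤s j<n) btw =
    +-mono-≤-< (lt-monoʳ m x≤y) (countLess-between M x≤y j j<n btw)

  swap-cover : ∀ P x M y R → x < y → (∀ j → j < length M → Outside x y (atZ M j)) →
               len (P ++ y ∷ M ++ x ∷ R) ≡ suc (len (P ++ x ∷ M ++ y ∷ R))
  swap-cover P x M y R x<y out = trans (len-split P y M x R) (trans
    (cong₂ _+_ core (sym (outer-swap P x M y R))) (cong suc (sym (len-split P x M y R))))
    where
    core : inner y M x ≡ suc (inner x M y)
    core with inner-outside M x<y out
    ... | eq₁ , eq₂ rewrite eq₁ | eq₂ | lt-true x<y | lt-false (<⇒≤ x<y) = lemma (countLess x M) (cross M (y ∷ []))
      where
      lemma : ∀ a b → a + 1 + b ≡ suc (a + 0 + b)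
      lemma = ℕSolver.solve-∀

  -- The exchanged pair is itself a new inversion, and the intermediate value forms at least one
  -- more, so the length grows by at least two.
  swap-between : ∀ P x M y R → x < y → ∀ j → j < length M → Between x y (atZ M j) →
                 suc (len (P ++ x ∷ M ++ y ∷ R)) < len (P ++ y ∷ M ++ x ∷ R)
  swap-between P x M y R x<y j j<n btw
    rewrite len-split P x M y R | len-split P y M x R | outer-swap P x M y R =
    +-monoˡ-≤ (outer P y M x R) (≤-trans (≤-reflexive (cong (λ z → suc (suc (countLess x M + z + cross M (y ∷ [])))) (lt-false (<⇒≤ x<y))))
      (≤-trans (≤-reflexive (lemma (countLess x M) (cross M (y ∷ []))))
      (+-mono-≤ (+-mono-≤ (countLess-between M (<⇒≤ x<y) j j<n btw) (≤-reflexive (sym (lt-true x<y)))) (cross-anti M (<⇒≤ x<y)))))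
    where
    lemma : ∀ a b → suc (suc (a + 0 + b)) ≡ suc a + 1 + b
    lemma = ℕSolver.solve-∀

  swap-descent : ∀ P x M y R → y ≤ x → len (P ++ y ∷ M ++ x ∷ R) ≤ len (P ++ x ∷ M ++ y ∷ R)
  swap-descent P x M y R y≤x
    rewrite len-split P x M y R | len-split P y M x R | outer-swap P x M y R =
    +-monoˡ-≤ (outer P y M x R) (+-mono-≤ (+-mono-≤ (countLess-mono M y≤x)
      (subst (_≤ lt y x) (sym (lt-false y≤x)) z≤n)) (cross-anti M y≤x))

  -- The classical criterion for w t_{a,b} to cover w in Bruhat order. It is local in the values,
  -- whereas the length condition involves the whole list.
  record Cov (w : List ℕ) (a b : ℕ) : Set where
    constructor cov
    field
      rise  : app w a < app w b
      empty : ∀ i → a < i → i < b → ¬ Between (app w a) (app w b) (app w i)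
  open Cov public

  module Decomposed (P : List ℕ) (x : ℕ) (M : List ℕ) (y : ℕ) (R : List ℕ) where
    w w′ : List ℕ
    w  = P ++ x ∷ M ++ y ∷ R
    w′ = P ++ y ∷ M ++ x ∷ R
    a b : ℕ
    a = suc (length P)
    b = suc (length P + suc (length M))

    |w| : length w ≡ length P + suc (length M + suc (length R))
    |w| = trans (Listₚ.length-++ P) (cong (λ z → length P + suc z) (Listₚ.length-++ M))
    |w′| : length w′ ≡ length P + suc (length M + suc (length R))
    |w′| = trans (Listₚ.length-++ P) (cong (λ z → length P + suc z) (Listₚ.length-++ M))

    M<n : ∀ {j} → j ≤ length M → length P + suc j < length w
    M<n j≤M = subst (_ <_) (sym |w|) (+-monoʳ-< (length P) (s≤s (≤-<-trans j≤M (m<m+n (length M) (s≤s z≤n)))))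
    a≤n : a ≤ length w
    a≤n = ≤-trans (≤-reflexive (+-comm 1 (length P))) (≤-trans (+-monoʳ-≤ (length P) (s≤s z≤n)) (≤-reflexive (sym |w|)))
    b≤n : b ≤ length w
    b≤n = M<n ≤-refl

    app-a : app w a ≡ x
    app-a = trans (app-suc w a≤n) (atZ-at P x _)
    app-b : app w b ≡ y
    app-b = trans (app-suc w b≤n) (trans (atZ-after P x _ (length M)) (atZ-at M y R))
    app-M : ∀ j → j < length M → app w (suc (length P + suc j)) ≡ atZ M j
    app-M j j<M = trans (app-suc w (M<n (<⇒≤ j<M))) (trans (atZ-after P x _ j) (atZ-++ˡ M (y ∷ R) j<M))

    eq-at : ∀ j → suc j ≢ a → suc j ≢ b → atZ w j ≡ atZ w′ j
    eq-at j j≢a j≢b = atZ-replace P x y j (λ eq → j≢a (cong suc eq)) λ i eq →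
      atZ-replace M y x i (λ eq′ → j≢b (cong suc (trans eq (cong (λ z → length P + suc z) eq′)))) (λ _ _ → refl)

    swap≡ : swapPos a b w ≡ w′
    swap≡ = app-ext (swapPos a b w) w′ (trans |s| (trans |w| (sym |w′|))) λ i →
      trans (app-swapPos a b w (s≤s z≤n) (s≤s z≤n) i) (go i)
      where
      |s| : length (swapPos a b w) ≡ length w
      |s| = length-swapPos-≤ w a≤n b≤n
      w≤w′ : ∀ {z} → z ≤ length w → z ≤ length w′
      w≤w′ = subst (_ ≤_) (trans |w| (sym |w′|))
      go : ∀ i → app w (τ a b i) ≡ app w′ i
      go i with position a b i
      ... | isˡ refl = trans (cong (app w) (τ-left a b)) (trans app-b (sym (trans (app-suc w′ (w≤w′ a≤n)) (atZ-at P y _))))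
      ... | isʳ refl = trans (cong (app w) (τ-right a b)) (trans app-a
          (sym (trans (app-suc w′ (w≤w′ b≤n)) (trans (atZ-after P y _ (length M)) (atZ-at M x R)))))
      ... | other i≢a i≢b = trans (cong (app w) (τ-other i≢a i≢b)) (same-at i i≢a i≢b)
        where
        same-at : ∀ i → i ≢ a → i ≢ b → app w i ≡ app w′ i
        same-at zero    _    _    = trans (app-zero w) (sym (app-zero w′))
        same-at (suc i) i≢a i≢b with ≤-<-connex (suc i) (length w)
        ... | inj₁ i<n = trans (app-suc w i<n) (trans (eq-at i i≢a i≢b) (sym (app-suc w′ (w≤w′ i<n))))
        ... | inj₂ n≤i = trans (app-> w n≤i) (sym (app-> w′ (subst (_< suc i) (trans |w| (sym |w′|)) n≤i)))

    module _ (inj : Inj w) where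
      outside : ¬ (∃[ j ] j < length M × Between x y (atZ M j)) → ∀ j → j < length M → Outside x y (atZ M j)
      outside none j j<M with <-cmp (atZ M j) x | <-cmp (atZ M j) y
      ... | tri< m<x _ _ | _ = inj₁ m<x
      ... | tri> _ _ _ | tri> _ _ y<m = inj₂ y<m
      ... | tri> _ _ x<m | tri< m<y _ _ = ⊥-elim (none (j , j<M , x<m , m<y))
      ... | tri≈ _ m≡x _ | _ = ⊥-elim (m+1+n≢m (length P)
            (suc-injective (inj _ _ (trans (app-M j j<M) (trans m≡x (sym app-a))))))
      ... | tri> _ _ _ | tri≈ _ m≡y _ = ⊥-elim (<⇒≢ j<M (suc-injective (+-cancelˡ-≡ (length P) _ _
            (suc-injective (inj _ _ (trans (app-M j j<M) (trans m≡y (sym app-b))))))))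

      cover⇒len : Cov w a b → len (swapPos a b w) ≡ suc (len w)
      cover⇒len c = trans (cong len swap≡) (swap-cover P x M y R (subst₂ _<_ app-a app-b (rise c))
        (outside λ { (j , j<M , btw) → empty c (suc (length P + suc j)) (s≤s (m<m+n (length P) (s≤s z≤n)))
          (s≤s (+-monoʳ-< (length P) (s≤s j<M)))
          (subst₂ (λ u v → Between u v (app w (suc (length P + suc j)))) (sym app-a) (sym app-b)
            (subst (Between x y) (sym (app-M j j<M)) btw)) }))

      len⇒cover : len (swapPos a b w) ≡ suc (len w) → Cov w a b
      len⇒cover eq = cov (subst₂ _<_ (sym app-a) (sym app-b) x<y) none
        where
        eq′ : len w′ ≡ suc (len w)
        eq′ = trans (cong len (sym swap≡)) eq
        x<y : x < y
        x<y with ≤-<-connex y x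
        ... | inj₂ x<y = x<y
        ... | inj₁ y≤x = ⊥-elim (1+n≰n (≤-trans (≤-reflexive (sym eq′)) (swap-descent P x M y R y≤x)))
        none : ∀ i → a < i → i < b → ¬ Between (app w a) (app w b) (app w i)
        none i a<i i<b btw with m≤n⇒∃[o]m+o≡n a<i
        ... | j , refl = <-irrefl (sym eq′) (swap-between P x M y R x<y j j<M
            (subst (Between x y) (app-M j j<M) (subst (λ z → Between x y (app w (suc z))) (sym (+-suc (length P) j))
              (subst₂ (λ u v → Between u v (app w (suc (suc (length P + j))))) app-a app-b btw))))
          where
          j<M : j < length M
          j<M = ≤-pred (+-cancelˡ-< (length P) (suc j) (suc (length M)) (subst (_< length P + suc (length M)) (sym (+-suc (length P) j)) (≤-pred i<b)))

  -- Turns the two positions into lengths of segments, so that the inversion count can be compared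
  -- segment by segment.
  decompose : ∀ w {a b} → 1 ≤ a → a < b → b ≤ length w →
              ∃[ P ] ∃[ x ] ∃[ M ] ∃[ y ] ∃[ R ] w ≡ P ++ x ∷ M ++ y ∷ R × a ≡ suc (length P) × b ≡ suc (length P + suc (length M))
  decompose w {suc a} {suc b} _ (s≤s a<b) b≤n with splitAt-∷ w a (<-trans a<b b≤n)
  ... | P , x , L , refl , refl with m≤n⇒∃[o]m+o≡n a<b
  ... | q , refl with splitAt-∷ L q q<L
    where
    q<L : q < length L
    q<L = +-cancelˡ-< (suc (length P)) q (length L)
      (≤-trans b≤n (≤-reflexive (trans (Listₚ.length-++ P) (+-suc (length P) (length L)))))
  ... | M , y , R , refl , refl = P , x , M , y , R , refl , refl , cong suc (sym (+-suc (length P) (length M)))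

  cover⇒len : ∀ w {a b} → Inj w → 1 ≤ a → a < b → b ≤ length w → Cov w a b → len (swapPos a b w) ≡ suc (len w)
  cover⇒len w inj 1≤a a<b b≤n c with decompose w 1≤a a<b b≤n
  ... | P , x , M , y , R , refl , refl , refl = Decomposed.cover⇒len P x M y R inj c

  len⇒cover : ∀ w {a b} → Inj w → 1 ≤ a → a < b → b ≤ length w → len (swapPos a b w) ≡ suc (len w) → Cov w a b
  len⇒cover w inj 1≤a a<b b≤n eq with decompose w 1≤a a<b b≤n
  ... | P , x , M , y , R , refl , refl , refl = Decomposed.len⇒cover P x M y R inj eq

  Ascent Descent : List ℕ → ℕ → Set
  Ascent  w i = app w i < app w (suc i)
  Descent w i = app w (suc i) < app w i

  ascent⇒cover : ∀ w i → Ascent w i → Cov w i (suc i)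
  ascent⇒cover w i asc = cov asc λ j i<j j<i′ _ → <⇒≱ i<j (≤-pred j<i′)

  ascent⇒len : ∀ w {i} → Inj w → 1 ≤ i → suc i ≤ length w → Ascent w i → len (swapPos i (suc i) w) ≡ suc (len w)
  ascent⇒len w {i} inj 1≤i i<n asc = cover⇒len w inj 1≤i (n<1+n i) i<n (ascent⇒cover w i asc)

open Length

-- Schubert polynomials and independence of the chosen ascent

module Schubert where
  open import Data.Nat using (_+_; _*_)

  record Valid (n : ℕ) (w : List ℕ) : Set where
    constructor valid
    field
      size : length w ≡ n
      inj : Inj w
  open Valid public

  valid-range : ∀ {n w a} → Valid n w → 1 ≤ a → a ≤ n → InRange w a
  valid-range (valid refl _) 1≤a a≤n = inRange 1≤a a≤n

  valid-swap : ∀ {n w a b} → Valid n w → 1 ≤ a → a ≤ n → 1 ≤ b → b ≤ n → Valid n (swapPos a b w)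
  valid-swap {w = w} (valid refl inj) 1≤a a≤n 1≤b b≤n =
    valid (length-swapPos-≤ w a≤n b≤n) (Inj-swapPos {w = w} 1≤a 1≤b inj)

  app-swapˡ : ∀ a b w → 1 ≤ a → 1 ≤ b → app (swapPos a b w) a ≡ app w b
  app-swapˡ a b w 1≤a 1≤b = trans (app-swapPos a b w 1≤a 1≤b a) (cong (app w) (τ-left a b))

  app-swapʳ : ∀ a b w → 1 ≤ a → 1 ≤ b → app (swapPos a b w) b ≡ app w a
  app-swapʳ a b w 1≤a 1≤b = trans (app-swapPos a b w 1≤a 1≤b b) (cong (app w) (τ-right a b))

  app-swap-other : ∀ a b w i → 1 ≤ a → 1 ≤ b → i ≢ a → i ≢ b → app (swapPos a b w) i ≡ app w i
  app-swap-other a b w i 1≤a 1≤b i≢a i≢b = trans (app-swapPos a b w 1≤a 1≤b i) (cong (app w) (τ-other i≢a i≢b))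

  -- Indices p count from 0: s p acts on the positions p + 1, p + 2, and ∂ p on the variables x_{p+1}, x_{p+2}.
  s : ℕ → List ℕ → List ℕ
  s p = swapPos (suc p) (suc (suc p))

  valid-s : ∀ {n w} p → suc p < n → Valid n w → Valid n (s p w)
  valid-s p p<n v = valid-swap v (s≤s z≤n) (<⇒≤ p<n) (s≤s z≤n) p<n

  AtInj : List ℕ → Set
  AtInj w = ∀ i j → i < length w → j < length w → atZ w i ≡ atZ w j → i ≡ j

  valid-atInj : ∀ {n w} → Valid n w → AtInj w
  valid-atInj {w = w} v i j i<n j<n eq =
    suc-injective (inj v (suc i) (suc j) (trans (app-suc w i<n) (trans eq (sym (app-suc w j<n)))))

  tail-atInj : ∀ {x w} → AtInj (x ∷ w) → AtInj w
  tail-atInj h i j i<n j<n eq = suc-injective (h (suc i) (suc j) (s≤s i<n) (s≤s j<n) eq)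

  -- The descents before the ascent are kept as data: they give minimality here, and they keep codes
  -- weakly decreasing for dominant permutations later.
  data First : ℕ → List ℕ → Set where
    here  : ∀ {x y R} → x < y → First 0 (x ∷ y ∷ R)
    there : ∀ {p x y R} → y < x → First p (y ∷ R) → First (suc p) (x ∷ y ∷ R)

  data Decreasing : List ℕ → Set where
    []  : Decreasing []
    [-] : ∀ {x} → Decreasing (x ∷ [])
    _∷_ : ∀ {x y R} → y < x → Decreasing (y ∷ R) → Decreasing (x ∷ y ∷ R)

  firstAscent-cases : ∀ i w → AtInj w →
    (∃[ p ] firstAscent i w ≡ just (i + p) × First p w) ⊎ (firstAscent i w ≡ nothing × Decreasing w)
  firstAscent-cases i []          _ = inj₂ (refl , [])
  firstAscent-cases i (x ∷ [])    _ = inj₂ (refl , [-])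
  firstAscent-cases i (x ∷ y ∷ R) h with <-cmp x y | firstAscent-cases (suc i) (y ∷ R) (tail-atInj h)
  ... | tri< x<y _ _ | _ rewrite <⇒<ᵇ-true x<y = inj₁ (0 , cong just (sym (+-identityʳ i)) , here x<y)
  ... | tri≈ _ x≡y _ | _ = ⊥-elim (0≢1+n (h 0 1 (s≤s z≤n) (s≤s (s≤s z≤n)) x≡y))
  ... | tri> _ _ y<x | inj₁ (p , eq , fst) rewrite ≥⇒<ᵇ-false (<⇒≤ y<x) =
    inj₁ (suc p , trans eq (cong just (sym (+-suc i p))) , there y<x fst)
  ... | tri> _ _ y<x | inj₂ (eq , dec) rewrite ≥⇒<ᵇ-false (<⇒≤ y<x) = inj₂ (eq , y<x ∷ dec)

  first-bound : ∀ {p w} → First p w → suc p < length w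
  first-bound (here _)      = s≤s (s≤s z≤n)
  first-bound (there _ fst) = s≤s (first-bound fst)

  first-rise : ∀ {p w} → First p w → atZ w p < atZ w (suc p)
  first-rise (here x<y)    = x<y
  first-rise (there _ fst) = first-rise fst

  first-fall : ∀ {p w} → First p w → ∀ j → j < p → atZ w (suc j) < atZ w j
  first-fall (there y<x _)   zero    _         = y<x
  first-fall (there _   fst) (suc j) (s≤s j<p) = first-fall fst j j<p

  atZ⇒ascent : ∀ w p → suc p < length w → atZ w p < atZ w (suc p) → Ascent w (suc p)
  atZ⇒ascent w p p<n lt = subst₂ _<_ (sym (app-suc w (<⇒≤ p<n))) (sym (app-suc w p<n)) lt

  ascent⇒atZ : ∀ w p → suc p < length w → Ascent w (suc p) → atZ w p < atZ w (suc p)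
  ascent⇒atZ w p p<n asc = subst₂ _<_ (app-suc w (<⇒≤ p<n)) (app-suc w p<n) asc

  first-ascent : ∀ {p w} → First p w → Ascent w (suc p)
  first-ascent {p} {w} fst = atZ⇒ascent w p (first-bound fst) (first-rise fst)

  first-minimal : ∀ {p w} q → suc q < length w → First p w → Ascent w (suc q) → p ≤ q
  first-minimal {p} {w} q q<n fst asc with ≤-<-connex p q
  ... | inj₁ p≤q = p≤q
  ... | inj₂ q<p = ⊥-elim (<-asym (ascent⇒atZ w q q<n asc) (first-fall fst q q<p))

  len-bound : ∀ w → len w + length w ≤ length w * length w
  len-bound []      = z≤n
  len-bound (x ∷ w) = begin
    countLess x w + len w + suc (length w)   ≤⟨ +-monoˡ-≤ (suc (length w)) (+-monoˡ-≤ (len w) (countLess-≤ w)) ⟩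
    length w + len w + suc (length w)        ≡⟨ lemma₁ (length w) (len w) ⟩
    suc (length w + (len w + length w))      ≤⟨ s≤s (+-monoʳ-≤ (length w) (len-bound w)) ⟩
    suc (length w + length w * length w)     ≤⟨ s≤s (+-monoʳ-≤ (length w) (m≤n+m _ (length w))) ⟩
    suc (length w + (length w + length w * length w)) ≡⟨ lemma₂ (length w) ⟩
    suc (length w) * suc (length w) ∎
    where
    open ≤-Reasoning
    lemma₁ : ∀ n l → n + l + suc n ≡ suc (n + (l + n))
    lemma₁ = ℕSolver.solve-∀
    lemma₂ : ∀ n → suc (n + (n + n * n)) ≡ suc n * suc n
    lemma₂ = ℕSolver.solve-∀
    bit-≤ : ∀ b → (if b then 1 else 0) ≤ 1
    bit-≤ true  = ≤-refl
    bit-≤ false = z≤n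
    countLess-≤ : ∀ w → countLess x w ≤ length w
    countLess-≤ []      = z≤n
    countLess-≤ (y ∷ w) = +-mono-≤ (bit-≤ (y <ᵇ x)) (countLess-≤ w)

  len-< : ∀ {n w} → 1 ≤ n → Valid n w → len w < n * n
  len-< {suc n} {w} _ v = <-≤-trans (m<m+n (len w) (s≤s z≤n))
    (subst (λ k → len w + k ≤ k * k) (size v) (len-bound w))

  ascent-len : ∀ {n w} p → suc p < n → Valid n w → Ascent w (suc p) → len (s p w) ≡ suc (len w)
  ascent-len {w = w} p p<n (valid refl inj) asc = ascent⇒len w inj (s≤s z≤n) p<n asc

  colength-step : ∀ {n w c} p → suc p < n → Valid n w → Ascent w (suc p) → n * n ≤ suc c + len w → n * n ≤ c + len (s p w)
  colength-step {c = c} p p<n v asc le =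
    ≤-trans le (≤-reflexive (trans (sym (+-suc c _)) (cong (c +_) (sym (ascent-len p p<n v asc)))))

  -- One unfolding spends a unit of fuel and adds one inversion, so `n * n ≤ f + len w` is an
  -- invariant. It never lets the fuel run out, because `len w` stays below `n * n`.
  schubertGo-fuel : ∀ {n} f f′ w → 1 ≤ n → Valid n w → n * n ≤ f + len w → n * n ≤ f′ + len w →
                    schubertGo f w ≡ schubertGo f′ w
  schubertGo-fuel zero    f′       w 1≤n v le le′ = ⊥-elim (<⇒≱ (len-< 1≤n v) le)
  schubertGo-fuel (suc f) zero     w 1≤n v le le′ = ⊥-elim (<⇒≱ (len-< 1≤n v) le′)
  schubertGo-fuel (suc f) (suc f′) w 1≤n v le le′ with firstAscent-cases 1 w (valid-atInj v)
  ... | inj₂ (eq , _) rewrite eq = refl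
  ... | inj₁ (p , eq , fst) rewrite eq = cong (dd (suc p)) (schubertGo-fuel f f′ (s p w) 1≤n (valid-s p p<n v)
      (colength-step p p<n v (first-ascent fst) le) (colength-step p p<n v (first-ascent fst) le′))
    where
    p<n = subst (suc p <_) (size v) (first-bound fst)

  𝔖-fuel : ∀ {n} f w → 1 ≤ n → Valid n w → n * n ≤ f + len w → 𝔖 w ≡ schubertGo f w
  𝔖-fuel f w 1≤n v@(valid refl _) le = schubertGo-fuel (length w * length w) f w 1≤n v (m≤m+n _ _) le

  𝔖-first : ∀ {n p w} → Valid n w → First p w → 𝔖 w ≡ dd (suc p) (𝔖 (s p w))
  𝔖-first {n} {p} {w} v fst = trans (𝔖-fuel (suc (n * n)) w 1≤n v (m≤n⇒m≤1+n (m≤m+n _ _))) unfold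
    where
    p<n = subst (suc p <_) (size v) (first-bound fst)
    1≤n : 1 ≤ n
    1≤n = ≤-trans (s≤s z≤n) p<n
    unfold : schubertGo (suc (n * n)) w ≡ dd (suc p) (𝔖 (s p w))
    unfold with firstAscent-cases 1 w (valid-atInj v)
    ... | inj₁ (q , eq , fst′) rewrite eq | ≤-antisym (first-minimal p (first-bound fst) fst′ (first-ascent fst))
                                                    (first-minimal q (first-bound fst′) fst (first-ascent fst′)) =
          cong (dd (suc p)) (sym (𝔖-fuel (n * n) (s p w) 1≤n (valid-s p p<n v) (m≤m+n _ _)))
    ... | inj₂ (eq , dec) = ⊥-elim (no-first fst dec)
      where
      no-first : ∀ {p w} → First p w → ¬ Decreasing w
      no-first (here x<y)    (y<x ∷ _) = <-asym x<y y<x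
      no-first (there _ fst) (_ ∷ dec) = no-first fst dec

  𝔖-decreasing : ∀ {n w} → 1 ≤ n → Valid n w → Decreasing w → 𝔖 w ≡ staircase n
  𝔖-decreasing {n} {w} 1≤n v dec = trans (𝔖-fuel (suc (n * n)) w 1≤n v (m≤n⇒m≤1+n (m≤m+n _ _))) unfold
    where
    none : ∀ i {w} → Decreasing w → firstAscent i w ≡ nothing
    none i []  = refl
    none i [-] = refl
    none i (y<x ∷ dec) rewrite ≥⇒<ᵇ-false (<⇒≤ y<x) = none (suc i) dec
    unfold : schubertGo (suc (n * n)) w ≡ staircase n
    unfold rewrite none 1 dec = cong staircase (size v)

  ⟨_⟩ : Functional → List ℕ → ℤ
  ⟨ φ ⟩ w = ev (at φ) (𝔖 w)

  ⟨⟩-first : ∀ {n p w} φ → Valid n w → First p w → ⟨ φ ⟩ w ≡ ⟨ ∂* p φ ⟩ (s p w)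
  ⟨⟩-first {p = p} {w} φ v fst = trans (cong (ev (at φ)) (𝔖-first v fst)) (ev-dd (at φ) p (𝔖 (s p w)))

  app-sˡ : ∀ p w → app (s p w) (suc p) ≡ app w (suc (suc p))
  app-sˡ p w = app-swapˡ (suc p) (suc (suc p)) w (s≤s z≤n) (s≤s z≤n)

  app-sʳ : ∀ p w → app (s p w) (suc (suc p)) ≡ app w (suc p)
  app-sʳ p w = app-swapʳ (suc p) (suc (suc p)) w (s≤s z≤n) (s≤s z≤n)

  app-s-other : ∀ p w i → i ≢ suc p → i ≢ suc (suc p) → app (s p w) i ≡ app w i
  app-s-other p w i = app-swap-other (suc p) (suc (suc p)) w i (s≤s z≤n) (s≤s z≤n)

  s-conj : ∀ {n w} p q → Valid n w → suc p < n → suc q < n → ∀ r r′ → suc r ≤ n →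
           τ (suc q) (suc (suc q)) (suc p) ≡ suc r → τ (suc q) (suc (suc q)) (suc (suc p)) ≡ suc r′ →
           s q (s p w) ≡ swapPos (suc r) (suc r′) (s q w)
  s-conj {n} {w} p q v p<n q<n r r′ r≤n eq eq′ = trans
    (swapPos-conj (suc p) (suc (suc p)) (suc q) (suc (suc q)) w
       (valid-range v (s≤s z≤n) (<⇒≤ p<n)) (valid-range v (s≤s z≤n) p<n)
       (valid-range v (s≤s z≤n) (<⇒≤ q<n)) (valid-range v (s≤s z≤n) q<n))
    (cong₂ (λ a b → swapPos a b (s q w)) eq eq′)

  s-comm : ∀ {n w} p q → Valid n w → suc p < q → suc q < n → s q (s p w) ≡ s p (s q w)
  s-comm {n} {w} p q v p<q q<n = s-conj p q v (<-trans p<q (<-trans (n<1+n q) q<n)) q<n p (suc p) p<n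
    (τ-other (λ eq → <⇒≢ p<q′ (suc-injective eq)) (λ eq → <⇒≢ (m<n⇒m<1+n p<q′) (suc-injective eq)))
    (τ-other (λ eq → <⇒≢ p<q (suc-injective eq)) (λ eq → <⇒≢ (m<n⇒m<1+n p<q) (suc-injective eq)))
    where
    p<q′ : p < q
    p<q′ = <-trans (n<1+n p) p<q
    p<n : suc p ≤ n
    p<n = <⇒≤ (<-trans p<q (<-trans (n<1+n q) q<n))

  s-braid : ∀ {n w} p → Valid n w → suc (suc p) < n → s p (s (suc p) (s p w)) ≡ s (suc p) (s p (s (suc p) w))
  s-braid {n} {w} p v p<n = begin
    s p (s q (s p w))
      ≡⟨ cong (s p) (s-conj p q v (<⇒≤ p<n) p<n p (suc q) (<⇒≤ (<⇒≤ p<n))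
           (τ-other (λ eq → 1+n≢n (sym (suc-injective eq))) (λ eq → m+1+n≢n 1 {p} (sym (suc-injective eq))))
           (τ-left (suc q) (suc (suc q)))) ⟩
    s p (swapPos (suc p) (suc (suc q)) u)
      ≡⟨ swapPos-conj (suc p) (suc (suc q)) (suc p) (suc (suc p)) u (range (<⇒≤ (<⇒≤ p<n))) (range p<n)
           (range (<⇒≤ (<⇒≤ p<n))) (range (<⇒≤ p<n)) ⟩
    swapPos (τ (suc p) (suc q) (suc p)) (τ (suc p) (suc q) (suc (suc q))) (s p u)
      ≡⟨ cong₂ (λ a b → swapPos a b (s p u)) (τ-left (suc p) (suc q))
           (τ-other (λ eq → m+1+n≢n 1 {p} (suc-injective eq)) (λ eq → 1+n≢n (suc-injective eq))) ⟩
    s q (s p u) ∎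
    where
    open ≡-Reasoning
    q = suc p
    u = s q w
    range : ∀ {a} → suc a ≤ n → InRange u (suc a)
    range = valid-range (valid-s q p<n v) (s≤s z≤n)

  -- Descending induction on length, with `c` bounding the distance to the top. The definition goes
  -- through the first ascent p. For another ascent q, both sides are pushed up to a common
  -- permutation: w s_p s_q if p and q are far apart, and the top of the braid if they are adjacent.
  ⟨⟩-ascent : ∀ {n} c w → Valid n w → n * n ≤ c + len w → ∀ q → suc q < n → Ascent w (suc q) →
              ∀ φ → ⟨ φ ⟩ w ≡ ⟨ ∂* q φ ⟩ (s q w)
  ⟨⟩-ascent {suc n} zero w v le q q<n asc φ = ⊥-elim (<⇒≱ (len-< (s≤s z≤n) v) le)
  ⟨⟩-ascent {n} (suc c) w v le q q<n asc φ with firstAscent-cases 1 w (valid-atInj v)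
  ... | inj₂ (_ , dec) = ⊥-elim (no-ascent dec q (subst (suc q <_) (sym (size v)) q<n) (ascent⇒atZ w q (subst (suc q <_) (sym (size v)) q<n) asc))
    where
    no-ascent : ∀ {w} → Decreasing w → ∀ q → suc q < length w → ¬ (atZ w q < atZ w (suc q))
    no-ascent (y<x ∷ _)   zero    _         x<y = <-asym x<y y<x
    no-ascent (_   ∷ dec) (suc q) (s≤s q<n) lt  = no-ascent dec q q<n lt
  ... | inj₁ (p , _ , fst) = compare (first-minimal q (subst (suc q <_) (sym (size v)) q<n) fst asc)
    where
    p<n = subst (suc p <_) (size v) (first-bound fst)
    ascₚ = first-ascent fst
    IH : ∀ {u} r → suc r < n → Valid n u → n * n ≤ c + len u → Ascent u (suc r) → ∀ ψ → ⟨ ψ ⟩ u ≡ ⟨ ∂* r ψ ⟩ (s r u)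
    IH {u} r r<n vu le′ a ψ = ⟨⟩-ascent c u vu le′ r r<n a ψ
    vp = valid-s p p<n v
    vq = valid-s q q<n v
    le-p = colength-step p p<n v ascₚ le
    le-q = colength-step q q<n v asc le
    far : suc p < q → ⟨ φ ⟩ w ≡ ⟨ ∂* q φ ⟩ (s q w)
    far p<q = begin
      ⟨ φ ⟩ w                              ≡⟨ ⟨⟩-first φ v fst ⟩
      ⟨ ∂* p φ ⟩ (s p w)                   ≡⟨ IH q q<n vp le-p (subst₂ _<_ (sym e₁) (sym e₂) asc) (∂* p φ) ⟩
      ⟨ ∂* q (∂* p φ) ⟩ (s q (s p w))      ≡⟨ cong (⟨ ∂* q (∂* p φ) ⟩) (s-comm p q v p<q q<n) ⟩
      ⟨ ∂* q (∂* p φ) ⟩ (s p (s q w))      ≡⟨ ev-cong (λ f → sym (∂-comm p q p<q f φ)) (𝔖 (s p (s q w))) ⟩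
      ⟨ ∂* p (∂* q φ) ⟩ (s p (s q w))      ≡⟨ sym (IH p p<n vq le-q (subst₂ _<_ (sym e₃) (sym e₄) ascₚ) (∂* q φ)) ⟩
      ⟨ ∂* q φ ⟩ (s q w) ∎
      where
      open ≡-Reasoning
      p<q′ : p < q
      p<q′ = <-trans (n<1+n p) p<q
      ≢₁ : ∀ {x y} → x < y → suc x ≢ suc y
      ≢₁ x<y eq = <⇒≢ x<y (suc-injective eq)
      e₁ = app-s-other p w (suc q) (≢-sym (≢₁ p<q′)) (≢-sym (≢₁ p<q))
      e₂ = app-s-other p w (suc (suc q)) (≢-sym (≢₁ (m<n⇒m<1+n p<q′))) (≢-sym (≢₁ (m<n⇒m<1+n p<q)))
      e₃ = app-s-other q w (suc p) (≢₁ p<q′) (≢₁ (m<n⇒m<1+n p<q′))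
      e₄ = app-s-other q w (suc (suc p)) (≢₁ p<q) (≢₁ (m<n⇒m<1+n p<q))
    near : q ≡ suc p → ⟨ φ ⟩ w ≡ ⟨ ∂* q φ ⟩ (s q w)
    -- The three entries at p + 1, p + 2, p + 3 increase, so both reduced words of their reversal
    -- climb through ascents only and the induction hypothesis applies at every rung.
    near refl = begin
      ⟨ φ ⟩ w                                          ≡⟨ ⟨⟩-first φ v fst ⟩
      ⟨ ∂* p φ ⟩ (s p w)                               ≡⟨ IH q q<n vp le-p ascqp (∂* p φ) ⟩
      ⟨ ∂* q (∂* p φ) ⟩ (s q (s p w))                  ≡⟨ IH p p<n (valid-s q q<n vp) le-qp ascpqp (∂* q (∂* p φ)) ⟩
      ⟨ ∂* p (∂* q (∂* p φ)) ⟩ (s p (s q (s p w)))     ≡⟨ cong (⟨ ∂* p (∂* q (∂* p φ)) ⟩) (s-braid p v q<n) ⟩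
      ⟨ ∂* p (∂* q (∂* p φ)) ⟩ (s q (s p (s q w)))     ≡⟨ ev-cong (λ f → ∂-braid p f φ) (𝔖 (s q (s p (s q w)))) ⟩
      ⟨ ∂* q (∂* p (∂* q φ)) ⟩ (s q (s p (s q w)))     ≡⟨ sym (IH q q<n (valid-s p p<n vq) le-pq ascqpq (∂* p (∂* q φ))) ⟩
      ⟨ ∂* p (∂* q φ) ⟩ (s p (s q w))                  ≡⟨ sym (IH p p<n vq le-q ascpq (∂* q φ)) ⟩
      ⟨ ∂* q φ ⟩ (s q w) ∎
      where
      open ≡-Reasoning
      x<y : app w (suc p) < app w (suc q)
      x<y = ascₚ
      x<z : app w (suc p) < app w (suc (suc q))
      x<z = <-trans ascₚ asc
      qq≢p : suc (suc q) ≢ suc p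
      qq≢p eq = m+1+n≢n 1 {p} (suc-injective eq)
      qq≢q : suc (suc q) ≢ suc q
      qq≢q eq = 1+n≢n (suc-injective eq)
      p-last : ∀ u → app (s p u) (suc (suc q)) ≡ app u (suc (suc q))
      p-last u = app-s-other p u (suc (suc q)) qq≢p qq≢q
      q-first : ∀ u → app (s q u) (suc p) ≡ app u (suc p)
      q-first u = app-s-other q u (suc p) (λ eq → 1+n≢n (sym (suc-injective eq))) (≢-sym qq≢p)
      ascqp : Ascent (s p w) (suc q)
      ascqp = subst₂ _<_ (sym (app-sʳ p w)) (sym (p-last w)) x<z
      ascpqp : Ascent (s q (s p w)) (suc p)
      ascpqp = subst₂ _<_ (sym (trans (q-first (s p w)) (app-sˡ p w))) (sym (trans (app-sˡ q (s p w)) (p-last w))) asc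
      ascpq : Ascent (s q w) (suc p)
      ascpq = subst₂ _<_ (sym (q-first w)) (sym (app-sˡ q w)) x<z
      ascqpq : Ascent (s p (s q w)) (suc q)
      ascqpq = subst₂ _<_ (sym (trans (app-sʳ p (s q w)) (q-first w))) (sym (trans (p-last (s q w)) (app-sʳ q w))) x<y
      weaken : ∀ {u r} → n * n ≤ c + len u → len (s r u) ≡ suc (len u) → n * n ≤ c + len (s r u)
      weaken le′ eq = ≤-trans le′ (+-monoʳ-≤ c (≤-trans (n≤1+n _) (≤-reflexive (sym eq))))
      le-qp = weaken {s p w} {q} le-p (ascent-len q q<n vp ascqp)
      le-pq = weaken {s q w} {p} le-q (ascent-len p p<n vq ascpq)
    compare : p ≤ q → ⟨ φ ⟩ w ≡ ⟨ ∂* q φ ⟩ (s q w)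
    compare p≤q with m≤n⇒m<n∨m≡n p≤q
    ... | inj₂ refl = ⟨⟩-first φ v fst
    ... | inj₁ p<q with m≤n⇒m<n∨m≡n p<q
    ...   | inj₁ p<q′ = far p<q′
    ...   | inj₂ refl = near refl

  s-involutive : ∀ {n w} p → suc p < n → Valid n w → s p (s p w) ≡ w
  s-involutive p p<n v = swapPos-involutive (valid-range v (s≤s z≤n) (<⇒≤ p<n)) (valid-range v (s≤s z≤n) p<n)

  -- At an ascent 𝔖_w is itself in the image of ∂_q, and ∂_q squares to zero.
  ∂-ascent : ∀ {n w} q → suc q < n → Valid n w → Ascent w (suc q) → ∀ φ → ⟨ ∂* q φ ⟩ w ≡ 0ℤ
  ∂-ascent {n} {w} q q<n v asc φ = trans (⟨⟩-ascent (n * n) w v (m≤m+n _ _) q q<n asc (∂* q φ))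
    (zeros (𝔖 (s q w)))
    where
    zeros : ∀ P → ev (at (∂* q (∂* q φ))) P ≡ 0ℤ
    zeros []            = refl
    zeros ((c , f) ∷ P) = trans (cong₂ (λ x y → c ℤ.* x ℤ.+ y) (∂-∂ q f φ) (zeros P))
      (trans (ℤₚ.+-identityʳ _) (ℤₚ.*-zeroʳ c))

  ∂-descent : ∀ {n w} q → suc q < n → Valid n w → Descent w (suc q) → ∀ φ → ⟨ ∂* q φ ⟩ w ≡ ⟨ φ ⟩ (s q w)
  ∂-descent {n} {w} q q<n v desc φ = sym (trans
    (⟨⟩-ascent (n * n) (s q w) (valid-s q q<n v) (m≤m+n _ _) q q<n (subst₂ _<_ (sym (app-sˡ q w)) (sym (app-sʳ q w)) desc) φ)
    (cong (⟨ ∂* q φ ⟩) (s-involutive q q<n v)))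

open Schubert

-- Dominant permutations and stability under appended fixed points

module Dominant where
  open import Data.Nat using (_+_; _*_)

  sw : ℕ → List ℕ → List ℕ
  sw zero    (x ∷ y ∷ R) = y ∷ x ∷ R
  sw zero    w           = w
  sw (suc p) []          = []
  sw (suc p) (x ∷ w)     = x ∷ sw p w

  length-sw : ∀ p w → length (sw p w) ≡ length w
  length-sw zero    []          = refl
  length-sw zero    (x ∷ [])    = refl
  length-sw zero    (x ∷ y ∷ w) = refl
  length-sw (suc p) []          = refl
  length-sw (suc p) (x ∷ w)     = cong suc (length-sw p w)

  atZ-sw : ∀ p w → suc p < length w → ∀ i → atZ (sw p w) i ≡ atZ w (τ p (suc p) i)
  atZ-sw zero    (x ∷ [])    (s≤s ())
  atZ-sw zero    (x ∷ y ∷ R) _         zero          = refl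
  atZ-sw zero    (x ∷ y ∷ R) _         (suc zero)    = refl
  atZ-sw zero    (x ∷ y ∷ R) _         (suc (suc i)) = refl
  atZ-sw (suc p) (x ∷ w)     _         zero          = refl
  atZ-sw (suc p) (x ∷ w)     (s≤s p<n) (suc i) with position p (suc p) i
  ... | isˡ refl = trans (atZ-sw p w p<n p) (trans (cong (atZ w) (τ-left p (suc p))) (cong (atZ (x ∷ w)) (sym (τ-left (suc p) (suc (suc p))))))
  ... | isʳ refl = trans (atZ-sw p w p<n (suc p)) (trans (cong (atZ w) (τ-right p (suc p))) (cong (atZ (x ∷ w)) (sym (τ-right (suc p) (suc (suc p))))))
  ... | other i≢ i≢′ = trans (atZ-sw p w p<n i) (trans (cong (atZ w) (τ-other i≢ i≢′))
      (cong (atZ (x ∷ w)) (sym (τ-other (λ eq → i≢ (suc-injective eq)) (λ eq → i≢′ (suc-injective eq))))))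

  s≡sw : ∀ {n w} p → suc p < n → Valid n w → s p w ≡ sw p w
  s≡sw {n} {w} p p<n v = atZ-ext (s p w) (sw p w) (trans |s| (sym (trans (length-sw p w) (size v)))) λ i i<s →
    let i<n = subst (i <_) |s| i<s
        i<w = subst (i <_) (sym (size v)) i<n in
    trans (sym (app-suc (s p w) i<s)) (trans (app-swapPos (suc p) (suc (suc p)) w (s≤s z≤n) (s≤s z≤n) (suc i))
      (trans (at-τ i i<w) (sym (atZ-sw p w p<w i))))
    where
    p<w : suc p < length w
    p<w = subst (suc p <_) (sym (size v)) p<n
    |s| : length (s p w) ≡ n
    |s| = size (valid-s p p<n v)
    at-τ : ∀ i → i < length w → app w (τ (suc p) (suc (suc p)) (suc i)) ≡ atZ w (τ p (suc p) i)
    at-τ i i<w with position p (suc p) i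
    ... | isˡ refl = trans (cong (app w) (τ-left (suc p) (suc (suc p)))) (trans (app-suc w p<w) (cong (atZ w) (sym (τ-left p (suc p)))))
    ... | isʳ refl = trans (cong (app w) (τ-right (suc p) (suc (suc p)))) (trans (app-suc w (<⇒≤ p<w)) (cong (atZ w) (sym (τ-right p (suc p)))))
    ... | other i≢ i≢′ = trans (cong (app w) (τ-other (λ eq → i≢ (suc-injective eq)) (λ eq → i≢′ (suc-injective eq))))
        (trans (app-suc w i<w) (cong (atZ w) (sym (τ-other i≢ i≢′))))

  -- The Lehmer code. A permutation is dominant when its code is weakly decreasing, and its Schubert
  -- polynomial is then the monomial with the code as exponents.
  code : List ℕ → List ℕ
  code []      = []
  code (x ∷ w) = countLess x w ∷ code w

  countLess-sw : ∀ x p w → countLess x (sw p w) ≡ countLess x w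
  countLess-sw x zero    []          = refl
  countLess-sw x zero    (y ∷ [])    = refl
  countLess-sw x zero    (y ∷ z ∷ w) = lemma (lt y x) (lt z x) (countLess x w)
    where
    lemma : ∀ a b c → b + (a + c) ≡ a + (b + c)
    lemma a b c = trans (sym (+-assoc b a c)) (trans (cong (_+ c) (+-comm b a)) (+-assoc a b c))
  countLess-sw x (suc p) []          = refl
  countLess-sw x (suc p) (y ∷ w)     = cong (lt y x +_) (countLess-sw x p w)

  record DominantStep (p : ℕ) (w : List ℕ) : Set where
    field
      code-sw  : code (sw p w) ≡ bump p (code w)
      level    : atZ (code w) p ≡ atZ (code w) (suc p)
      dominant : WeaklyDecr (code (sw p w))
  open DominantStep

  -- At an ascent x < y the code of x is at most that of y, since y is not counted below x;
  -- dominance forces equality. The swap adds the single inversion of y with x. The strict descent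
  -- just before the ascent leaves room for the raised entry.
  dominant-step : ∀ {p w} → First p w → WeaklyDecr (code w) → DominantStep p w
  dominant-step {w = x ∷ y ∷ R} (here x<y) (y≤x , wd) = record
    { code-sw  = cong₂ (λ u v → u ∷ v ∷ code R)
        (trans (cong₂ _+_ (lt-true x<y) (sym eq)) (cong (λ z → suc (z + countLess x R)) (sym y≮x))) eq
    ; level    = trans (cong (_+ countLess x R) y≮x) eq
    ; dominant = ≤-trans (≤-reflexive eq) (m≤n+m (countLess y R) (lt x y)) ,
                 subst (λ z → WeaklyDecr (z ∷ code R)) (sym eq) wd }
    where
    y≮x : lt y x ≡ 0
    y≮x = lt-false (<⇒≤ x<y)
    eq : countLess x R ≡ countLess y R
    eq = ≤-antisym (countLess-mono R (<⇒≤ x<y)) (subst (λ z → countLess y R ≤ z + countLess x R) y≮x y≤x)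
  dominant-step {suc p} {x ∷ w} (there y<x fst) (y≤x , wd) = record
    { code-sw  = cong₂ _∷_ (countLess-sw x p w) (code-sw step)
    ; level    = level step
    ; dominant = extend fst y<x y≤x (code-sw step) (dominant step) }
    where
    step = dominant-step fst wd
    extend : ∀ {p y R} → First p (y ∷ R) → y < x → countLess y R ≤ countLess x (y ∷ R) →
             code (sw p (y ∷ R)) ≡ bump p (code (y ∷ R)) → WeaklyDecr (code (sw p (y ∷ R))) →
             WeaklyDecr (countLess x (sw p (y ∷ R)) ∷ code (sw p (y ∷ R)))
    extend {y = y} (here {y = z} {R} y<z) y<x _ eq wd′ = ≤-trans (≤-reflexive (cong (λ l → atZ l 0) eq))
      (≤-trans (+-mono-≤ (≤-reflexive (trans (cong suc (lt-false (<⇒≤ y<z))) (sym (lt-true y<x)))) (countLess-mono R (<⇒≤ y<x)))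
        (m≤n+m _ (lt z x))) , wd′
    extend {suc p} {y} (there {y = z} {R} z<y _) _ y≤x _ wd′ =
      subst₂ _≤_ (sym (countLess-sw y p (z ∷ R))) (sym (countLess-sw x (suc p) (y ∷ z ∷ R))) y≤x , wd′

  -- ∂_p kills a monomial whose two exponents agree, so only the Leibniz correction survives.
  ∂-bump-level : ∀ p (φ : Functional) f → atZ f p ≡ atZ f (suc p) → ∂ p (at φ) (bump p f) ≡ at φ f
  ∂-bump-level p φ f eq = trans (∂-bumpˡ p φ f) (trans (cong (λ z → z ℤ.+ 1ℤ ℤ.* at φ f) vanish)
    (trans (ℤₚ.+-identityˡ _) (ℤₚ.*-identityˡ _)))
    where
    lemma : ∀ x → x ℤ.+ -1ℤ ℤ.* x ≡ 0ℤ
    lemma = solve-∀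
    g : ℕ → ℕ → ℤ
    g u v = at (X* (suc p) φ) (set₂ p f u v)
    vanish : ∂ p (at (X* (suc p) φ)) f ≡ 0ℤ
    vanish = trans (∂-diff p (at (X* (suc p) φ)) f) (trans (cong (λ a → diff g a (atZ f (suc p))) eq)
      (lemma (half g (atZ f (suc p)) (atZ f (suc p)))))

  countLess-all : ∀ x w → (∀ j → j < length w → atZ w j < x) → countLess x w ≡ length w
  countLess-all x []      _ = refl
  countLess-all x (y ∷ w) h = cong₂ _+_ (lt-true (h 0 (s≤s z≤n))) (countLess-all x w (λ j j<n → h (suc j) (s≤s j<n)))

  code-decreasing : ∀ {w} → Decreasing w → code w ≡ downFrom (length w)
  code-decreasing []  = refl
  code-decreasing [-] = refl
  code-decreasing {x ∷ w} d@(_ ∷ dec) = cong₂ _∷_ (countLess-all x w (below d)) (code-decreasing dec)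
    where
    below : ∀ {x w} → Decreasing (x ∷ w) → ∀ j → j < length w → atZ w j < x
    below (y<x ∷ _)   zero    _         = y<x
    below (y<x ∷ dec) (suc j) (s≤s j<n) = <-trans (below dec j j<n) y<x

  staircase≡downFrom : ∀ n → map (λ j → n ∸ suc j) (upTo n) ≡ downFrom n
  staircase≡downFrom n = trans (Listₚ.map-upTo (λ j → n ∸ suc j) n) (go n)
    where
    go : ∀ n → applyUpTo (λ j → n ∸ suc j) n ≡ downFrom n
    go zero    = refl
    go (suc n) = cong (n ∷_) (go n)

  -- Descends from the longest element, whose code is the staircase. Each ∂_p removes precisely the
  -- variable by which the code of w s_p exceeds that of w.
  ⟨⟩-dominant : ∀ {n} c w → 1 ≤ n → Valid n w → n * n ≤ c + len w → WeaklyDecr (code w) → ∀ φ → ⟨ φ ⟩ w ≡ at φ (code w)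
  ⟨⟩-dominant zero    w 1≤n v le wd φ = ⊥-elim (<⇒≱ (len-< 1≤n v) le)
  ⟨⟩-dominant {n} (suc c) w 1≤n v le wd φ with firstAscent-cases 1 w (valid-atInj v)
  ... | inj₂ (_ , dec) = begin
      ⟨ φ ⟩ w                      ≡⟨ cong (ev (at φ)) (𝔖-decreasing 1≤n v dec) ⟩
      ev (at φ) (staircase n)      ≡⟨ trans (ℤₚ.+-identityʳ _) (ℤₚ.*-identityˡ _) ⟩
      at φ (map (λ j → n ∸ suc j) (upTo n)) ≡⟨ cong (at φ) (staircase≡downFrom n) ⟩
      at φ (downFrom n)            ≡⟨ cong (at φ) (trans (cong downFrom (sym (size v))) (sym (code-decreasing dec))) ⟩
      at φ (code w) ∎
    where open ≡-Reasoning
  ... | inj₁ (p , _ , fst) = begin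
      ⟨ φ ⟩ w                      ≡⟨ ⟨⟩-first φ v fst ⟩
      ⟨ ∂* p φ ⟩ (s p w)           ≡⟨ cong (⟨ ∂* p φ ⟩) eq ⟩
      ⟨ ∂* p φ ⟩ (sw p w)          ≡⟨ ⟨⟩-dominant c (sw p w) 1≤n (subst (Valid n) eq (valid-s p p<n v))
                                        (subst (λ u → n * n ≤ c + len u) eq (colength-step p p<n v (first-ascent fst) le))
                                        (dominant step) (∂* p φ) ⟩
      ∂ p (at φ) (code (sw p w))   ≡⟨ cong (∂ p (at φ)) (code-sw step) ⟩
      ∂ p (at φ) (bump p (code w)) ≡⟨ ∂-bump-level p φ (code w) (level step) ⟩
      at φ (code w) ∎
    where
    open ≡-Reasoning
    p<n = subst (suc p <_) (size v) (first-bound fst)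
    step = dominant-step fst wd
    eq = s≡sw p p<n v

  WD-downFrom : ∀ n → WeaklyDecr (downFrom n)
  WD-downFrom zero          = tt
  WD-downFrom (suc zero)    = tt
  WD-downFrom (suc (suc n)) = n≤1+n n , WD-downFrom (suc n)

  WD-∷ʳ-0 : ∀ xs → WeaklyDecr xs → WeaklyDecr (xs ++ 0 ∷ [])
  WD-∷ʳ-0 []           _         = tt
  WD-∷ʳ-0 (x ∷ [])     _         = z≤n , tt
  WD-∷ʳ-0 (x ∷ y ∷ xs) (y≤x , h) = y≤x , WD-∷ʳ-0 (y ∷ xs) h

  ∼-∷ʳ-0 : ∀ xs → xs ++ 0 ∷ [] ∼ xs
  exponent (∼-∷ʳ-0 xs) = go xs
    where
    go : ∀ xs i → atZ (xs ++ 0 ∷ []) i ≡ atZ xs i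
    go []       zero    = refl
    go []       (suc i) = refl
    go (x ∷ xs) zero    = refl
    go (x ∷ xs) (suc i) = go xs i

  pad : List ℕ → List ℕ
  pad w = w ++ suc (length w) ∷ []

  length-pad : ∀ w → length (pad w) ≡ suc (length w)
  length-pad w = trans (Listₚ.length-++ w) (+-comm (length w) 1)

  app-pad : ∀ w i → app (pad w) i ≡ app w i
  app-pad w zero    = trans (app-zero (pad w)) (sym (app-zero w))
  app-pad w (suc i) with <-cmp i (length w)
  ... | tri< i<n _ _ = trans (app-suc (pad w) (subst (i <_) (sym (length-pad w)) (m<n⇒m<1+n i<n)))
      (trans (atZ-++ˡ w _ i<n) (sym (app-suc w i<n)))
  ... | tri≈ _ refl _ = trans (app-suc (pad w) (subst (i <_) (sym (length-pad w)) (n<1+n i)))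
      (trans (atZ-at w _ []) (sym (app-> w (n<1+n i))))
  ... | tri> _ _ n<i = trans (app-> (pad w) (subst (_< suc i) (sym (length-pad w)) (s≤s n<i))) (sym (app-> w (m<n⇒m<1+n n<i)))

  valid-pad : ∀ {n w} → Valid n w → Valid (suc n) (pad w)
  valid-pad {n} {w} v = valid (trans (length-pad w) (cong suc (size v))) λ i j eq →
    inj v i j (trans (sym (app-pad w i)) (trans eq (app-pad w j)))

  valid-< : ∀ {n w} → Valid n w → ∀ j → j < length w → atZ w j < suc (length w)
  valid-< {w = w} v j j<n = s≤s (subst (_≤ length w) (app-suc w j<n) (app-≤ {w} (inj v) j<n))

  countLess-∷ʳ : ∀ x w {z} → x ≤ z → countLess x (w ++ z ∷ []) ≡ countLess x w
  countLess-∷ʳ x w x≤z = trans (countLess-++ x w _)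
    (trans (cong (λ k → countLess x w + (k + 0)) (lt-false x≤z)) (+-identityʳ _))

  code-∷ʳ : ∀ w {z} → (∀ j → j < length w → atZ w j < z) → code (w ++ z ∷ []) ≡ code w ++ 0 ∷ []
  code-∷ʳ []      _ = refl
  code-∷ʳ (x ∷ w) h = cong₂ _∷_ (countLess-∷ʳ x w (<⇒≤ (h 0 (s≤s z≤n)))) (code-∷ʳ w (λ j j<n → h (suc j) (s≤s j<n)))

  len-∷ʳ : ∀ w {z} → (∀ j → j < length w → atZ w j < z) → len (w ++ z ∷ []) ≡ len w
  len-∷ʳ []      _ = refl
  len-∷ʳ (x ∷ w) h = cong₂ _+_ (countLess-∷ʳ x w (<⇒≤ (h 0 (s≤s z≤n)))) (len-∷ʳ w (λ j j<n → h (suc j) (s≤s j<n)))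

  len-pad : ∀ {n w} → Valid n w → len (pad w) ≡ len w
  len-pad {w = w} v = len-∷ʳ w (valid-< v)

  first-++ : ∀ {p w} R → First p w → First p (w ++ R)
  first-++ R (here x<y)      = here x<y
  first-++ R (there y<x fst) = there y<x (first-++ R fst)

  sw-++ : ∀ {p w} R → First p w → sw p (w ++ R) ≡ sw p w ++ R
  sw-++ R (here _)              = refl
  sw-++ R (there {x = x} _ fst) = cong (x ∷_) (sw-++ R fst)

  -- As long as w has an ascent, w and `pad w` share the first one. A decreasing w has none while
  -- `pad w` may still have one at its end; there both are dominant, with codes that differ by a
  -- trailing zero.
  ⟨⟩-pad : ∀ {n} c w → 1 ≤ n → Valid n w → n * n ≤ c + len w → ∀ φ → ⟨ φ ⟩ (pad w) ≡ ⟨ φ ⟩ w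
  ⟨⟩-pad zero    w 1≤n v le φ = ⊥-elim (<⇒≱ (len-< 1≤n v) le)
  ⟨⟩-pad {n} (suc c) w 1≤n v le φ with firstAscent-cases 1 w (valid-atInj v)
  ... | inj₂ (_ , dec) = begin
      ⟨ φ ⟩ (pad w)               ≡⟨ ⟨⟩-dominant (suc n * suc n) (pad w) (s≤s z≤n) (valid-pad v) (m≤m+n _ _)
                                       (subst WeaklyDecr (sym eq) (WD-∷ʳ-0 (code w) wd)) φ ⟩
      at φ (code (pad w))         ≡⟨ cong (at φ) eq ⟩
      at φ (code w ++ 0 ∷ [])     ≡⟨ respects φ (∼-∷ʳ-0 (code w)) ⟩
      at φ (code w)               ≡⟨ sym (⟨⟩-dominant (n * n) w 1≤n v (m≤m+n _ _) wd φ) ⟩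
      ⟨ φ ⟩ w ∎
    where
    open ≡-Reasoning
    wd : WeaklyDecr (code w)
    wd = subst WeaklyDecr (sym (code-decreasing dec)) (WD-downFrom (length w))
    eq : code (pad w) ≡ code w ++ 0 ∷ []
    eq = code-∷ʳ w (valid-< v)
  ... | inj₁ (p , _ , fst) = begin
      ⟨ φ ⟩ (pad w)               ≡⟨ ⟨⟩-first φ (valid-pad v) fst′ ⟩
      ⟨ ∂* p φ ⟩ (s p (pad w))    ≡⟨ cong (⟨ ∂* p φ ⟩) eq ⟩
      ⟨ ∂* p φ ⟩ (pad (s p w))    ≡⟨ ⟨⟩-pad c (s p w) 1≤n (valid-s p p<n v) (colength-step p p<n v (first-ascent fst) le) (∂* p φ) ⟩
      ⟨ ∂* p φ ⟩ (s p w)          ≡⟨ sym (⟨⟩-first φ v fst) ⟩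
      ⟨ φ ⟩ w ∎
    where
    open ≡-Reasoning
    p<n = subst (suc p <_) (size v) (first-bound fst)
    fst′ : First p (pad w)
    fst′ = first-++ _ fst
    eq : s p (pad w) ≡ pad (s p w)
    eq = trans (s≡sw p (m<n⇒m<1+n p<n) (valid-pad v)) (trans (sw-++ _ fst)
      (cong₂ (λ u z → u ++ z ∷ []) (sym (s≡sw p p<n v)) (cong suc (trans (size v) (sym (size (valid-s p p<n v)))))))

  data Padding (v : List ℕ) : List ℕ → Set where
    done : Padding v v
    more : ∀ {w} → Padding v w → Padding v (pad w)

  padding : ∀ {n} v r → Valid n v → ∃[ w ] Padding v w × Valid (r + n) w × (∀ i → app w i ≡ app v i)
  padding v zero    vv = v , done , vv , λ _ → refl
  padding v (suc r) vv with padding v r vv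
  ... | w , pd , vw , eq = pad w , more pd , valid-pad vw , λ i → trans (app-pad w i) (eq i)

  align : ∀ {n n′ v w} → n ≤ n′ → Valid n v → Valid n′ w → (∀ i → app w i ≡ app v i) → Padding v w
  align {n} {n′} {v} {w} n≤n′ vv vw eq with padding v (n′ ∸ n) vv
  ... | w′ , pd , vw′ , eq′ = subst (Padding v) (app-ext w′ w
    (trans (size vw′) (trans (m∸n+n≡m n≤n′) (sym (size vw)))) (λ i → trans (eq′ i) (sym (eq i)))) pd

  padding-valid : ∀ {n v w} → Valid n v → Padding v w → ∃[ n′ ] n ≤ n′ × Valid n′ w
  padding-valid {n} vv done = n , ≤-refl , vv
  padding-valid vv (more pd) with padding-valid vv pd
  ... | n′ , n≤n′ , vw = suc n′ , m≤n⇒m≤1+n n≤n′ , valid-pad vw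

  padding-len : ∀ {n v w} → Valid n v → Padding v w → len w ≡ len v
  padding-len vv done      = refl
  padding-len vv (more pd) with padding-valid vv pd
  ... | _ , _ , vw = trans (len-pad vw) (padding-len vv pd)

  padding-⟨⟩ : ∀ {n v w} → 1 ≤ n → Valid n v → Padding v w → ∀ φ → ⟨ φ ⟩ w ≡ ⟨ φ ⟩ v
  padding-⟨⟩ 1≤n vv done      φ = refl
  padding-⟨⟩ 1≤n vv (more pd) φ with padding-valid vv pd
  ... | n′ , n≤n′ , vw = trans (⟨⟩-pad (n′ * n′) _ (≤-trans 1≤n n≤n′) vw (m≤m+n _ _) φ) (padding-⟨⟩ 1≤n vv pd φ)

open Dominant

-- Cover operators and their transport along an ascent

module Covers where
  open import Data.Integer using (_+_; _*_)

  opaque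
    -- Acts on functions of the permutation, so in `T a b (T c d f)` the transposition t_{a,b} is
    -- applied first.
    T : ℕ → ℕ → (List ℕ → ℤ) → List ℕ → ℤ
    T a b f w with len (swapPos a b w) ≟ suc (len w)
    ... | yes _ = f (swapPos a b w)
    ... | no  _ = 0ℤ

    T-yes : ∀ a b f w → len (swapPos a b w) ≡ suc (len w) → T a b f w ≡ f (swapPos a b w)
    T-yes a b f w eq with len (swapPos a b w) ≟ suc (len w)
    ... | yes _  = refl
    ... | no  ne = ⊥-elim (ne eq)

    T-no : ∀ a b f w → len (swapPos a b w) ≢ suc (len w) → T a b f w ≡ 0ℤ
    T-no a b f w ne with len (swapPos a b w) ≟ suc (len w)
    ... | yes eq = ⊥-elim (ne eq)
    ... | no  _  = refl

  T-cov : ∀ {n a b w} f → Valid n w → 1 ≤ a → a < b → b ≤ n → Cov w a b → T a b f w ≡ f (swapPos a b w)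
  T-cov {a = a} {b} {w} f (valid refl i) 1≤a a<b b≤n c = T-yes a b f w (cover⇒len w i 1≤a a<b b≤n c)

  T-¬cov : ∀ {n a b w} f → Valid n w → 1 ≤ a → a < b → b ≤ n → ¬ Cov w a b → T a b f w ≡ 0ℤ
  T-¬cov {a = a} {b} {w} f (valid refl i) 1≤a a<b b≤n ¬c = T-no a b f w (λ eq → ¬c (len⇒cover w i 1≤a a<b b≤n eq))

  between-or-above : ∀ {n w a b i} → Valid n w → i ≢ b → ¬ Between (app w a) (app w b) (app w i) → app w a < app w i → app w b < app w i
  between-or-above {w = w} {b = b} {i} v i≢b ¬btw a<i with <-cmp (app w i) (app w b)
  ... | tri< i<b _ _ = ⊥-elim (¬btw (a<i , i<b))
  ... | tri≈ _ eq _  = ⊥-elim (i≢b (inj v i b eq))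
  ... | tri> _ _ b<i = b<i

  between-or-below : ∀ {n w a b i} → Valid n w → i ≢ a → ¬ Between (app w a) (app w b) (app w i) → app w i < app w b → app w i < app w a
  between-or-below {w = w} {a} {b} {i} v i≢a ¬btw i<b with <-cmp (app w i) (app w a)
  ... | tri< i<a _ _ = i<a
  ... | tri≈ _ eq _  = ⊥-elim (i≢a (inj v i a eq))
  ... | tri> _ _ a<i = ⊥-elim (¬btw (a<i , i<b))

  1≤-< : ∀ {a b} → 1 ≤ a → a < b → 1 ≤ b
  1≤-< 1≤a a<b = ≤-trans 1≤a (<⇒≤ a<b)

  -- The critical cases are a = i and b = i + 1. The other position of the ascent then lies between
  -- a and b, so its value avoids the interval of exchanged values, and that is just what keeps the
  -- order.
  cover-keeps-ascent : ∀ {n w a b} i → Valid n w → 1 ≤ a → a < b → Cov w a b → Ascent w i →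
                       ¬ (a ≡ i × b ≡ suc i) → Ascent (swapPos a b w) i
  cover-keeps-ascent {n} {w} {a} {b} i v 1≤a a<b c asc ≢i =
    subst₂ _<_ (sym (app-swapPos a b w 1≤a 1≤b i)) (sym (app-swapPos a b w 1≤a 1≤b (suc i))) go
    where
    1≤b = 1≤-< 1≤a a<b
    eq< : ∀ {x y x′ y′} → x ≡ x′ → y ≡ y′ → app w x′ < app w y′ → app w x < app w y
    eq< refl refl h = h
    go : app w (τ a b i) < app w (τ a b (suc i))
    go with position a b i | position a b (suc i)
    ... | isˡ refl | isʳ refl = ⊥-elim (≢i (refl , refl))
    ... | isˡ refl | other i≢a i≢b = eq< (τ-left a b) (τ-other i≢a i≢b)
          (between-or-above {a = a} {b} {suc a} v i≢b (empty c (suc a) (n<1+n a) (≤∧≢⇒< a<b i≢b)) asc)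
    ... | isˡ refl | isˡ eq = ⊥-elim (1+n≢n eq)
    ... | isʳ refl | isˡ refl = ⊥-elim (<⇒≱ a<b (n≤1+n b))
    ... | isʳ refl | isʳ eq = ⊥-elim (1+n≢n eq)
    ... | isʳ refl | other i≢a i≢b = eq< (τ-right a b) (τ-other i≢a i≢b) (<-trans (rise c) asc)
    ... | other i≢a i≢b | isˡ refl = eq< (τ-other i≢a i≢b) (τ-left a b) (<-trans asc (rise c))
    ... | other i≢a i≢b | isʳ refl = eq< (τ-other i≢a i≢b) (τ-right a b)
          (between-or-below {a = a} {b} {i} v i≢a (empty c i (≤∧≢⇒< (≤-pred a<b) (≢-sym i≢a)) (n<1+n i)) asc)
    ... | other i≢a i≢b | other i≢a′ i≢b′ = eq< (τ-other i≢a i≢b) (τ-other i≢a′ i≢b′) asc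

  σ : ℕ → ℕ → ℕ
  σ p = τ (suc p) (suc (suc p))

  σ-mono : ∀ p {a b} → a < b → ¬ (a ≡ suc p × b ≡ suc (suc p)) → σ p a < σ p b
  σ-mono p {a} {b} a<b ≢p with position (suc p) (suc (suc p)) a | position (suc p) (suc (suc p)) b
  ... | isˡ refl | isˡ refl = ⊥-elim (<-irrefl refl a<b)
  ... | isˡ refl | isʳ refl = ⊥-elim (≢p (refl , refl))
  ... | isˡ refl | other b≢ b≢′ = subst₂ _<_ (sym (τ-left (suc p) (suc (suc p)))) (sym (τ-other b≢ b≢′)) (≤∧≢⇒< a<b (≢-sym b≢′))
  ... | isʳ refl | isˡ refl = ⊥-elim (<⇒≱ a<b (n≤1+n _))
  ... | isʳ refl | isʳ refl = ⊥-elim (<-irrefl refl a<b)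
  ... | isʳ refl | other b≢ b≢′ = subst₂ _<_ (sym (τ-right (suc p) (suc (suc p)))) (sym (τ-other b≢ b≢′)) (<-trans (n<1+n _) a<b)
  ... | other a≢ a≢′ | isˡ refl = subst₂ _<_ (sym (τ-other a≢ a≢′)) (sym (τ-left (suc p) (suc (suc p)))) (<-trans a<b (n<1+n _))
  ... | other a≢ a≢′ | isʳ refl = subst₂ _<_ (sym (τ-other a≢ a≢′)) (sym (τ-right (suc p) (suc (suc p)))) (≤∧≢⇒< (≤-pred a<b) a≢)
  ... | other a≢ a≢′ | other b≢ b≢′ = subst₂ _<_ (sym (τ-other a≢ a≢′)) (sym (τ-other b≢ b≢′)) a<b

  module AscentStep {n : ℕ} {w : List ℕ} (p : ℕ) (p<n : suc p < n) (vw : Valid n w) (asc : Ascent w (suc p)) where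
    v : List ℕ
    v = s p w
    vv : Valid n v
    vv = valid-s p p<n vw
    len-v : len v ≡ suc (len w)
    len-v = ascent-len p p<n vw asc

    module _ {a b : ℕ} (1≤a : 1 ≤ a) (a<b : a < b) (b≤n : b ≤ n) where
      private
        1≤b = 1≤-< 1≤a a<b
        a≤n = ≤-trans (<⇒≤ a<b) b≤n
        x u : List ℕ
        x = swapPos a b w
        u = swapPos (σ p a) (σ p b) v
        vx : Valid n x
        vx = valid-swap {a = a} {b} vw 1≤a a≤n 1≤b b≤n
        u≡ : s p x ≡ u
        u≡ = swapPos-conj a b (suc p) (suc (suc p)) w (valid-range vw 1≤a a≤n) (valid-range vw 1≤b b≤n)
               (valid-range vw (s≤s z≤n) (<⇒≤ p<n)) (valid-range vw (s≤s z≤n) p<n)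
        vu : Valid n u
        vu = subst (Valid n) u≡ (valid-s p p<n vx)

      -- Multiplication by s_p matches the covers of w with those of v = w s_p. If w t_{a,b} is a
      -- cover it keeps the ascent at p, so ∂_p leads back to it from the matching cover of v. A
      -- cover of v without partner has an ascent at p, and ∂_p annihilates it.
      T-transport : ∀ φ → ¬ (a ≡ suc p × b ≡ suc (suc p)) → T (σ p a) (σ p b) ⟨ ∂* p φ ⟩ v ≡ T a b ⟨ φ ⟩ w
      T-transport φ ≢p = go (len x ≟ suc (len w)) (len u ≟ suc (len v)) (<-cmp (app u (suc p)) (app u (suc (suc p))))
        where
        go : Dec (len x ≡ suc (len w)) → Dec (len u ≡ suc (len v)) → Tri _ _ _ →
             T (σ p a) (σ p b) ⟨ ∂* p φ ⟩ v ≡ T a b ⟨ φ ⟩ w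
        go (yes eq) _ _ = trans
            (T-yes (σ p a) (σ p b) ⟨ ∂* p φ ⟩ v
              (trans (cong len (sym u≡)) (trans (ascent-len p p<n vx ascx) (trans (cong suc eq) (cong suc (sym len-v))))))
            (trans (cong ⟨ ∂* p φ ⟩ (sym u≡)) (trans (∂-descent p p<n (valid-s p p<n vx) desc φ)
              (trans (cong ⟨ φ ⟩ (s-involutive p p<n vx)) (sym (T-yes a b ⟨ φ ⟩ w eq)))))
          where
          ascx : Ascent x (suc p)
          ascx = cover-keeps-ascent (suc p) vw 1≤a a<b (len⇒cover w (inj vw) 1≤a a<b (subst (b ≤_) (sym (size vw)) b≤n) eq) asc ≢p
          desc : Descent (s p x) (suc p)
          desc = subst₂ _<_ (sym (app-sʳ p x)) (sym (app-sˡ p x)) ascx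
        go (no ne) (no ne′) _ = trans (T-no (σ p a) (σ p b) ⟨ ∂* p φ ⟩ v ne′) (sym (T-no a b ⟨ φ ⟩ w ne))
        go (no ne) (yes eq) (tri< asc′ _ _) = trans (T-yes (σ p a) (σ p b) ⟨ ∂* p φ ⟩ v eq)
            (trans (∂-ascent p p<n vu asc′ φ) (sym (T-no a b ⟨ φ ⟩ w ne)))
        go (no ne) (yes eq) (tri≈ _ eq′ _) = ⊥-elim (1+n≢n (sym (suc-injective (inj vu (suc p) (suc (suc p)) eq′))))
        go (no ne) (yes eq) (tri> _ _ desc) = ⊥-elim (ne (suc-injective (trans (sym len-u) (trans eq (cong suc len-v)))))
          where
          ascx : Ascent x (suc p)
          ascx = subst₂ _<_ (trans (cong (λ z → app z (suc (suc p))) (sym u≡)) (app-sʳ p x))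
                            (trans (cong (λ z → app z (suc p)) (sym u≡)) (app-sˡ p x)) desc
          len-u : len u ≡ suc (len x)
          len-u = trans (cong len (sym u≡)) (ascent-len p p<n vx ascx)

    T-reflection-w : ∀ f → T (suc p) (suc (suc p)) f w ≡ f v
    T-reflection-w f = T-yes (suc p) (suc (suc p)) f w len-v

    T-reflection-v : ∀ f → T (suc p) (suc (suc p)) f v ≡ 0ℤ
    T-reflection-v f = T-no (suc p) (suc (suc p)) f v λ eq →
      m+1+n≢n 1 (trans (cong suc (sym len-v)) (trans (sym eq) (cong len (s-involutive p p<n vw))))

  -- The sign merges the two sums of Monk's rule into one sum over all positions j, which s_p merely
  -- permutes.
  term : ℕ → ℕ → (List ℕ → ℤ) → List ℕ → ℤ
  term k j f w with <-cmp k j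
  ... | tri< _ _ _ = T k j f w
  ... | tri≈ _ _ _ = 0ℤ
  ... | tri> _ _ _ = -1ℤ * T j k f w

  term-< : ∀ {k j} f w → k < j → term k j f w ≡ T k j f w
  term-< {k} {j} f w k<j with <-cmp k j
  ... | tri< _ _ _   = refl
  ... | tri≈ k≮j _ _ = ⊥-elim (k≮j k<j)
  ... | tri> k≮j _ _ = ⊥-elim (k≮j k<j)

  term-> : ∀ {k j} f w → j < k → term k j f w ≡ -1ℤ * T j k f w
  term-> {k} {j} f w j<k with <-cmp k j
  ... | tri< _ _ j≮k = ⊥-elim (j≮k j<k)
  ... | tri≈ _ _ j≮k = ⊥-elim (j≮k j<k)
  ... | tri> _ _ _   = refl

  term-refl : ∀ k f w → term k k f w ≡ 0ℤ
  term-refl k f w with <-cmp k k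
  ... | tri< k<k _ _ = ⊥-elim (<-irrefl refl k<k)
  ... | tri≈ _ _ _   = refl
  ... | tri> _ _ k<k = ⊥-elim (<-irrefl refl k<k)

  Sum-+ : ∀ n g h → Sum n (λ j → g j + h j) ≡ Sum n g + Sum n h
  Sum-+ zero    g h = refl
  Sum-+ (suc n) g h = trans (cong (g 0 + h 0 +_) (Sum-+ n (λ j → g (suc j)) (λ j → h (suc j))))
    (lemma (g 0) (h 0) (Sum n (λ j → g (suc j))) (Sum n (λ j → h (suc j))))
    where
    lemma : ∀ a b c d → a + b + (c + d) ≡ a + c + (b + d)
    lemma = solve-∀

  Sum-zero : ∀ n {g} → (∀ j → j < n → g j ≡ 0ℤ) → Sum n g ≡ 0ℤ
  Sum-zero zero    _ = refl
  Sum-zero (suc n) h = cong₂ _+_ (h 0 (s≤s z≤n)) (Sum-zero n (λ j j<n → h (suc j) (s≤s j<n)))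

  Sum-single : ∀ n {g} p → p < n → (∀ j → j < n → j ≢ p → g j ≡ 0ℤ) → Sum n g ≡ g p
  Sum-single (suc n) {g} zero    _         h = trans (cong (g 0 +_) (Sum-zero n (λ j j<n → h (suc j) (s≤s j<n) (λ ())))) (ℤₚ.+-identityʳ (g 0))
  Sum-single (suc n) {g} (suc p) (s≤s p<n) h = trans (cong₂ _+_ (h 0 (s≤s z≤n) (λ ()))
    (Sum-single n {λ j → g (suc j)} p p<n (λ j j<n j≢p → h (suc j) (s≤s j<n) (λ eq → j≢p (suc-injective eq))))) (ℤₚ.+-identityˡ (g (suc p)))

  τ-suc : ∀ a b i → τ (suc a) (suc b) (suc i) ≡ suc (τ a b i)
  τ-suc a b i with position a b i
  ... | isˡ refl = trans (τ-left (suc a) (suc b)) (cong suc (sym (τ-left a b)))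
  ... | isʳ refl = trans (τ-right (suc a) (suc b)) (cong suc (sym (τ-right a b)))
  ... | other i≢a i≢b = trans (τ-other (λ eq → i≢a (suc-injective eq)) (λ eq → i≢b (suc-injective eq))) (cong suc (sym (τ-other i≢a i≢b)))

  Sum-τ : ∀ n p g → suc p < n → Sum n (λ j → g (τ p (suc p) j)) ≡ Sum n g
  Sum-τ (suc zero)    zero    g (s≤s ())
  Sum-τ (suc (suc n)) zero    g _ = lemma (g 0) (g 1) (Sum n (λ j → g (suc (suc j))))
    where
    lemma : ∀ a b c → b + (a + c) ≡ a + (b + c)
    lemma = solve-∀
  Sum-τ (suc n) (suc p) g (s≤s p<n) = cong (g 0 +_)
    (trans (Sum-cong n (λ j _ → cong g (τ-suc p (suc p) j))) (Sum-τ n p (λ j → g (suc j)) p<n))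

open Covers

-- Monk's rule

module Monk where
  open import Data.Integer using (_+_; _*_)

  module MonkStep {n : ℕ} {w : List ℕ} (p : ℕ) (p<n : suc p < n) (vw : Valid n w) (asc : Ascent w (suc p)) (φ : Functional) where
    open AscentStep p p<n vw asc

    σ-left : σ p (suc p) ≡ suc (suc p)
    σ-left = τ-left (suc p) (suc (suc p))
    σ-right : σ p (suc (suc p)) ≡ suc p
    σ-right = τ-right (suc p) (suc (suc p))

    term-transport : ∀ {k j} → 1 ≤ k → k ≤ n → 1 ≤ j → j ≤ n →
                     ¬ (k ≡ suc p × j ≡ suc (suc p)) → ¬ (j ≡ suc p × k ≡ suc (suc p)) →
                     term (σ p k) (σ p j) ⟨ ∂* p φ ⟩ v ≡ term k j ⟨ φ ⟩ w
    term-transport {k} {j} 1≤k k≤n 1≤j j≤n ≢₁ ≢₂ with <-cmp k j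
    ... | tri< k<j _ _  = trans (term-< ⟨ ∂* p φ ⟩ v (σ-mono p k<j ≢₁)) (T-transport 1≤k k<j j≤n φ ≢₁)
    ... | tri≈ _ refl _ = term-refl (σ p k) ⟨ ∂* p φ ⟩ v
    ... | tri> _ _ j<k  = trans (term-> ⟨ ∂* p φ ⟩ v (σ-mono p j<k ≢₂)) (cong (-1ℤ *_) (T-transport 1≤j j<k k≤n φ ≢₂))

    -- The transposition t_{p+1,p+2} is the one without a partner: it leads up from w but down from
    -- v. Its contribution is the correction of the Leibniz rule.
    correction : ℕ → ℕ → ℤ
    correction k j with k ≟ suc p | j ≟ suc (suc p) | k ≟ suc (suc p) | j ≟ suc p
    ... | yes _ | yes _ | _     | _     = ⟨ φ ⟩ v
    ... | _     | _     | yes _ | yes _ = -1ℤ * ⟨ φ ⟩ v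
    ... | _     | _     | _     | _     = 0ℤ

    term-step : ∀ {k j} → 1 ≤ k → k ≤ n → 1 ≤ j → j ≤ n →
                term k j ⟨ φ ⟩ w ≡ term (σ p k) (σ p j) ⟨ ∂* p φ ⟩ v + correction k j
    term-step {k} {j} 1≤k k≤n 1≤j j≤n with k ≟ suc p | j ≟ suc (suc p) | k ≟ suc (suc p) | j ≟ suc p
    ... | yes refl | yes refl | _ | _ = trans (trans (term-< ⟨ φ ⟩ w (n<1+n _)) (T-reflection-w ⟨ φ ⟩)) (trans (sym (ℤₚ.+-identityˡ _))
          (cong (_+ ⟨ φ ⟩ v) (sym (trans (cong₂ (λ a b → term a b ⟨ ∂* p φ ⟩ v) σ-left σ-right)
            (trans (term-> ⟨ ∂* p φ ⟩ v (n<1+n _)) (cong (-1ℤ *_) (T-reflection-v ⟨ ∂* p φ ⟩)))))))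
    ... | no _ | _ | yes refl | yes refl = trans (trans (term-> ⟨ φ ⟩ w (n<1+n _)) (cong (-1ℤ *_) (T-reflection-w ⟨ φ ⟩))) (trans (sym (ℤₚ.+-identityˡ _))
          (cong (_+ -1ℤ * ⟨ φ ⟩ v) (sym (trans (cong₂ (λ a b → term a b ⟨ ∂* p φ ⟩ v) σ-right σ-left)
            (trans (term-< ⟨ ∂* p φ ⟩ v (n<1+n _)) (T-reflection-v ⟨ ∂* p φ ⟩))))))
    ... | yes refl | no j≢ | yes eq | _ = ⊥-elim (1+n≢n (sym eq))
    ... | yes refl | no j≢ | no _ | _ = trans (sym (term-transport 1≤k k≤n 1≤j j≤n (λ (_ , eq) → j≢ eq) (λ (_ , eq) → 1+n≢n (sym eq)))) (sym (ℤₚ.+-identityʳ _))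
    ... | no k≢ | _ | no k≢′ | _ = trans (sym (term-transport 1≤k k≤n 1≤j j≤n (λ (eq , _) → k≢ eq) (λ (_ , eq) → k≢′ eq))) (sym (ℤₚ.+-identityʳ _))
    ... | no k≢ | _ | yes refl | no j≢ = trans (sym (term-transport 1≤k k≤n 1≤j j≤n (λ (eq , _) → k≢ eq) (λ (eq , _) → j≢ eq))) (sym (ℤₚ.+-identityʳ _))

    sum-step : ∀ {k} → 1 ≤ k → k ≤ n → Sum n (λ j → term k (suc j) ⟨ φ ⟩ w) ≡
               Sum n (λ j → term (σ p k) (suc j) ⟨ ∂* p φ ⟩ v) + Sum n (λ j → correction k (suc j))
    sum-step {k} 1≤k k≤n = trans (Sum-cong n (λ j j<n → term-step {k} {suc j} 1≤k k≤n (s≤s z≤n) j<n))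
      (trans (Sum-+ n (λ j → term (σ p k) (σ p (suc j)) ⟨ ∂* p φ ⟩ v) (λ j → correction k (suc j)))
      (cong (_+ Sum n (λ j → correction k (suc j)))
        (trans (Sum-cong n (λ j _ → cong (λ z → term (σ p k) z ⟨ ∂* p φ ⟩ v) (τ-suc p (suc p) j)))
               (Sum-τ n p (λ j → term (σ p k) (suc j) ⟨ ∂* p φ ⟩ v) p<n))))

    correction-left : Sum n (λ j → correction (suc p) (suc j)) ≡ ⟨ φ ⟩ v
    correction-left = trans (Sum-single n (suc p) p<n (λ j _ j≢ → zeros j j≢)) value
      where
      zeros : ∀ j → j ≢ suc p → correction (suc p) (suc j) ≡ 0ℤ
      zeros j j≢ with suc p ≟ suc p | suc j ≟ suc (suc p) | suc p ≟ suc (suc p) | suc j ≟ suc p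
      ... | yes _ | yes eq | _      | _ = ⊥-elim (j≢ (suc-injective eq))
      ... | yes _ | no _   | yes eq | _ = ⊥-elim (1+n≢n (sym eq))
      ... | yes _ | no _   | no _   | _ = refl
      ... | no ne | _      | _      | _ = ⊥-elim (ne refl)
      value : correction (suc p) (suc (suc p)) ≡ ⟨ φ ⟩ v
      value with suc p ≟ suc p | suc (suc p) ≟ suc (suc p)
      ... | yes _ | yes _ = refl
      ... | no ne | _     = ⊥-elim (ne refl)
      ... | yes _ | no ne = ⊥-elim (ne refl)

    correction-right : Sum n (λ j → correction (suc (suc p)) (suc j)) ≡ -1ℤ * ⟨ φ ⟩ v
    correction-right = trans (Sum-single n p (<⇒≤ p<n) (λ j _ j≢ → zeros j j≢)) value
      where
      zeros : ∀ j → j ≢ p → correction (suc (suc p)) (suc j) ≡ 0ℤ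
      zeros j j≢ with suc (suc p) ≟ suc p | suc j ≟ suc (suc p) | suc (suc p) ≟ suc (suc p) | suc j ≟ suc p
      ... | yes eq | _ | _     | _      = ⊥-elim (1+n≢n eq)
      ... | no _   | _ | yes _ | yes eq = ⊥-elim (j≢ (suc-injective eq))
      ... | no _   | _ | yes _ | no _   = refl
      ... | no _   | _ | no ne | _      = ⊥-elim (ne refl)
      value : correction (suc (suc p)) (suc p) ≡ -1ℤ * ⟨ φ ⟩ v
      value with suc (suc p) ≟ suc p | suc (suc p) ≟ suc (suc p) | suc p ≟ suc p
      ... | yes eq | _     | _     = ⊥-elim (1+n≢n eq)
      ... | no _   | yes _ | yes _ = refl
      ... | no _   | no ne | _     = ⊥-elim (ne refl)
      ... | no _   | yes _ | no ne = ⊥-elim (ne refl)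

    correction-other : ∀ {k} → k ≢ suc p → k ≢ suc (suc p) → Sum n (λ j → correction k (suc j)) ≡ 0ℤ
    correction-other {k} k≢ k≢′ = Sum-zero n (λ j _ → zeros j)
      where
      zeros : ∀ j → correction k (suc j) ≡ 0ℤ
      zeros j with k ≟ suc p | suc j ≟ suc (suc p) | k ≟ suc (suc p) | suc j ≟ suc p
      ... | yes eq | _ | _      | _ = ⊥-elim (k≢ eq)
      ... | no _   | _ | yes eq | _ = ⊥-elim (k≢′ eq)
      ... | no _   | _ | no _   | _ = refl

    -- ∂_p is applied to Monk's rule for v. Carrying x_k past ∂_p exchanges x_{p+1} with x_{p+2} and
    -- adds or subtracts 𝔖_v, which the sums of `correction` match. For k = p + 1 the rule for v is
    -- called at p + 2, which therefore has to stay below n.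
    step : (∀ k → 1 ≤ k → k < n → ⟨ X* (k ∸ 1) (∂* p φ) ⟩ v ≡ Sum n (λ j → term k (suc j) ⟨ ∂* p φ ⟩ v)) →
           suc (suc p) < n → ∀ k → k < n → 1 ≤ k → ⟨ X* (k ∸ 1) φ ⟩ w ≡ Sum n (λ j → term k (suc j) ⟨ φ ⟩ w)
    step IH p′<n (suc q) k<n 1≤k = trans (⟨⟩-ascent (n ℕ.* n) w vw (m≤m+n _ _) p p<n asc (X* q φ)) (trans (cases (position p (suc p) q)) (sym (sum-step 1≤k (<⇒≤ k<n))))
      where
      Σv : ℕ → ℤ
      Σv k = Sum n (λ j → term k (suc j) ⟨ ∂* p φ ⟩ v)
      shiftʳ : ∀ x y → x ≡ x + 1ℤ * y + -1ℤ * y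
      shiftʳ = solve-∀
      shiftʳ′ : ∀ x y → x ≡ x + -1ℤ * y + y
      shiftʳ′ = solve-∀
      lin : ∀ c (ψ θ : Functional) → (∀ f → at (∂* p (X* q φ)) f ≡ at ψ f + c * at θ f) → ⟨ ∂* p (X* q φ) ⟩ v ≡ ⟨ ψ ⟩ v + c * ⟨ θ ⟩ v
      lin c ψ θ h = trans (ev-cong h (𝔖 v)) (trans (ev-+ (at ψ) (λ f → c * at θ f) (𝔖 v)) (cong (⟨ ψ ⟩ v +_) (ev-* c (at θ) (𝔖 v))))
      cases : Position p (suc p) q → ⟨ ∂* p (X* q φ) ⟩ v ≡ Σv (σ p (suc q)) + Sum n (λ j → correction (suc q) (suc j))
      cases (isˡ refl) = trans (lin 1ℤ (X* (suc p) (∂* p φ)) φ (λ f → trans (shiftʳ′ _ (at φ f))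
              (trans (cong (_+ at φ f) (sym (∂-bumpʳ p φ f))) (cong (at (∂* p φ) (bump (suc p) f) +_) (sym (ℤₚ.*-identityˡ (at φ f)))))))
            (cong₂ _+_ (trans (IH (suc (suc p)) (s≤s z≤n) p′<n) (cong Σv (sym σ-left)))
                       (trans (ℤₚ.*-identityˡ _) (sym correction-left)))
      cases (isʳ refl) = trans (lin -1ℤ (X* p (∂* p φ)) φ (λ f → trans (shiftʳ _ (at φ f)) (cong (_+ -1ℤ * at φ f) (sym (∂-bumpˡ p φ f)))))
            (cong₂ _+_ (trans (IH (suc p) (s≤s z≤n) p<n) (cong Σv (sym σ-right))) (sym correction-right))
      cases (other q≢ q≢′) = trans (ev-cong (λ f → sym (∂-bump-≢ p q φ f q≢ q≢′)) (𝔖 v))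
            (trans (IH (suc q) 1≤k k<n) (trans (cong Σv (sym (τ-other k≢ k≢′)))
              (trans (sym (ℤₚ.+-identityʳ _)) (cong (Σv (σ p (suc q)) +_) (sym (correction-other k≢ k≢′))))))
        where
        k≢ : suc q ≢ suc p
        k≢ eq = q≢ (suc-injective eq)
        k≢′ : suc q ≢ suc (suc p)
        k≢′ eq = q≢′ (suc-injective eq)

  last-ascent : ∀ {p w} → First p w → length w ≡ suc (suc p) → ∃[ ds ] ∃[ y ] w ≡ ds ++ y ∷ [] × Decreasing ds × length ds ≡ suc p
  last-ascent (here {x} {y} {[]} _) refl = x ∷ [] , y , refl , [-] , refl
  last-ascent (there {x = x} y<x fst) eq with last-ascent fst (suc-injective eq)
  ... | d ∷ ds , z , refl , dec , |ds| = x ∷ d ∷ ds , z , refl , y<x ∷ dec , cong suc |ds|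

  atZ-decreasing : ∀ {w} → Decreasing w → ∀ i j → i < j → j < length w → atZ w j < atZ w i
  atZ-decreasing [-]         zero    (suc j) _         (s≤s ())
  atZ-decreasing [-]         (suc i) (suc j) _         (s≤s ())
  atZ-decreasing (y<x ∷ dec) zero    (suc zero)    _         _         = y<x
  atZ-decreasing (y<x ∷ dec) zero    (suc (suc j)) _         (s≤s j<n) = <-trans (atZ-decreasing dec zero (suc j) (s≤s z≤n) j<n) y<x
  atZ-decreasing (y<x ∷ dec) (suc i) (suc j)       (s≤s i<j) (s≤s j<n) = atZ-decreasing dec i j i<j j<n

  decreasing-suffix : ∀ P {w} → Decreasing (P ++ w) → Decreasing w
  decreasing-suffix []          dec       = dec
  decreasing-suffix (p ∷ P) {w} dec = decreasing-suffix P (tail (P ++ w) dec)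
    where
    tail : ∀ {x} w → Decreasing (x ∷ w) → Decreasing w
    tail []      _         = []
    tail (_ ∷ _) (_ ∷ dec) = dec

  module Raise (x : ℕ) (M : List ℕ) (y : ℕ) where
    w u : List ℕ → List ℕ
    w P = P ++ x ∷ M ++ y ∷ []
    u P = P ++ y ∷ M ++ x ∷ []

    -- The entries of M lie below both x and y, so exchanging the two changes a single code entry:
    -- the place of x gains the inversion of y with x.
    code-raise : ∀ P → Decreasing (P ++ x ∷ M) → (∀ j → j < length (P ++ x ∷ M) → atZ (P ++ x ∷ M) j < y) →
                 code (u P) ≡ bump (length P) (code (w P))
    code-raise []      dec top = cong₂ _∷_
        (trans (countLess-++ y M (x ∷ [])) (trans (cong₂ (λ a b → a ℕ.+ (b ℕ.+ 0)) (countLess-all y M top′) (lt-true (top 0 (s≤s z≤n))))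
          (trans (+-comm (length M) 1) (cong suc (sym (trans (countLess-∷ʳ x M (<⇒≤ (top 0 (s≤s z≤n)))) (countLess-all x M below)))))))
        (trans (code-∷ʳ M below) (sym (code-∷ʳ M top′)))
      where
      top′ : ∀ j → j < length M → atZ M j < y
      top′ j j<M = top (suc j) (s≤s j<M)
      below : ∀ j → j < length M → atZ M j < x
      below j j<M = atZ-decreasing dec 0 (suc j) (s≤s z≤n) (s≤s j<M)
    code-raise (p ∷ P) dec top = cong₂ _∷_ (sym (countLess-swap′ P))
        (code-raise P (decreasing-suffix (p ∷ []) dec) (λ j j<n → top (suc j) (s≤s j<n)))
      where
      countLess-swap′ : ∀ P → countLess p (w P) ≡ countLess p (u P)
      countLess-swap′ P = trans (countLess-++ p P _) (trans (cong (countLess p P ℕ.+_) (countLess-swap p x M y [])) (sym (countLess-++ p P _)))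

    code-base : ∀ P → Decreasing (P ++ x ∷ M) → (∀ j → j < length (P ++ x ∷ M) → atZ (P ++ x ∷ M) j < y) →
                code (w P) ≡ downFrom (length (P ++ x ∷ M)) ++ 0 ∷ []
    code-base P dec top = trans (cong code (sym (Listₚ.++-assoc P (x ∷ M) (y ∷ []))))
      (trans (code-∷ʳ (P ++ x ∷ M) top) (cong (_++ 0 ∷ []) (code-decreasing dec)))

    WD-bump : ∀ m r → r < m → WeaklyDecr (bump r (downFrom m ++ 0 ∷ []))
    WD-bump (suc zero)    zero    _ = z≤n , tt
    WD-bump (suc (suc m)) zero    _ = ≤-trans (n≤1+n m) (n≤1+n (suc m)) , WD-∷ʳ-0 (downFrom (suc m)) (WD-downFrom (suc m))
    WD-bump (suc (suc m)) (suc zero)    r<m = ≤-refl , WD-bump (suc m) zero (s≤s z≤n)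
    WD-bump (suc (suc m)) (suc (suc r)) (s≤s r<m) = n≤1+n m , WD-bump (suc m) (suc r) r<m
    WD-bump (suc zero)    (suc r) (s≤s ())

  -- Cutting the sum off at n loses no cover because n is fixed: for b > n, position n would carry a
  -- value between those at k and b. The descending induction ends at a decreasing list followed by
  -- n, not at the longest element.
  monk : ∀ {n} c w → Valid n w → n ℕ.* n ≤ c ℕ.+ len w → app w n ≡ n → ∀ k → 1 ≤ k → k < n →
         ∀ φ → ⟨ X* (k ∸ 1) φ ⟩ w ≡ Sum n (λ j → term k (suc j) ⟨ φ ⟩ w)
  monk {n} zero w vw le fix k 1≤k k<n φ = ⊥-elim (<⇒≱ (len-< (≤-trans 1≤k (<⇒≤ k<n)) vw) le)
  monk {n} (suc c) w vw le fix zero    () k<n φ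
  monk {n} (suc c) w vw le fix k@(suc q) 1≤k k<n φ with firstAscent-cases 1 w (valid-atInj vw)
  -- Here n is at least 2, and a decreasing permutation cannot fix its last position.
  ... | inj₂ (_ , dec) = ⊥-elim (no-max n refl)
    where
    no-max : ∀ m → m ≡ n → ⊥
    no-max zero          refl = <⇒≱ k<n z≤n
    no-max (suc zero)    refl = <⇒≱ k<n 1≤k
    no-max (suc (suc m)) refl = <⇒≱ (subst (_< atZ w m) (trans (sym (app-suc w m<w)) fix)
        (atZ-decreasing dec m (suc m) (n<1+n m) m<w))
        (subst₂ _≤_ (app-suc w (<⇒≤ m<w)) (size vw) (app-≤ {w} (inj vw) (<⇒≤ m<w)))
      where
      m<w : suc m < length w
      m<w = ≤-reflexive (sym (size vw))
  ... | inj₁ (p , _ , fst) = cases (m≤n⇒m<n∨m≡n p<n)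
    where
    p<n = subst (suc p <_) (size vw) (first-bound fst)
    asc = first-ascent fst
    cases : suc (suc p) < n ⊎ suc (suc p) ≡ n → ⟨ X* (k ∸ 1) φ ⟩ w ≡ Sum n (λ j → term k (suc j) ⟨ φ ⟩ w)
    cases (inj₁ p′<n) = MonkStep.step p p<n vw asc φ
      (λ k′ 1≤k′ k′<n → monk c (s p w) (valid-s p p<n vw) (colength-step p p<n vw asc le)
        (trans (app-s-other p w n (≢-sym (<⇒≢ p<n)) (≢-sym (<⇒≢ p′<n))) fix) k′ 1≤k′ k′<n (∂* p φ))
      p′<n k k<n 1≤k
    -- The positions before n decrease, so t_{κ,n} is the only cover through κ = k. Both w and w
    -- t_{κ,n} are dominant, and their codes differ by one at κ.
    cases (inj₂ refl) with last-ascent fst (size vw)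
    ... | ds , y , refl , dec , |ds| with splitAt-∷ ds q (subst (q <_) (sym |ds|) (≤-pred k<n))
    ...   | P , x , M , refl , refl = base
      where
      w≡ : w ≡ P ++ x ∷ M ++ y ∷ []
      w≡ = Listₚ.++-assoc P (x ∷ M) (y ∷ [])
      N = suc (suc p)
      q<p : q < suc p
      q<p = ≤-pred k<n
      |D| : length (P ++ x ∷ M) ≡ suc p
      |D| = |ds|
      p<w : suc p < length w
      p<w = subst (suc p <_) (sym (size vw)) (n<1+n (suc p))
      y≡N : y ≡ N
      y≡N = trans (sym (trans (cong (atZ w) (sym |D|)) (atZ-at (P ++ x ∷ M) y []))) (trans (sym (app-suc w p<w)) fix)
      app-D : ∀ j → j < suc p → app w (suc j) ≡ atZ (P ++ x ∷ M) j
      app-D j j<p = trans (app-suc w (<-trans j<p p<w)) (atZ-++ˡ (P ++ x ∷ M) (y ∷ []) (subst (j <_) (sym |D|) j<p))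
      below-N : ∀ j → j < suc p → app w (suc j) < N
      below-N j j<p = ≤∧≢⇒< (subst (app w (suc j) ≤_) (size vw) (app-≤ {w} (inj vw) (<-trans j<p p<w)))
        (λ eq → <⇒≢ (s≤s j<p) (inj vw (suc j) N (trans eq (sym fix))))
      top : ∀ j → j < length (P ++ x ∷ M) → atZ (P ++ x ∷ M) j < y
      top j j<D = subst₂ _<_ (app-D j j<p) (sym y≡N) (below-N j j<p)
        where j<p = subst (j <_) |D| j<D
      falls : ∀ i j → i < j → j < suc p → app w (suc j) < app w (suc i)
      falls i j i<j j<p = subst₂ _<_ (sym (app-D j j<p)) (sym (app-D i (<-trans i<j j<p)))
        (atZ-decreasing dec i j i<j (subst (j <_) (sym |D|) j<p))
      N≡ : N ≡ suc (length P ℕ.+ suc (length M))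
      N≡ = cong suc (trans (sym |D|) (Listₚ.length-++ P))
      u≡ : swapPos (suc q) N w ≡ P ++ y ∷ M ++ x ∷ []
      u≡ = trans (cong₂ (λ b z → swapPos (suc q) b z) N≡ w≡) (Decomposed.swap≡ P x M y [])
      q<N : suc q < N
      q<N = s≤s q<p
      vu : Valid N (swapPos (suc q) N w)
      vu = valid-swap {a = suc q} {N} vw (s≤s z≤n) (<⇒≤ q<N) (s≤s z≤n) ≤-refl
      code-w : code w ≡ downFrom (suc p) ++ 0 ∷ []
      code-w = trans (cong code w≡) (trans (Raise.code-base x M y P dec top) (cong (λ m → downFrom m ++ 0 ∷ []) |D|))
      code-u : code (swapPos (suc q) N w) ≡ bump q (code w)
      code-u = trans (cong code u≡) (trans (Raise.code-raise x M y P dec top) (cong (λ z → bump q (code z)) (sym w≡)))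
      covN : Cov w (suc q) N
      covN = cov (subst (app w (suc q) <_) (sym fix) (below-N q q<p)) none
        where
        none : ∀ i → suc q < i → i < N → ¬ Between (app w (suc q)) (app w N) (app w i)
        none (suc i) (s≤s q<i) (s≤s i<p) (q<i′ , _) = <-asym q<i′ (falls q i q<i i<p)
      not-cov : ∀ {i j} → i < j → j < suc p → ¬ Cov w (suc i) (suc j)
      not-cov {i} {j} i<j j<p c = <-asym (rise c) (falls i j i<j j<p)
      zeros : ∀ j → j < N → j ≢ suc p → term (suc q) (suc j) ⟨ φ ⟩ w ≡ 0ℤ
      zeros j j<N j≢p with <-cmp q j | ≤∧≢⇒< (≤-pred j<N) j≢p
      ... | tri< q<j _ _  | j<p = trans (term-< ⟨ φ ⟩ w (s≤s q<j)) (T-¬cov ⟨ φ ⟩ vw (s≤s z≤n) (s≤s q<j) j<N (not-cov q<j j<p))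
      ... | tri≈ _ refl _ | _   = term-refl (suc q) ⟨ φ ⟩ w
      ... | tri> _ _ j<q  | _   = trans (term-> ⟨ φ ⟩ w (s≤s j<q)) (cong (-1ℤ *_) (T-¬cov ⟨ φ ⟩ vw (s≤s z≤n) (s≤s j<q) (<⇒≤ q<N) (not-cov j<q q<p)))
      base : ⟨ X* q φ ⟩ w ≡ Sum N (λ j → term (suc q) (suc j) ⟨ φ ⟩ w)
      base = begin
        ⟨ X* q φ ⟩ w
          ≡⟨ ⟨⟩-dominant (N ℕ.* N) w (s≤s z≤n) vw (m≤m+n _ _) (subst WeaklyDecr (sym code-w) (WD-∷ʳ-0 (downFrom (suc p)) (WD-downFrom (suc p)))) (X* q φ) ⟩
        at φ (bump q (code w))
          ≡⟨ cong (at φ) (sym code-u) ⟩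
        at φ (code (swapPos (suc q) N w))
          ≡⟨ sym (⟨⟩-dominant (N ℕ.* N) (swapPos (suc q) N w) (s≤s z≤n) vu (m≤m+n _ _)
               (subst WeaklyDecr (sym (trans code-u (cong (bump q) code-w))) (Raise.WD-bump x M y (suc p) q q<p)) φ) ⟩
        ⟨ φ ⟩ (swapPos (suc q) N w)
          ≡⟨ sym (T-cov ⟨ φ ⟩ vw (s≤s z≤n) q<N ≤-refl covN) ⟩
        T (suc q) N ⟨ φ ⟩ w
          ≡⟨ sym (term-< ⟨ φ ⟩ w q<N) ⟩
        term (suc q) N ⟨ φ ⟩ w
          ≡⟨ sym (Sum-single N {λ j → term (suc q) (suc j) ⟨ φ ⟩ w} (suc p) ≤-refl zeros) ⟩
        Sum N (λ j → term (suc q) (suc j) ⟨ φ ⟩ w) ∎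
        where open ≡-Reasoning

open Monk

-- Commutation and quadratic relations between covers

module CoverRelations where
  open import Data.Integer using (_+_; _*_)

  -- Covers of bare functions: the relations depend only on the values at a few positions, and lists
  -- would only add lengths to track.
  record CovF (A : ℕ → ℕ) (a b : ℕ) : Set where
    constructor covF
    field
      riseF  : A a < A b
      emptyF : ∀ i → a < i → i < b → ¬ Between (A a) (A b) (A i)
  open CovF

  record Swapped (A B : ℕ → ℕ) (a b : ℕ) : Set where
    field
      atˡ : B a ≡ A b
      atʳ : B b ≡ A a
      off : ∀ i → i ≢ a → i ≢ b → B i ≡ A i
  open Swapped

  InjF : (ℕ → ℕ) → Set
  InjF A = ∀ i j → A i ≡ A j → i ≡ j

  <-or-> : ∀ {A} → InjF A → ∀ {i j} → i ≢ j → A i < A j ⊎ A j < A i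
  <-or-> {A} inj {i} {j} i≢j with <-cmp (A i) (A j)
  ... | tri< lt _ _ = inj₁ lt
  ... | tri≈ _ eq _ = ⊥-elim (i≢j (inj i j eq))
  ... | tri> _ _ gt = inj₂ gt

  pos-< : ∀ {i j} → i ≢ j → i < j ⊎ j < i
  pos-< = <-or-> {λ i → i} (λ _ _ eq → eq)

  module _ {A B C : ℕ → ℕ} {a b c d : ℕ} (inj : InjF A) (sB : Swapped A B a b) (sC : Swapped A C c d)
           (a<b : a < b) (c<d : c < d) (a≢c : a ≢ c) (a≢d : a ≢ d) (b≢c : b ≢ c) (b≢d : b ≢ d)
           (cA : CovF A a b) (cB : CovF B c d) where
    private
      Bc = off sB c (≢-sym a≢c) (≢-sym b≢c)
      Bd = off sB d (≢-sym a≢d) (≢-sym b≢d)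
      γ<δ : A c < A d
      γ<δ = subst₂ _<_ Bc Bd (riseF cB)
      noB : ∀ i → c < i → i < d → ∀ {x} → B i ≡ x → A c < x → x < A d → ⊥
      noB i c<i i<d refl γ<x x<δ = emptyF cB i c<i i<d (subst (_< B i) (sym Bc) γ<x , subst (B i <_) (sym Bd) x<δ)
      noA : ∀ i → a < i → i < b → A a < A i → A i < A b → ⊥
      noA i a<i i<b l r = emptyF cA i a<i i<b (l , r)

    -- The first swap changes only the positions a and b, so an obstruction to the exchanged order
    -- sits at one of them. In every relative order of positions and values it forces a forbidden
    -- value into one of the two given covers.
    cover-comm₁ : CovF A c d
    cover-comm₁ = covF γ<δ none
      where
      none : ∀ j → c < j → j < d → ¬ Between (A c) (A d) (A j)
      none j c<j j<d (l , r) with position a b j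
      ... | other j≢a j≢b = noB j c<j j<d (off sB j j≢a j≢b) l r
      ... | isˡ refl with <-or-> inj b≢d
      ...   | inj₁ β<δ = noB a c<j j<d (atˡ sB) (<-trans l (riseF cA)) β<δ
      ...   | inj₂ δ<β with pos-< b≢d
      ...     | inj₁ b<d = noB b (<-trans c<j a<b) b<d (atʳ sB) l r
      ...     | inj₂ d<b = noA d j<d d<b r δ<β
      none j c<j j<d (l , r) | isʳ refl with <-or-> inj a≢c
      ...   | inj₂ γ<α = noB b c<j j<d (atʳ sB) γ<α (<-trans (riseF cA) r)
      ...   | inj₁ α<γ with pos-< a≢c
      ...     | inj₁ a<c = noA c a<c c<j α<γ l
      ...     | inj₂ c<a = noB a c<a (<-trans a<b j<d) (atˡ sB) l r

    cover-comm₂ : CovF C a b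
    cover-comm₂ = covF (subst₂ _<_ (sym Ca) (sym Cb) (riseF cA)) none
      where
      Ca = off sC a a≢c a≢d
      Cb = off sC b b≢c b≢d
      none : ∀ j → a < j → j < b → ¬ Between (C a) (C b) (C j)
      none j a<j j<b (l′ , r′) with subst (_< C j) Ca l′ | subst (C j <_) Cb r′ | position c d j
      ... | l | r | other j≢c j≢d = noA j a<j j<b (subst (A a <_) (off sC j j≢c j≢d) l) (subst (_< A b) (off sC j j≢c j≢d) r)
      ... | l | r | isˡ refl with subst (A a <_) (atˡ sC) l | subst (_< A b) (atˡ sC) r | <-or-> inj a≢c
      ...   | α<δ | δ<β | inj₁ α<γ = noA c a<j j<b α<γ (<-trans γ<δ δ<β)
      ...   | α<δ | δ<β | inj₂ γ<α with pos-< b≢d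
      ...     | inj₁ b<d = noB b j<b b<d (atʳ sB) γ<α α<δ
      ...     | inj₂ d<b = noA d (<-trans a<j c<d) d<b α<δ δ<β
      none j a<j j<b (l′ , r′) | l | r | isʳ refl with subst (A a <_) (atʳ sC) l | subst (_< A b) (atʳ sC) r | <-or-> inj b≢d
      ...   | α<γ | γ<β | inj₂ δ<β = noA d a<j j<b (<-trans α<γ γ<δ) δ<β
      ...   | α<γ | γ<β | inj₁ β<δ with pos-< a≢c
      ...     | inj₁ a<c = noA c a<c (<-trans c<d j<b) α<γ γ<β
      ...     | inj₂ c<a = noB a c<a a<j (atˡ sB) γ<β β<δ

  module _ {A B B′ B″ : ℕ → ℕ} {a κ b : ℕ} (inj : InjF A) (a<κ : a < κ) (κ<b : κ < b)
           (sB : Swapped A B a κ) (sB′ : Swapped A B′ κ b) (sB″ : Swapped A B″ a b) where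
    private
      a≢κ = <⇒≢ a<κ
      κ≢b = <⇒≢ κ<b
      a<b = <-trans a<κ κ<b
      a≢b = <⇒≢ a<b
      Bb = off sB b (≢-sym a≢b) (≢-sym κ≢b)
      B′a = off sB′ a a≢κ a≢b
      B″κ = off sB″ κ (≢-sym a≢κ) κ≢b
      btw : ∀ {x y z x′ y′ z′} → x ≡ x′ → y ≡ y′ → z ≡ z′ → Between x y z → Between x′ y′ z′
      btw refl refl refl h = h
      right : ∀ {i} → κ < i → i ≢ a
      right κ<i eq = <-asym a<κ (subst (κ <_) eq κ<i)
      left : ∀ {i} → i < κ → i ≢ b
      left i<κ eq = <-asym κ<b (subst (_< κ) eq i<κ)

    -- The order of the values at κ and b decides how the chain t_{a,κ}, t_{κ,b} is rewritten: here
    -- it becomes a chain starting with t_{κ,b}, and for the opposite order, in `exchange₂`, one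
    -- starting with t_{a,b}. The two converses ensure that the right-hand side of the quadratic
    -- relation has no further terms.
    exchange₁ : CovF A a κ → CovF B κ b → A κ < A b → CovF A κ b × CovF B′ a b
    exchange₁ c₁ c₂ q<r = covF q<r none , covF (subst₂ _<_ (sym B′a) (sym (atʳ sB′)) (riseF c₁)) none′
      where
      none : ∀ j → κ < j → j < b → ¬ Between (A κ) (A b) (A j)
      none j κ<j j<b (l , r) = emptyF c₂ j κ<j j<b
        (btw (sym (atʳ sB)) (sym Bb) (sym (off sB j (right κ<j) (≢-sym (<⇒≢ κ<j)))) (<-trans (riseF c₁) l , r))
      none′ : ∀ j → a < j → j < b → ¬ Between (B′ a) (B′ b) (B′ j)
      none′ j a<j j<b h with <-cmp j κ
      ... | tri< j<κ j≢κ _ = emptyF c₁ j a<j j<κ (btw B′a (atʳ sB′) (off sB′ j j≢κ (left j<κ)) h)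
      ... | tri≈ _ refl _  = <-asym q<r (proj₂ (btw B′a (atʳ sB′) (atˡ sB′) h))
      ... | tri> _ j≢κ κ<j with btw B′a (atʳ sB′) (off sB′ j j≢κ (<⇒≢ j<b)) h
      ...   | l , r = emptyF c₂ j κ<j j<b (btw (sym (atʳ sB)) (sym Bb) (sym (off sB j (right κ<j) j≢κ)) (l , <-trans r q<r))

    exchange₂ : CovF A a κ → CovF B κ b → A b < A κ → CovF A a b × CovF B″ a κ
    exchange₂ c₁ c₂ r<q = covF p<r none , covF (subst₂ _<_ (sym (atˡ sB″)) (sym B″κ) r<q) none′
      where
      p<r : A a < A b
      p<r = subst₂ _<_ (atʳ sB) Bb (riseF c₂)
      none : ∀ j → a < j → j < b → ¬ Between (A a) (A b) (A j)
      none j a<j j<b (l , r) with <-cmp j κ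
      ... | tri< j<κ _ _   = emptyF c₁ j a<j j<κ (l , <-trans r r<q)
      ... | tri≈ _ refl _  = <-asym r r<q
      ... | tri> _ j≢κ κ<j = emptyF c₂ j κ<j j<b (btw (sym (atʳ sB)) (sym Bb) (sym (off sB j (right κ<j) j≢κ)) (l , r))
      none′ : ∀ j → a < j → j < κ → ¬ Between (B″ a) (B″ κ) (B″ j)
      none′ j a<j j<κ h with btw (atˡ sB″) B″κ (off sB″ j (≢-sym (<⇒≢ a<j)) (left j<κ)) h
      ... | l , r = emptyF c₁ j a<j j<κ (<-trans p<r l , r)

    exchange₁⁻¹ : CovF A κ b → CovF B′ a b → CovF A a κ × CovF B κ b
    exchange₁⁻¹ c₁ c₂ = covF p<q none , covF (subst₂ _<_ (sym (atʳ sB)) (sym Bb) (<-trans p<q (riseF c₁))) none′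
      where
      p<q : A a < A κ
      p<q = subst₂ _<_ B′a (atʳ sB′) (riseF c₂)
      none : ∀ j → a < j → j < κ → ¬ Between (A a) (A κ) (A j)
      none j a<j j<κ h = emptyF c₂ j a<j (<-trans j<κ κ<b)
        (btw (sym B′a) (sym (atʳ sB′)) (sym (off sB′ j (<⇒≢ j<κ) (left j<κ))) h)
      none′ : ∀ j → κ < j → j < b → ¬ Between (B κ) (B b) (B j)
      none′ j κ<j j<b h with btw (atʳ sB) Bb (off sB j (right κ<j) (≢-sym (<⇒≢ κ<j))) h | <-or-> inj (<⇒≢ κ<j)
      ... | l , r | inj₁ q<j = emptyF c₁ j κ<j j<b (q<j , r)
      ... | l , r | inj₂ j<q = emptyF c₂ j (<-trans a<κ κ<j) j<b
            (btw (sym B′a) (sym (atʳ sB′)) (sym (off sB′ j (≢-sym (<⇒≢ κ<j)) (<⇒≢ j<b))) (l , j<q))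

    exchange₂⁻¹ : CovF A a b → CovF B″ a κ → A b < A κ × CovF A a κ × CovF B κ b
    exchange₂⁻¹ c₁ c₂ = r<q , covF (<-trans (riseF c₁) r<q) none , covF (subst₂ _<_ (sym (atʳ sB)) (sym Bb) (riseF c₁)) none′
      where
      r<q : A b < A κ
      r<q = subst₂ _<_ (atˡ sB″) B″κ (riseF c₂)
      none : ∀ j → a < j → j < κ → ¬ Between (A a) (A κ) (A j)
      none j a<j j<κ (l , r) with <-or-> inj (left j<κ)
      ... | inj₁ j<r = emptyF c₁ j a<j (<-trans j<κ κ<b) (l , j<r)
      ... | inj₂ r<j = emptyF c₂ j a<j j<κ (btw (sym (atˡ sB″)) (sym B″κ) (sym (off sB″ j (≢-sym (<⇒≢ a<j)) (left j<κ))) (r<j , r))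
      none′ : ∀ j → κ < j → j < b → ¬ Between (B κ) (B b) (B j)
      none′ j κ<j j<b h = emptyF c₁ j (<-trans a<κ κ<j) j<b (btw (atʳ sB) Bb (off sB j (right κ<j) (≢-sym (<⇒≢ κ<j))) h)

  Cov⇒F : ∀ {w a b} → Cov w a b → CovF (app w) a b
  Cov⇒F (cov r e) = covF r e

  F⇒Cov : ∀ {w a b} → CovF (app w) a b → Cov w a b
  F⇒Cov (covF r e) = cov r e

  swapped : ∀ w {a b} → 1 ≤ a → 1 ≤ b → Swapped (app w) (app (swapPos a b w)) a b
  swapped w {a} {b} 1≤a 1≤b = record
    { atˡ = app-swapˡ a b w 1≤a 1≤b ; atʳ = app-swapʳ a b w 1≤a 1≤b
    ; off = λ i → app-swap-other a b w i 1≤a 1≤b }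

  record Pair (n a b : ℕ) : Set where
    constructor pair
    field
      1≤a : 1 ≤ a
      a<b : a < b
      b≤n : b ≤ n
    1≤b : 1 ≤ b
    1≤b = 1≤-< 1≤a a<b
    a≤n : a ≤ n
    a≤n = ≤-trans (<⇒≤ a<b) b≤n
  open Pair

  cov? : ∀ {n a b w} → Valid n w → Pair n a b → Cov w a b ⊎ ¬ Cov w a b
  cov? {a = a} {b} {w} (valid refl i) (pair 1≤a a<b b≤n) with len (swapPos a b w) ≟ suc (len w)
  ... | yes eq = inj₁ (len⇒cover w i 1≤a a<b b≤n eq)
  ... | no ne  = inj₂ λ c → ne (cover⇒len w i 1≤a a<b b≤n c)

  swap-valid : ∀ {n a b w} → Pair n a b → Valid n w → Valid n (swapPos a b w)
  swap-valid p v = valid-swap v (1≤a p) (a≤n p) (1≤b p) (b≤n p)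

  module _ {n a b c d : ℕ} {w : List ℕ} (v : Valid n w) (p : Pair n a b) (q : Pair n c d) (f : List ℕ → ℤ) where
    TT-yes : Cov w a b → Cov (swapPos a b w) c d → T a b (T c d f) w ≡ f (swapPos c d (swapPos a b w))
    TT-yes c₁ c₂ = trans (T-cov (T c d f) v (1≤a p) (a<b p) (b≤n p) c₁)
                         (T-cov f (swap-valid p v) (1≤a q) (a<b q) (b≤n q) c₂)

    TT-no : ¬ (Cov w a b × Cov (swapPos a b w) c d) → T a b (T c d f) w ≡ 0ℤ
    TT-no ne with cov? v p
    ... | inj₂ ¬c = T-¬cov (T c d f) v (1≤a p) (a<b p) (b≤n p) ¬c
    ... | inj₁ c₁ = trans (T-cov (T c d f) v (1≤a p) (a<b p) (b≤n p) c₁)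
                          (T-¬cov f (swap-valid p v) (1≤a q) (a<b q) (b≤n q) (λ c₂ → ne (c₁ , c₂)))

    TT? : (Cov w a b × Cov (swapPos a b w) c d) ⊎ ¬ (Cov w a b × Cov (swapPos a b w) c d)
    TT? with cov? v p | cov? (swap-valid p v) q
    ... | inj₁ c₁ | inj₁ c₂ = inj₁ (c₁ , c₂)
    ... | inj₂ ¬c | _       = inj₂ λ (c₁ , _) → ¬c c₁
    ... | _       | inj₂ ¬c = inj₂ λ (_ , c₂) → ¬c c₂

  pair-conj : ∀ {n a b c d w} → Valid n w → Pair n a b → Pair n c d →
              swapPos c d (swapPos a b w) ≡ swapPos (τ c d a) (τ c d b) (swapPos c d w)
  pair-conj {a = a} {b} {c} {d} {w} v p q = swapPos-conj a b c d w (valid-range v (1≤a p) (a≤n p)) (valid-range v (1≤b p) (b≤n p))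
    (valid-range v (1≤a q) (a≤n q)) (valid-range v (1≤b q) (b≤n q))

  module _ {n a b c d : ℕ} (p : Pair n a b) (q : Pair n c d) (a≢c : a ≢ c) (a≢d : a ≢ d) (b≢c : b ≢ c) (b≢d : b ≢ d) where
    private
      commute : ∀ {a b c d} → Pair n a b → Pair n c d → a ≢ c → a ≢ d → b ≢ c → b ≢ d → ∀ {w} → Valid n w →
                Cov w a b × Cov (swapPos a b w) c d → Cov w c d × Cov (swapPos c d w) a b
      commute p q a≢c a≢d b≢c b≢d {w} v (c₁ , c₂) =
        F⇒Cov (cover-comm₁ (inj v) (swapped w (1≤a p) (1≤b p)) (swapped w (1≤a q) (1≤b q)) (a<b p) (a<b q) a≢c a≢d b≢c b≢d (Cov⇒F c₁) (Cov⇒F c₂)) ,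
        F⇒Cov (cover-comm₂ (inj v) (swapped w (1≤a p) (1≤b p)) (swapped w (1≤a q) (1≤b q)) (a<b p) (a<b q) a≢c a≢d b≢c b≢d (Cov⇒F c₁) (Cov⇒F c₂))

    T-comm : ∀ f {w} → Valid n w → T a b (T c d f) w ≡ T c d (T a b f) w
    T-comm f {w} v with TT? v p q f
    ... | inj₁ (c₁ , c₂) = let c₃ , c₄ = commute p q a≢c a≢d b≢c b≢d v (c₁ , c₂) in
          trans (TT-yes v p q f c₁ c₂) (trans (cong f (trans (pair-conj v p q)
            (cong₂ (λ x y → swapPos x y (swapPos c d w)) (τ-other a≢c a≢d) (τ-other b≢c b≢d)))) (sym (TT-yes v q p f c₃ c₄)))
    ... | inj₂ ne = trans (TT-no v p q f ne) (sym (TT-no v q p f λ h → ne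
          (commute q p (≢-sym a≢c) (≢-sym b≢c) (≢-sym a≢d) (≢-sym b≢d) v h)))

  -- The quadratic relation of the Fomin–Kirillov algebra.
  T-quadratic : ∀ {n a κ b} → 1 ≤ a → a < κ → κ < b → b ≤ n → ∀ f {w} → Valid n w →
                T a κ (T κ b f) w ≡ T κ b (T a b f) w + T a b (T a κ f) w
  T-quadratic {n} {a} {κ} {b} pos a<κ κ<b top f {w} v = go (TT? v aκ κb f)
    where
    κb = pair {n} (1≤-< pos a<κ) κ<b top
    aκ = pair {n} pos a<κ (a≤n κb)
    ab = pair {n} pos (<-trans a<κ κ<b) top
    sB = swapped w (1≤a aκ) (1≤b aκ)
    sB′ = swapped w (1≤a κb) (1≤b κb)
    sB″ = swapped w (1≤a ab) (1≤b ab)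
    a≢κ = <⇒≢ a<κ
    κ≢b = <⇒≢ κ<b
    a≢b = <⇒≢ (<-trans a<κ κ<b)
    go : (Cov w a κ × Cov (swapPos a κ w) κ b) ⊎ ¬ (Cov w a κ × Cov (swapPos a κ w) κ b) →
         T a κ (T κ b f) w ≡ T κ b (T a b f) w + T a b (T a κ f) w
    go (inj₂ ne) = trans (TT-no v aκ κb f ne) (sym (cong₂ _+_
      (TT-no v κb ab f λ (c₁ , c₂) → let c₃ , c₄ = exchange₁⁻¹ (inj v) a<κ κ<b sB sB′ sB″ (Cov⇒F c₁) (Cov⇒F c₂) in ne (F⇒Cov c₃ , F⇒Cov c₄))
      (TT-no v ab aκ f λ (c₁ , c₂) → let _ , c₃ , c₄ = exchange₂⁻¹ (inj v) a<κ κ<b sB sB′ sB″ (Cov⇒F c₁) (Cov⇒F c₂) in ne (F⇒Cov c₃ , F⇒Cov c₄))))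
    go (inj₁ (c₁ , c₂)) with <-or-> (inj v) κ≢b
    ... | inj₁ q<r = let c₃ , c₄ = exchange₁ (inj v) a<κ κ<b sB sB′ sB″ (Cov⇒F c₁) (Cov⇒F c₂) q<r in
      trans (TT-yes v aκ κb f c₁ c₂) (trans (sym (ℤₚ.+-identityʳ _)) (cong₂ _+_
        (trans (cong f (trans (pair-conj v aκ κb) (cong₂ (λ x y → swapPos x y (swapPos κ b w)) (τ-other a≢κ a≢b) (τ-left κ b))))
               (sym (TT-yes v κb ab f (F⇒Cov c₃) (F⇒Cov c₄))))
        (sym (TT-no v ab aκ f λ (c₅ , c₆) → <-asym q<r (proj₁ (exchange₂⁻¹ (inj v) a<κ κ<b sB sB′ sB″ (Cov⇒F c₅) (Cov⇒F c₆)))))))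
    ... | inj₂ r<q = let c₃ , c₄ = exchange₂ (inj v) a<κ κ<b sB sB′ sB″ (Cov⇒F c₁) (Cov⇒F c₂) r<q in
      trans (TT-yes v aκ κb f c₁ c₂) (trans (sym (ℤₚ.+-identityˡ _)) (cong₂ _+_
        (sym (TT-no v κb ab f λ (c₅ , _) → <-asym r<q (rise c₅)))
        (trans (cong f (sym (trans (pair-conj v ab aκ) (cong₂ (λ x y → swapPos x y (swapPos a κ w)) (τ-left a κ) (τ-other (≢-sym a≢b) (≢-sym κ≢b))))))
               (sym (TT-yes v ab aκ f (F⇒Cov c₃) (F⇒Cov c₄))))))

open CoverRelations

-- Operators on permutations with marked indices

module MarkedStates where
  open import Data.Integer using (_+_; _*_)

  opaque
    unfolding T
    T-cong : ∀ a b {f g} w → (len (swapPos a b w) ≡ suc (len w) → f (swapPos a b w) ≡ g (swapPos a b w)) → T a b f w ≡ T a b g w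
    T-cong a b w h with len (swapPos a b w) ≟ suc (len w)
    ... | yes eq = h eq
    ... | no _   = refl

    T-+ : ∀ a b f g w → T a b (λ w → f w + g w) w ≡ T a b f w + T a b g w
    T-+ a b f g w with len (swapPos a b w) ≟ suc (len w)
    ... | yes _ = refl
    ... | no _  = refl

    T-0 : ∀ a b w → T a b (λ _ → 0ℤ) w ≡ 0ℤ
    T-0 a b w with len (swapPos a b w) ≟ suc (len w)
    ... | yes _ = refl
    ... | no _  = refl

  -- A state is a permutation together with marks on 1, …, k (the head marks k) recording which a have been used.
  State : ℕ → Set
  State k = List ℕ → Vec Bool k → ℤ

  -- Marked indices are skipped and the chosen one becomes marked, which builds the distinctness of
  -- the a's into the operator.
  Z : ∀ k → ℕ → State k → State k
  Z zero    b F w []          = 0ℤ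
  Z (suc k) b F w (true  ∷ u) = Z k b (λ w u → F w (true ∷ u)) w u
  Z (suc k) b F w (false ∷ u) = T (suc k) b (λ w → F w (true ∷ u)) w + Z k b (λ w u → F w (false ∷ u)) w u

  -- The counterpart of `Z` on the indices already used; it supplies the terms of the quadratic
  -- relation in which an index occurs twice.
  Q : ∀ k → ℕ → State k → State k
  Q zero    c F w []          = 0ℤ
  Q (suc k) c F w (true  ∷ u) = T (suc k) c (λ w → F w (true ∷ u)) w + Q k c (λ w u → F w (true ∷ u)) w u
  Q (suc k) c F w (false ∷ u) = Q k c (λ w u → F w (false ∷ u)) w u

  K : ∀ {k} → ℕ → ℕ → State k → State k
  K κ b F w u = T κ b (λ w → F w u) w

  Used : ∀ {k} → Vec Bool k → ℕ → Set
  Used []              a = ⊥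
  Used {suc k} (x ∷ u) a = (x ≡ true × a ≡ suc k) ⊎ Used u a

  -- Agreement is demanded only at states reached by an actual cover and with at most one new mark.
  -- Invariants such as `Room`, or the position of the marked values, survive just such steps.
  Z-cong : ∀ k b {F G : State k} w u →
           (∀ a u′ → 1 ≤ a → a ≤ k → (∀ c → Used u′ c → c ≡ a ⊎ Used u c) →
              len (swapPos a b w) ≡ suc (len w) → F (swapPos a b w) u′ ≡ G (swapPos a b w) u′) →
           Z k b F w u ≡ Z k b G w u
  Z-cong zero    b w []          h = refl
  Z-cong (suc k) b w (true  ∷ u) h = Z-cong k b w u λ a u′ 1≤a a≤k sub eq → h a (true ∷ u′) 1≤a (m≤n⇒m≤1+n a≤k)
    (λ { c (inj₁ used) → inj₂ (inj₁ used) ; c (inj₂ used) → map₂ inj₂ (sub c used) }) eq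
  Z-cong (suc k) b w (false ∷ u) h = cong₂ _+_
    (T-cong (suc k) b w (h (suc k) (true ∷ u) (s≤s z≤n) ≤-refl
      λ { c (inj₁ (_ , eq)) → inj₁ eq ; c (inj₂ used) → inj₂ (inj₂ used) }))
    (Z-cong k b w u λ a u′ 1≤a a≤k sub eq → h a (false ∷ u′) 1≤a (m≤n⇒m≤1+n a≤k)
      (λ { c (inj₁ used) → inj₂ (inj₁ used) ; c (inj₂ used) → map₂ inj₂ (sub c used) }) eq)

  infix 4 _≗ₛ_
  _≗ₛ_ : ∀ {k} → State k → State k → Set
  F ≗ₛ G = ∀ w u → F w u ≡ G w u

  Z-cong-≗ : ∀ k b {F G : State k} → F ≗ₛ G → Z k b F ≗ₛ Z k b G
  Z-cong-≗ k b h w u = Z-cong k b w u (λ a u′ _ _ _ _ → h (swapPos a b w) u′)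

  Z-+ : ∀ k b (F G : State k) → Z k b (λ w u → F w u + G w u) ≗ₛ λ w u → Z k b F w u + Z k b G w u
  Z-+ zero    b F G w []          = refl
  Z-+ (suc k) b F G w (true  ∷ u) = Z-+ k b (λ w u → F w (true ∷ u)) (λ w u → G w (true ∷ u)) w u
  Z-+ (suc k) b F G w (false ∷ u) = trans
    (cong₂ _+_ (T-+ (suc k) b (λ w → F w (true ∷ u)) (λ w → G w (true ∷ u)) w) (Z-+ k b (λ w u → F w (false ∷ u)) (λ w u → G w (false ∷ u)) w u))
    (lemma (T (suc k) b (λ w → F w (true ∷ u)) w) (T (suc k) b (λ w → G w (true ∷ u)) w) (Z k b (λ w u → F w (false ∷ u)) w u) (Z k b (λ w u → G w (false ∷ u)) w u))
    where
    lemma : ∀ a b c d → a + b + (c + d) ≡ a + c + (b + d)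
    lemma = solve-∀

  Z-0 : ∀ k b w u → Z k b (λ _ _ → 0ℤ) w u ≡ 0ℤ
  Z-0 zero    b w []          = refl
  Z-0 (suc k) b w (true  ∷ u) = Z-0 k b w u
  Z-0 (suc k) b w (false ∷ u) = cong₂ _+_ (T-0 (suc k) b w) (Z-0 k b w u)

  Q-+ : ∀ k b (F G : State k) → Q k b (λ w u → F w u + G w u) ≗ₛ λ w u → Q k b F w u + Q k b G w u
  Q-+ zero    b F G w []          = refl
  Q-+ (suc k) b F G w (false ∷ u) = Q-+ k b (λ w u → F w (false ∷ u)) (λ w u → G w (false ∷ u)) w u
  Q-+ (suc k) b F G w (true  ∷ u) = trans
    (cong₂ _+_ (T-+ (suc k) b (λ w → F w (true ∷ u)) (λ w → G w (true ∷ u)) w) (Q-+ k b (λ w u → F w (true ∷ u)) (λ w u → G w (true ∷ u)) w u))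
    (lemma (T (suc k) b (λ w → F w (true ∷ u)) w) (T (suc k) b (λ w → G w (true ∷ u)) w) (Q k b (λ w u → F w (true ∷ u)) w u) (Q k b (λ w u → G w (true ∷ u)) w u))
    where
    lemma : ∀ a b c d → a + b + (c + d) ≡ a + c + (b + d)
    lemma = solve-∀

  module _ {n : ℕ} where
    infix 4 _≗ᵥ_
    _≗ᵥ_ : ∀ {k} → State k → State k → Set
    F ≗ᵥ G = ∀ w u → Valid n w → F w u ≡ G w u

    T-cong-≗ᵥ : ∀ {a b} → Pair n a b → ∀ {f g} → (∀ w → Valid n w → f w ≡ g w) → ∀ {w} → Valid n w → T a b f w ≡ T a b g w
    T-cong-≗ᵥ {a} {b} p h {w} v = T-cong a b w (λ _ → h (swapPos a b w) (swap-valid p v))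

    column : ∀ {a k b} → 1 ≤ a → a ≤ k → k < b → b ≤ n → Pair n a b
    column 1≤a a≤k k<b b≤n = pair 1≤a (≤-<-trans a≤k k<b) b≤n

    Z-cong-≗ᵥ : ∀ {k b} → k < b → b ≤ n → ∀ {F G : State k} → F ≗ᵥ G → Z k b F ≗ᵥ Z k b G
    Z-cong-≗ᵥ {k} {b} k<b b≤n h w u v = Z-cong k b w u
      (λ a u′ 1≤a a≤k _ _ → h (swapPos a b w) u′ (swap-valid (column 1≤a a≤k k<b b≤n) v))

    T-Z-comm : ∀ k {b c d} → k < b → b ≤ n → k < c → Pair n c d → c ≢ b → d ≢ b → ∀ (F : State k) {w} u → Valid n w →
               T c d (λ w → Z k b F w u) w ≡ Z k b (λ w u → T c d (λ w → F w u) w) w u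
    T-Z-comm zero    {b} {c} {d} _ _ _ _ _ _ F {w} [] v = T-0 c d w
    T-Z-comm (suc k) k<b b≤n k<c p c≢b d≢b F (true ∷ u) v =
      T-Z-comm k (<⇒≤ k<b) b≤n (<⇒≤ k<c) p c≢b d≢b (λ w u → F w (true ∷ u)) u v
    T-Z-comm (suc k) {b} {c} {d} k<b b≤n k<c p c≢b d≢b F {w} (false ∷ u) v =
      trans (T-+ c d (T (suc k) b (λ w → F w (true ∷ u))) _ w)
        (cong₂ _+_ (T-comm p (pair (s≤s z≤n) k<b b≤n) (≢-sym (<⇒≢ k<c)) c≢b (≢-sym (<⇒≢ (<-trans k<c (Pair.a<b p)))) d≢b (λ w → F w (true ∷ u)) v)
                   (T-Z-comm k (<⇒≤ k<b) b≤n (<⇒≤ k<c) p c≢b d≢b (λ w u → F w (false ∷ u)) u v))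

    T-Q-comm : ∀ k {b c d} → k < b → b ≤ n → k < c → Pair n c d → c ≢ b → d ≢ b → ∀ (F : State k) {w} u → Valid n w →
               T c d (λ w → Q k b F w u) w ≡ Q k b (λ w u → T c d (λ w → F w u) w) w u
    T-Q-comm zero    {b} {c} {d} _ _ _ _ _ _ F {w} [] v = T-0 c d w
    T-Q-comm (suc k) k<b b≤n k<c p c≢b d≢b F (false ∷ u) v =
      T-Q-comm k (<⇒≤ k<b) b≤n (<⇒≤ k<c) p c≢b d≢b (λ w u → F w (false ∷ u)) u v
    T-Q-comm (suc k) {b} {c} {d} k<b b≤n k<c p c≢b d≢b F {w} (true ∷ u) v =
      trans (T-+ c d (T (suc k) b (λ w → F w (true ∷ u))) _ w)
        (cong₂ _+_ (T-comm p (pair (s≤s z≤n) k<b b≤n) (≢-sym (<⇒≢ k<c)) c≢b (≢-sym (<⇒≢ (<-trans k<c (Pair.a<b p)))) d≢b (λ w → F w (true ∷ u)) v)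
                   (T-Q-comm k (<⇒≤ k<b) b≤n (<⇒≤ k<c) p c≢b d≢b (λ w u → F w (true ∷ u)) u v))

    -- Steps in two different columns use different a's because of the marks, so their
    -- transpositions are disjoint.
    Z-comm : ∀ k {b c} → k < b → b ≤ n → k < c → c ≤ n → b ≢ c → ∀ (F : State k) → Z k b (Z k c F) ≗ᵥ Z k c (Z k b F)
    Z-comm zero    k<b b≤n k<c c≤n b≢c F w [] v = refl
    Z-comm (suc k) k<b b≤n k<c c≤n b≢c F w (true ∷ u) v =
      Z-comm k (<⇒≤ k<b) b≤n (<⇒≤ k<c) c≤n b≢c (λ w u → F w (true ∷ u)) w u v
    Z-comm (suc k) {b} {c} k<b b≤n k<c c≤n b≢c F w (false ∷ u) v = begin
      T κ b (λ w → Z k c Fₜ w u) w + Z k b (λ w u → T κ c (λ w → Fₜ w u) w + Z k c F_f w u) w u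
        ≡⟨ cong₂ _+_ (T-Z-comm k (<⇒≤ k<c) c≤n ≤-refl (pair (s≤s z≤n) k<b b≤n) (<⇒≢ k<c) b≢c Fₜ u v) (Z-+ k b _ (Z k c F_f) w u) ⟩
      Z k c (λ w u → T κ b (λ w → Fₜ w u) w) w u + (Z k b (λ w u → T κ c (λ w → Fₜ w u) w) w u + Z k b (Z k c F_f) w u)
        ≡⟨ lemma (Z k c (λ w u → T κ b (λ w → Fₜ w u) w) w u) (Z k b (λ w u → T κ c (λ w → Fₜ w u) w) w u) (Z k b (Z k c F_f) w u) ⟩
      Z k b (λ w u → T κ c (λ w → Fₜ w u) w) w u + (Z k c (λ w u → T κ b (λ w → Fₜ w u) w) w u + Z k b (Z k c F_f) w u)
        ≡⟨ cong₂ (λ x y → x + (Z k c (λ w u → T κ b (λ w → Fₜ w u) w) w u + y))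
             (sym (T-Z-comm k (<⇒≤ k<b) b≤n ≤-refl (pair (s≤s z≤n) k<c c≤n) (<⇒≢ k<b) (≢-sym b≢c) Fₜ u v))
             (Z-comm k (<⇒≤ k<b) b≤n (<⇒≤ k<c) c≤n b≢c F_f w u v) ⟩
      T κ c (λ w → Z k b Fₜ w u) w + (Z k c (λ w u → T κ b (λ w → Fₜ w u) w) w u + Z k c (Z k b F_f) w u)
        ≡⟨ cong (T κ c (λ w → Z k b Fₜ w u) w +_) (sym (Z-+ k c _ (Z k b F_f) w u)) ⟩
      T κ c (λ w → Z k b Fₜ w u) w + Z k c (λ w u → T κ b (λ w → Fₜ w u) w + Z k b F_f w u) w u ∎
      where
      open ≡-Reasoning
      κ = suc k
      Fₜ F_f : State k
      Fₜ w u = F w (true ∷ u)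
      F_f w u = F w (false ∷ u)
      lemma : ∀ x y z → x + (y + z) ≡ y + (x + z)
      lemma = solve-∀

    -- The quadratic relation summed over a. For distinct indices the steps of `Q` and `Z` commute.
    -- The product T_{ab} T_{aκ} occurs on the right only, since a carries its mark when `Q` acts
    -- after `Z` and not when it acts before.
    Z-exchange : ∀ k {κ b} → k < κ → κ < b → b ≤ n → ∀ (F : State k) w u → Valid n w →
      Z k κ (K κ b F) w u + Q k κ (Z k b F) w u ≡ K κ b (Z k b F) w u + Z k b (Q k κ F) w u
    Z-exchange zero {κ} {b} k<κ κ<b b≤n F w [] v = sym (trans (ℤₚ.+-identityʳ _) (T-0 κ b w))
    Z-exchange (suc k) {κ} {b} k<κ κ<b b≤n F w (true ∷ u) v = begin
      Z k κ (K κ b Fₜ) w u + (T a κ (λ w → Z k b Fₜ w u) w + Q k κ (Z k b Fₜ) w u)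
        ≡⟨ lemma (Z k κ (K κ b Fₜ) w u) (T a κ (λ w → Z k b Fₜ w u) w) (Q k κ (Z k b Fₜ) w u) ⟩
      Z k κ (K κ b Fₜ) w u + Q k κ (Z k b Fₜ) w u + T a κ (λ w → Z k b Fₜ w u) w
        ≡⟨ cong₂ _+_ (Z-exchange k (<⇒≤ k<κ) κ<b b≤n Fₜ w u v)
             (T-Z-comm k (<-trans (<⇒≤ k<κ) κ<b) b≤n ≤-refl (pair (s≤s z≤n) k<κ κ≤n) (<⇒≢ (<-trans k<κ κ<b)) (<⇒≢ κ<b) Fₜ u v) ⟩
      K κ b (Z k b Fₜ) w u + Z k b (Q k κ Fₜ) w u + Z k b (λ w u → T a κ (λ w → Fₜ w u) w) w u
        ≡⟨ lemma′ (K κ b (Z k b Fₜ) w u) (Z k b (Q k κ Fₜ) w u) (Z k b (λ w u → T a κ (λ w → Fₜ w u) w) w u) ⟩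
      K κ b (Z k b Fₜ) w u + (Z k b (λ w u → T a κ (λ w → Fₜ w u) w) w u + Z k b (Q k κ Fₜ) w u)
        ≡⟨ cong (K κ b (Z k b Fₜ) w u +_) (sym (Z-+ k b _ (Q k κ Fₜ) w u)) ⟩
      K κ b (Z k b Fₜ) w u + Z k b (λ w u → T a κ (λ w → Fₜ w u) w + Q k κ Fₜ w u) w u ∎
      where
      open ≡-Reasoning
      a = suc k
      κ≤n = ≤-trans (<⇒≤ κ<b) b≤n
      Fₜ : State k
      Fₜ w u = F w (true ∷ u)
      lemma : ∀ x y z → x + (y + z) ≡ x + z + y
      lemma = solve-∀
      lemma′ : ∀ x y z → x + y + z ≡ x + (z + y)
      lemma′ = solve-∀
    Z-exchange (suc k) {κ} {b} k<κ κ<b b≤n F w (false ∷ u) v = begin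
      T a κ (T κ b fₜ) w + Z k κ (K κ b F_f) w u + Q k κ (λ w u → T a b (λ w → Fₜ w u) w + Z k b F_f w u) w u
        ≡⟨ cong₂ (λ x y → x + Z k κ (K κ b F_f) w u + y)
             (T-quadratic (s≤s z≤n) k<κ κ<b b≤n fₜ v) (Q-+ k κ _ (Z k b F_f) w u) ⟩
      T κ b (T a b fₜ) w + T a b (T a κ fₜ) w + Z k κ (K κ b F_f) w u + (Q k κ (λ w u → T a b (λ w → Fₜ w u) w) w u + Q k κ (Z k b F_f) w u)
        ≡⟨ lemma (T κ b (T a b fₜ) w) (T a b (T a κ fₜ) w) (Z k κ (K κ b F_f) w u) (Q k κ (λ w u → T a b (λ w → Fₜ w u) w) w u) (Q k κ (Z k b F_f) w u) ⟩
      T κ b (T a b fₜ) w + (T a b (T a κ fₜ) w + Q k κ (λ w u → T a b (λ w → Fₜ w u) w) w u) + (Z k κ (K κ b F_f) w u + Q k κ (Z k b F_f) w u)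
        ≡⟨ cong₂ (λ x y → T κ b (T a b fₜ) w + (T a b (T a κ fₜ) w + x) + y)
             (sym (T-Q-comm k (<⇒≤ k<κ) κ≤n ≤-refl (pair (s≤s z≤n) (<-trans k<κ κ<b) b≤n) (<⇒≢ k<κ) (≢-sym (<⇒≢ κ<b)) Fₜ u v))
             (Z-exchange k (<⇒≤ k<κ) κ<b b≤n F_f w u v) ⟩
      T κ b (T a b fₜ) w + (T a b (T a κ fₜ) w + T a b (λ w → Q k κ Fₜ w u) w) + (K κ b (Z k b F_f) w u + Z k b (Q k κ F_f) w u)
        ≡⟨ lemma′ (T κ b (T a b fₜ) w) (T a b (T a κ fₜ) w + T a b (λ w → Q k κ Fₜ w u) w) (K κ b (Z k b F_f) w u) (Z k b (Q k κ F_f) w u) ⟩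
      (T κ b (T a b fₜ) w + K κ b (Z k b F_f) w u) + ((T a b (T a κ fₜ) w + T a b (λ w → Q k κ Fₜ w u) w) + Z k b (Q k κ F_f) w u)
        ≡⟨ cong₂ (λ x y → x + (y + Z k b (Q k κ F_f) w u))
             (sym (T-+ κ b (T a b fₜ) (λ w → Z k b F_f w u) w)) (sym (T-+ a b (T a κ fₜ) (λ w → Q k κ Fₜ w u) w)) ⟩
      T κ b (λ w → T a b fₜ w + Z k b F_f w u) w + (T a b (λ w → T a κ fₜ w + Q k κ Fₜ w u) w + Z k b (Q k κ F_f) w u) ∎
      where
      open ≡-Reasoning
      a = suc k
      κ≤n = ≤-trans (<⇒≤ κ<b) b≤n
      Fₜ F_f : State k
      Fₜ w u = F w (true ∷ u)
      F_f w u = F w (false ∷ u)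
      fₜ : List ℕ → ℤ
      fₜ w = Fₜ w u
      lemma : ∀ p q r s t → p + q + r + (s + t) ≡ p + (q + s) + (r + t)
      lemma = solve-∀
      lemma′ : ∀ p q r s → p + q + (r + s) ≡ p + r + (q + s)
      lemma′ = solve-∀

open MarkedStates

-- Generating series of chains and the exchange of columns

module Series where
  open import Data.Integer using (_+_; _*_)

  -- Power series in t with coefficients in State k.
  Seq : ℕ → Set
  Seq k = ℕ → State k

  -- sh O is t O, and R k b is (1 − t Z k b)⁻¹.
  sh : ∀ {k} → (State k → State k) → Seq k → Seq k
  sh O F zero    w u = 0ℤ
  sh O F (suc m) w u = O (F m) w u

  R : ∀ k → ℕ → Seq k → Seq k
  R k b G zero    w u = G zero w u
  R k b G (suc m) w u = G (suc m) w u + Z k b (R k b G m) w u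

  infixl 6 _⊕_
  _⊕_ : ∀ {k} → Seq k → Seq k → Seq k
  (F ⊕ G) m w u = F m w u + G m w u

  𝟘 : ∀ {k} → Seq k
  𝟘 m w u = 0ℤ

  -- The highest column is outermost and hence used first along a chain, which makes the b's weakly
  -- decreasing.
  RR : ∀ k → ℕ → ℕ → Seq k → Seq k
  RR k base zero    F = F
  RR k base (suc d) F = R k (suc (d ℕ.+ base)) (RR k base d F)

  interchange : ∀ a b c d → a + b + (c + d) ≡ a + c + (b + d)
  interchange = solve-∀

  module _ {k : ℕ} where
    R-fix : ∀ b (G : Seq k) m w u → R k b G m w u ≡ G m w u + sh (Z k b) (R k b G) m w u
    R-fix b G zero    w u = sym (ℤₚ.+-identityʳ _)
    R-fix b G (suc m) w u = refl

    R-⊕ : ∀ b (F G : Seq k) m w u → R k b (F ⊕ G) m w u ≡ (R k b F ⊕ R k b G) m w u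
    R-⊕ b F G zero    w u = refl
    R-⊕ b F G (suc m) w u = trans
      (cong (F (suc m) w u + G (suc m) w u +_) (trans (Z-cong-≗ k b (R-⊕ b F G m) w u) (Z-+ k b (R k b F m) (R k b G m) w u)))
      (interchange (F (suc m) w u) (G (suc m) w u) (Z k b (R k b F m) w u) (Z k b (R k b G m) w u))

    R-𝟘 : ∀ b m w u → R k b 𝟘 m w u ≡ 0ℤ
    R-𝟘 b zero    w u = refl
    R-𝟘 b (suc m) w u = cong (0ℤ +_) (trans (Z-cong-≗ k b (R-𝟘 b m) w u) (Z-0 k b w u))

    RR-⊕ : ∀ base d (F G : Seq k) m w u → RR k base d (F ⊕ G) m w u ≡ (RR k base d F ⊕ RR k base d G) m w u
    RR-⊕ base zero    F G m w u = refl
    RR-⊕ base (suc d) F G m w u = trans (R-cong-≗ (RR-⊕ base d F G) m w u) (R-⊕ (suc (d ℕ.+ base)) (RR k base d F) (RR k base d G) m w u)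
      where
      R-cong-≗ : ∀ {b F G} → (∀ m w u → F m w u ≡ G m w u) → ∀ m w u → R k b F m w u ≡ R k b G m w u
      R-cong-≗ h zero    w u = h zero w u
      R-cong-≗ {b} h (suc m) w u = cong₂ _+_ (h (suc m) w u) (Z-cong-≗ k b (R-cong-≗ h m) w u)

  module _ {n k : ℕ} where
    infix 4 _≈_
    _≈_ : Seq k → Seq k → Set
    F ≈ G = ∀ m w u → Valid n w → F m w u ≡ G m w u

    ≈-sym : ∀ {F G} → F ≈ G → G ≈ F
    ≈-sym h m w u v = sym (h m w u v)

    ≈-trans : ∀ {F G H} → F ≈ G → G ≈ H → F ≈ H
    ≈-trans h h′ m w u v = trans (h m w u v) (h′ m w u v)

    R-cong : ∀ {b} → k < b → b ≤ n → ∀ {F G} → F ≈ G → R k b F ≈ R k b G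
    R-cong k<b b≤n h zero    w u v = h zero w u v
    R-cong k<b b≤n h (suc m) w u v = cong₂ _+_ (h (suc m) w u v) (Z-cong-≗ᵥ k<b b≤n (R-cong k<b b≤n h m) w u v)

    -- The factor t makes coefficient m + 1 depend on coefficient m only. Identities between
    -- inverses of 1 - t Z_b are thereby reduced to checking a fixed-point equation.
    R-unique : ∀ {b} → k < b → b ≤ n → ∀ {H G} → H ≈ G ⊕ sh (Z k b) H → H ≈ R k b G
    R-unique k<b b≤n h zero    w u v = trans (h zero w u v) (ℤₚ.+-identityʳ _)
    R-unique k<b b≤n {G = G} h (suc m) w u v =
      trans (h (suc m) w u v) (cong (G (suc m) w u +_) (Z-cong-≗ᵥ k<b b≤n (R-unique k<b b≤n h m) w u v))

    record Linear (O : State k → State k) : Set where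
      field
        O-cong : ∀ {F G} → _≗ᵥ_ {n} F G → _≗ᵥ_ {n} (O F) (O G)
        O-+    : ∀ F G → O (λ w u → F w u + G w u) ≗ₛ λ w u → O F w u + O G w u
    open Linear

    R-sh-comm : ∀ {b} → k < b → b ≤ n → ∀ {O} → Linear O → (∀ F → _≗ᵥ_ {n} (O (Z k b F)) (Z k b (O F))) →
                ∀ G → R k b (sh O G) ≈ sh O (R k b G)
    R-sh-comm         k<b b≤n     l comm G zero    w u v = refl
    R-sh-comm {b} k<b b≤n {O} l comm G (suc zero) w u v = trans (cong (O (G 0) w u +_) (Z-0 k b w u)) (ℤₚ.+-identityʳ _)
    R-sh-comm {b} k<b b≤n {O} l comm G (suc (suc m)) w u v = trans
      (cong (O (G (suc m)) w u +_) (trans (Z-cong-≗ᵥ k<b b≤n (R-sh-comm k<b b≤n l comm G (suc m)) w u v) (sym (comm (R k b G m) w u v))))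
      (sym (O-+ l (G (suc m)) (Z k b (R k b G m)) w u))

    Z-linear : ∀ {b} → k < b → b ≤ n → Linear (Z k b)
    Z-linear {b} k<b b≤n = record { O-cong = Z-cong-≗ᵥ k<b b≤n ; O-+ = Z-+ k b }

    Z-self-comm : ∀ b F → _≗ᵥ_ {n} (Z k b (Z k b F)) (Z k b (Z k b F))
    Z-self-comm b F w u v = refl

    R-comm : ∀ {b c} → k < b → b ≤ n → k < c → c ≤ n → b ≢ c → ∀ G → R k b (R k c G) ≈ R k c (R k b G)
    R-comm {b} {c} k<b b≤n k<c c≤n b≢c G = R-unique k<c c≤n λ m w u v → begin
      R k b (R k c G) m w u
        ≡⟨ R-cong k<b b≤n (λ m w u v → R-fix c G m w u) m w u v ⟩
      R k b (G ⊕ sh (Z k c) (R k c G)) m w u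
        ≡⟨ R-⊕ b G (sh (Z k c) (R k c G)) m w u ⟩
      R k b G m w u + R k b (sh (Z k c) (R k c G)) m w u
        ≡⟨ cong (R k b G m w u +_) (R-sh-comm k<b b≤n (Z-linear k<c c≤n) (Z-comm k k<c c≤n k<b b≤n (≢-sym b≢c)) (R k c G) m w u v) ⟩
      R k b G m w u + sh (Z k c) (R k b (R k c G)) m w u ∎
      where open ≡-Reasoning

    module Exchange {κ b : ℕ} (k<κ : k < κ) (κ<b : κ < b) (b≤n : b ≤ n) where
      private
        κ≤n = ≤-trans (<⇒≤ κ<b) b≤n
        k<b = <-trans k<κ κ<b
      Kb : State k → State k
      Kb = K κ b

      K-linear : Linear Kb
      K-linear = record
        { O-cong = λ h w u v → T-cong-≗ᵥ (pair (≤-trans (s≤s z≤n) k<κ) κ<b b≤n) (λ w → h w u) v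
        ; O-+    = λ F G w u → T-+ κ b (λ w → F w u) (λ w → G w u) w }

      K-Z-comm : ∀ {c} → k < c → c ≤ n → κ ≢ c → b ≢ c → ∀ F → _≗ᵥ_ {n} (Kb (Z k c F)) (Z k c (Kb F))
      K-Z-comm k<c c≤n κ≢c b≢c F w u v =
        T-Z-comm k k<c c≤n k<κ (pair (≤-trans (s≤s z≤n) k<κ) κ<b b≤n) κ≢c b≢c F u v

      module _ (G : Seq k) where
        private
          H X : Seq k
          H = R k b G
          X = R k κ (sh (Q k κ) H)

        -- The right-hand side is shown to solve the fixed-point equation of (1 - t Z_κ)⁻¹ applied
        -- to t K G + t Q H. After expanding H and X once, the equation is `Z-exchange` for H
        -- together with `Z-comm` for X.
        partial : R k κ (sh Kb G) ⊕ X ≈ sh Kb H ⊕ R k κ (sh (Q k κ) G) ⊕ sh (Z k b) X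
        partial = ≈-sym (≈-trans (R-unique k<κ κ≤n {Y} {sh Kb G ⊕ sh (Q k κ) H} solves)
                                 (λ m w u v → R-⊕ κ (sh Kb G) (sh (Q k κ) H) m w u))
          where
          open ≡-Reasoning
          Y : Seq k
          Y = sh Kb H ⊕ R k κ (sh (Q k κ) G) ⊕ sh (Z k b) X
          core : ∀ m w u → Valid n w →
                 Kb (H m) w u + Q k κ (G m) w u + Z k b (X m) w u ≡
                 Kb (G m) w u + Q k κ (H m) w u + (Z k κ (sh Kb H m) w u + Z k κ (sh (Z k b) X m) w u)
          core zero    w u v = cong (Kb (G 0) w u + Q k κ (G 0) w u +_)
            (trans (Z-0 k b w u) (sym (cong₂ _+_ (Z-0 k κ w u) (Z-0 k κ w u))))
          core (suc l) w u v = begin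
            Kb (H (suc l)) w u + Q k κ (G (suc l)) w u + Z k b (X (suc l)) w u
              ≡⟨ cong₂ (λ x y → x + Q k κ (G (suc l)) w u + y)
                   (O-+ K-linear (G (suc l)) (Z k b (H l)) w u) (Z-+ k b (Q k κ (H l)) (Z k κ (X l)) w u) ⟩
            kg + kzh + qg + (zqh + Z k b (Z k κ (X l)) w u)
              ≡⟨ cong (λ x → kg + kzh + qg + (zqh + x)) (Z-comm k k<b b≤n k<κ κ≤n (≢-sym (<⇒≢ κ<b)) (X l) w u v) ⟩
            kg + kzh + qg + (zqh + zzx)
              ≡⟨ lemma₁ kg kzh qg zqh zzx ⟩
            kg + qg + (kzh + zqh) + zzx
              ≡⟨ cong (λ x → kg + qg + x + zzx) (sym (Z-exchange k k<κ κ<b b≤n (H l) w u v)) ⟩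
            kg + qg + (zkh + qzh) + zzx
              ≡⟨ lemma₂ kg qg zkh qzh zzx ⟩
            kg + (qg + qzh) + (zkh + zzx)
              ≡⟨ cong (λ x → kg + x + (zkh + zzx)) (sym (Q-+ k κ (G (suc l)) (Z k b (H l)) w u)) ⟩
            kg + Q k κ (H (suc l)) w u + (zkh + zzx) ∎
            where
            kg = Kb (G (suc l)) w u
            kzh = Kb (Z k b (H l)) w u
            qg = Q k κ (G (suc l)) w u
            qzh = Q k κ (Z k b (H l)) w u
            zqh = Z k b (Q k κ (H l)) w u
            zkh = Z k κ (Kb (H l)) w u
            zzx = Z k κ (Z k b (X l)) w u
            lemma₁ : ∀ a b c d e → a + b + c + (d + e) ≡ a + c + (b + d) + e
            lemma₁ = solve-∀
            lemma₂ : ∀ a b c d e → a + b + (c + d) + e ≡ a + (b + d) + (c + e)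
            lemma₂ = solve-∀
          solves : Y ≈ sh Kb G ⊕ sh (Q k κ) H ⊕ sh (Z k κ) Y
          solves zero    w u v = refl
          solves (suc m) w u v = begin
            Kb (H m) w u + (Q k κ (G m) w u + Z k κ (RQ m) w u) + Z k b (X m) w u
              ≡⟨ lemma₁ (Kb (H m) w u) (Q k κ (G m) w u) (Z k κ (RQ m) w u) (Z k b (X m) w u) ⟩
            Kb (H m) w u + Q k κ (G m) w u + Z k b (X m) w u + Z k κ (RQ m) w u
              ≡⟨ cong (_+ Z k κ (RQ m) w u) (core m w u v) ⟩
            kg+qh + (Z k κ (sh Kb H m) w u + Z k κ (sh (Z k b) X m) w u) + Z k κ (RQ m) w u
              ≡⟨ lemma₂ kg+qh (Z k κ (sh Kb H m) w u) (Z k κ (sh (Z k b) X m) w u) (Z k κ (RQ m) w u) ⟩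
            kg+qh + (Z k κ (sh Kb H m) w u + Z k κ (RQ m) w u + Z k κ (sh (Z k b) X m) w u)
              ≡⟨ cong (kg+qh +_) (sym (trans (Z-+ k κ ((sh Kb H ⊕ RQ) m) (sh (Z k b) X m) w u)
                   (cong (_+ Z k κ (sh (Z k b) X m) w u) (Z-+ k κ (sh Kb H m) (RQ m) w u)))) ⟩
            kg+qh + Z k κ (Y m) w u ∎
            where
            RQ : Seq k
            RQ = R k κ (sh (Q k κ) G)
            kg+qh = Kb (G m) w u + Q k κ (H m) w u
            lemma₁ : ∀ a b c d → a + (b + c) + d ≡ a + b + d + c
            lemma₁ = solve-∀
            lemma₂ : ∀ a b c d → a + (b + c) + d ≡ a + (b + d + c)
            lemma₂ = solve-∀

        -- `partial` with (1 - t Z_b)⁻¹ applied to it. On the left X becomes R_b X = X + t Z_b R_b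
        -- X, and the last summand is the image of t Z_b X on the right, so the two cancel.
        exchange : R k b (R k κ (sh Kb G)) ⊕ X ≈ R k b (sh Kb H) ⊕ R k b (R k κ (sh (Q k κ) G))
        exchange m w u v = cancel (R k b (R k κ (sh Kb G)) m w u) (X m w u) (R k b (sh Kb H) m w u)
            (R k b (R k κ (sh (Q k κ) G)) m w u) (R k b (sh (Z k b) X) m w u) (begin
          R k b (R k κ (sh Kb G)) m w u + (X m w u + R k b (sh (Z k b) X) m w u)
            ≡⟨ cong (R k b (R k κ (sh Kb G)) m w u +_) (trans
                 (cong (X m w u +_) (R-sh-comm k<b b≤n (Z-linear k<b b≤n) (Z-self-comm b) X m w u v))
                 (sym (R-fix b X m w u))) ⟩
          R k b (R k κ (sh Kb G)) m w u + R k b X m w u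
            ≡⟨ sym (R-⊕ b (R k κ (sh Kb G)) X m w u) ⟩
          R k b (R k κ (sh Kb G) ⊕ X) m w u
            ≡⟨ R-cong k<b b≤n partial m w u v ⟩
          R k b (sh Kb H ⊕ R k κ (sh (Q k κ) G) ⊕ sh (Z k b) X) m w u
            ≡⟨ trans (R-⊕ b (sh Kb H ⊕ R k κ (sh (Q k κ) G)) (sh (Z k b) X) m w u)
                 (cong (_+ R k b (sh (Z k b) X) m w u) (R-⊕ b (sh Kb H) (R k κ (sh (Q k κ) G)) m w u)) ⟩
          R k b (sh Kb H) m w u + R k b (R k κ (sh (Q k κ) G)) m w u + R k b (sh (Z k b) X) m w u ∎)
          where
          open ≡-Reasoning
          cancel : ∀ a x b c y → a + (x + y) ≡ b + c + y → a + x ≡ b + c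
          cancel a x b c y eq = ∙-cancelʳ y (a + x) (b + c) (trans (ℤₚ.+-assoc a x y) eq)

    module Columns (κ : ℕ) (k<κ : k < κ) (F : Seq k) where
      -- V₁ d enumerates the chains in the columns κ + 1, …, κ + d that use κ exactly once.
      DK V₁ : ℕ → Seq k
      DK zero    = 𝟘
      DK (suc d) = DK d ⊕ sh (K κ (suc (d ℕ.+ κ))) F

      V₀ : ℕ → Seq k
      V₀ d = RR k κ d F

      V₁ zero    = 𝟘
      V₁ (suc d) = R k (suc (d ℕ.+ κ)) (sh (K κ (suc (d ℕ.+ κ))) (V₀ (suc d)) ⊕ V₁ d)

      private
        κ<col : ∀ d → κ < suc (d ℕ.+ κ)
        κ<col d = s≤s (m≤n+m κ d)

        RR-R-comm : ∀ d → d ℕ.+ κ ≤ n → ∀ G → RR k κ d (R k κ G) ≈ R k κ (RR k κ d G)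
        RR-R-comm zero    _   G m w u v = refl
        RR-R-comm (suc d) d≤n G = ≈-trans
          (R-cong (<-trans k<κ (κ<col d)) d≤n (RR-R-comm d (<⇒≤ d≤n) G))
          (R-comm (<-trans k<κ (κ<col d)) d≤n k<κ (≤-trans (<⇒≤ (κ<col d)) d≤n) (≢-sym (<⇒≢ (κ<col d))) (RR k κ d G))

        RR-K-comm : ∀ {b} → κ < b → b ≤ n → ∀ d → d ℕ.+ κ < b → ∀ G → RR k κ d (sh (K κ b) G) ≈ sh (K κ b) (RR k κ d G)
        RR-K-comm κ<b b≤n zero    _   G m w u v = refl
        RR-K-comm {b} κ<b b≤n (suc d) d<b G = ≈-trans (R-cong k<c c≤n (RR-K-comm κ<b b≤n d (<⇒≤ d<b) G))
          (R-sh-comm k<c c≤n (Exchange.K-linear k<κ κ<b b≤n) (Exchange.K-Z-comm k<κ κ<b b≤n k<c c≤n (<⇒≢ (κ<col d)) (≢-sym (<⇒≢ d<b))) (RR k κ d G))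
          where
          k<c = <-trans k<κ (κ<col d)
          c≤n = ≤-trans (<⇒≤ d<b) b≤n

      -- Telescopes `exchange` over the columns: each step t_{κ,b}, at first taken after all columns
      -- and after κ, is carried into its own column b, where it becomes the single use of κ counted
      -- by `V₁`. The terms with `Q` are what remains at the two ends.
      columns : ∀ d → d ℕ.+ κ ≤ n →
        RR k κ d (R k κ (DK d)) ⊕ R k κ (sh (Q k κ) (V₀ d)) ≈ V₁ d ⊕ RR k κ d (R k κ (sh (Q k κ) F))
      columns zero    _   m w u v = cong (_+ R k κ (sh (Q k κ) F) m w u) (R-𝟘 κ m w u)
      columns (suc d) d≤n m w u v = begin
        R k b (RR k κ d (R k κ (DK d ⊕ sh (K κ b) F))) m w u + qH
          ≡⟨ cong (_+ qH) (trans (R-cong k<b d≤n (λ m w u v → trans (RR-cong d (<⇒≤ d≤n) (λ m w u v → R-⊕ κ (DK d) (sh (K κ b) F) m w u) m w u v)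
               (RR-⊕ κ d (R k κ (DK d)) (R k κ (sh (K κ b) F)) m w u)) m w u v)
               (R-⊕ b (RR k κ d (R k κ (DK d))) (RR k κ d (R k κ (sh (K κ b) F))) m w u)) ⟩
        dk + R k b (RR k κ d (R k κ (sh (K κ b) F))) m w u + qH
          ≡⟨ cong (λ x → dk + x + qH) (R-cong k<b d≤n (≈-trans (RR-R-comm d (<⇒≤ d≤n) (sh (K κ b) F))
               (R-cong k<κ (≤-trans (<⇒≤ (κ<col d)) d≤n) (RR-K-comm (κ<col d) d≤n d ≤-refl F))) m w u v) ⟩
        dk + rkG + qH
          ≡⟨ ℤₚ.+-assoc dk rkG qH ⟩
        dk + (rkG + qH)
          ≡⟨ cong (dk +_) (Exchange.exchange k<κ (κ<col d) d≤n (V₀ d) m w u v) ⟩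
        dk + (kH + R k b (R k κ (sh (Q k κ) (V₀ d))) m w u)
          ≡⟨ lemma₁ dk kH (R k b (R k κ (sh (Q k κ) (V₀ d))) m w u) ⟩
        kH + (dk + R k b (R k κ (sh (Q k κ) (V₀ d))) m w u)
          ≡⟨ cong (kH +_) (trans (sym (R-⊕ b (RR k κ d (R k κ (DK d))) (R k κ (sh (Q k κ) (V₀ d))) m w u))
               (trans (R-cong k<b d≤n (columns d (<⇒≤ d≤n)) m w u v)
                      (R-⊕ b (V₁ d) (RR k κ d (R k κ (sh (Q k κ) F))) m w u))) ⟩
        kH + (R k b (V₁ d) m w u + rqF)
          ≡⟨ trans (sym (ℤₚ.+-assoc kH (R k b (V₁ d) m w u) rqF)) (cong (_+ rqF) (sym (R-⊕ b (sh (K κ b) (V₀ (suc d))) (V₁ d) m w u))) ⟩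
        V₁ (suc d) m w u + rqF ∎
        where
        open ≡-Reasoning
        b = suc (d ℕ.+ κ)
        k<b = <-trans k<κ (κ<col d)
        qH = R k κ (sh (Q k κ) (V₀ (suc d))) m w u
        dk = R k b (RR k κ d (R k κ (DK d))) m w u
        rkG = R k b (R k κ (sh (K κ b) (V₀ d))) m w u
        kH = R k b (sh (K κ b) (V₀ (suc d))) m w u
        rqF = R k b (RR k κ d (R k κ (sh (Q k κ) F))) m w u
        lemma₁ : ∀ x y z → x + (y + z) ≡ y + (x + z)
        lemma₁ = solve-∀
        RR-cong : ∀ d → d ℕ.+ κ ≤ n → ∀ {F G} → F ≈ G → RR k κ d F ≈ RR k κ d G
        RR-cong zero    _   h = h
        RR-cong (suc d) d≤n h = R-cong (<-trans k<κ (κ<col d)) d≤n (RR-cong d (<⇒≤ d≤n) h)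

  lift : ∀ {k} → Seq k → Seq (suc k)
  lift F m w (x ∷ u) = F m w u

  -- Splits the chains that may also use κ = k + 1 by whether they do.
  module _ {n k : ℕ} (F : Seq k) where
    private
      κ = suc k
    open Columns {n} {k} κ ≤-refl F

    RR-lift-true : ∀ d m w u → RR κ κ d (lift F) m w (true ∷ u) ≡ V₀ d m w u
    RR-lift-true zero    m       w u = refl
    RR-lift-true (suc d) zero    w u = RR-lift-true d zero w u
    RR-lift-true (suc d) (suc m) w u = cong₂ _+_ (RR-lift-true d (suc m) w u) (Z-cong-≗ k _ (RR-lift-true (suc d) m) w u)

    RR-lift-false : ∀ d m w u → RR κ κ d (lift F) m w (false ∷ u) ≡ V₀ d m w u + V₁ d m w u
    RR-lift-false zero    m       w u = sym (ℤₚ.+-identityʳ _)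
    RR-lift-false (suc d) zero    w u = trans (RR-lift-false d zero w u) (cong (V₀ d zero w u +_) (sym (ℤₚ.+-identityˡ _)))
    RR-lift-false (suc d) (suc m) w u = trans
      (cong₂ _+_ (RR-lift-false d (suc m) w u) (cong₂ _+_
        (T-cong κ b w (λ _ → RR-lift-true (suc d) m (swapPos κ b w) u))
        (trans (Z-cong-≗ k b (RR-lift-false (suc d) m) w u) (Z-+ k b (V₀ (suc d) m) (V₁ (suc d) m) w u))))
      (lemma (V₀ d (suc m) w u) (V₁ d (suc m) w u) (K κ b (V₀ (suc d) m) w u) (Z k b (V₀ (suc d) m) w u) (Z k b (V₁ (suc d) m) w u))
      where
      b = suc (d ℕ.+ κ)
      lemma : ∀ p q r s t → p + q + (r + (s + t)) ≡ p + s + (r + q + t)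
      lemma = solve-∀

open Series

-- Multiplication by elementary symmetric polynomials

module ElementaryPieri where
  open import Data.Integer using (_+_; _*_)

  Used-≤ : ∀ {k} (u : Vec Bool k) {a} → Used u a → a ≤ k
  Used-≤ (x ∷ u) (inj₁ (_ , refl)) = ≤-refl
  Used-≤ (x ∷ u) (inj₂ used)       = m≤n⇒m≤1+n (Used-≤ u used)

  unmarked : ∀ k → Vec Bool k
  unmarked k = replicate k false

  unmarked-unused : ∀ k {a} → ¬ Used (unmarked k) a
  unmarked-unused (suc k) (inj₂ used) = unmarked-unused k used

  len⇒cov : ∀ {n a b w} → Valid n w → Pair n a b → len (swapPos a b w) ≡ suc (len w) → Cov w a b
  len⇒cov {w = w} (valid refl i) (pair 1≤a a<b b≤n) eq = len⇒cover w i 1≤a a<b b≤n eq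

  module _ {n : ℕ} where
    Q-vanish : ∀ k {κ} → k < κ → κ ≤ n → ∀ (F : State k) {w} u → Valid n w →
               (∀ a → Used u a → app w κ < app w a) → Q k κ F w u ≡ 0ℤ
    Q-vanish zero    _   _   F []          v above = refl
    Q-vanish (suc k) k<κ κ≤n F (false ∷ u) v above = Q-vanish k (<⇒≤ k<κ) κ≤n (λ w u → F w (false ∷ u)) u v (λ a used → above a (inj₂ used))
    Q-vanish (suc k) k<κ κ≤n F {w} (true ∷ u) v above = cong₂ _+_
      (T-¬cov (λ w → F w (true ∷ u)) v (s≤s z≤n) k<κ κ≤n (λ c → <-asym (rise c) (above (suc k) (inj₁ (refl , refl)))))
      (Q-vanish k (<⇒≤ k<κ) κ≤n (λ w u → F w (true ∷ u)) u v (λ a used → above a (inj₂ used)))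

    -- Within one column the values at the marked positions stay above the value at κ, so no mark can be used again.
    RQ-vanish : ∀ k {κ} → k < κ → κ ≤ n → ∀ (G : Seq k) m {w} u → Valid n w →
                (∀ a → Used u a → app w κ < app w a) → R k κ (sh (Q k κ) G) m w u ≡ 0ℤ
    RQ-vanish k k<κ κ≤n G zero    u v above = refl
    RQ-vanish k {κ} k<κ κ≤n G (suc m) {w} u v above = cong₂ _+_ (Q-vanish k k<κ κ≤n (G m) u v above)
      (trans (Z-cong k κ w u (λ a u′ 1≤a a≤k sub eq →
        let p = column {n} 1≤a a≤k k<κ κ≤n in
        RQ-vanish k k<κ κ≤n G m u′ (swap-valid p v) (stays p u′ sub (len⇒cov v p eq)))) (Z-0 k κ w u))
      where
      stays : ∀ {a} → Pair n a κ → ∀ u′ → (∀ c → Used u′ c → c ≡ a ⊎ Used u c) → Cov w a κ →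
              ∀ c → Used u′ c → app (swapPos a κ w) κ < app (swapPos a κ w) c
      stays {a} p u′ sub cv c used = subst (_< app (swapPos a κ w) c) (sym (app-swapʳ a κ w 1≤a 1≤κ)) (go (c ≟ a) (sub c used))
        where
        1≤a = Pair.1≤a p
        1≤κ = Pair.1≤b p
        go : _ → c ≡ a ⊎ Used u c → app w a < app (swapPos a κ w) c
        go (yes refl) _             = subst (app w a <_) (sym (app-swapˡ a κ w 1≤a 1≤κ)) (rise cv)
        go (no c≢a) (inj₁ c≡a)      = ⊥-elim (c≢a c≡a)
        go (no c≢a) (inj₂ used′)    = subst (app w a <_)
          (sym (app-swap-other a κ w c 1≤a 1≤κ c≢a (<⇒≢ (≤-<-trans (Used-≤ u used′) k<κ)))) (<-trans (rise cv) (above c used′))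

  -- A permutation from which m further covers by t_{a,b} with a ≤ K stay inside S_n.
  record Room (n K m : ℕ) (w : List ℕ) : Set where
    constructor room
    field
      isValid : Valid n w
      space   : m ℕ.+ K < n
      fixed   : ∀ i → n ≤ m ℕ.+ i → app w i ≡ i
  open Room public

  -- If b were above N, position N would lie between a and b, with its value N between those at a
  -- and b; a value above N at a is excluded since such values are fixed points. So a cover enlarges
  -- the support by at most one place.
  cover-fixed : ∀ {n a b w N} → Valid n w → a < N → a < b → (∀ i → N ≤ i → app w i ≡ i) → Cov w a b → b ≤ N
  cover-fixed {a = a} {b} {w} {N} v a<N a<b fix c with ≤-<-connex b N
  ... | inj₁ b≤N = b≤N
  ... | inj₂ N<b = ⊥-elim (empty c N a<N N<b (a<N′ , subst₂ _<_ (sym (fix N ≤-refl)) (sym (fix b (<⇒≤ N<b))) N<b))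
    where
    a<N′ : app w a < app w N
    a<N′ with <-cmp (app w a) (app w N)
    ... | tri< lt _ _ = lt
    ... | tri≈ _ eq _ = ⊥-elim (<⇒≢ a<N (inj v a N eq))
    ... | tri> _ _ gt = ⊥-elim (<⇒≢ (<-trans a<N N<wa) (inj v a (app w a) (sym (fix (app w a) (<⇒≤ N<wa)))))
      where
      N<wa : N < app w a
      N<wa = subst (_< app w a) (fix N ≤-refl) gt

  room-step : ∀ {n K m a b w} → Room n K (suc m) w → Pair n a b → a ≤ K → Cov w a b → Room n K m (swapPos a b w)
  room-step {n} {K} {m} {a} {b} {w} r p a≤K c = room (swap-valid p v) (<⇒≤ (space r)) fix
    where
    v = isValid r
    -- The first position known to be fixed before the step. By `cover-fixed` the step reaches N at
    -- most, so everything beyond N stays fixed.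
    N = n ∸ suc m
    a<N : a < N
    a<N = m+n≤o⇒m≤o∸n (suc a) (≤-trans (s≤s (≤-trans (≤-reflexive (+-comm a (suc m))) (+-monoʳ-≤ (suc m) a≤K))) (space r))
    sm≤n : suc m ≤ n
    sm≤n = ≤-trans (m≤m+n (suc m) K) (<⇒≤ (space r))
    b≤N : b ≤ N
    b≤N = cover-fixed v a<N (Pair.a<b p) (λ i N≤i → fixed r i (≤-trans (≤-reflexive (sym (m+[n∸m]≡n sm≤n))) (+-monoʳ-≤ (suc m) N≤i))) c
    fix : ∀ i → n ≤ m ℕ.+ i → app (swapPos a b w) i ≡ i
    fix i n≤i = trans (app-swap-other a b w i (Pair.1≤a p) (Pair.1≤b p) (≢-sym (<⇒≢ (<-trans (Pair.a<b p) b<i))) (≢-sym (<⇒≢ b<i)))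
                      (fixed r i (m≤n⇒m≤1+n n≤i))
      where
      b<i : b < i
      b<i = ≤-<-trans b≤N (+-cancelˡ-< m N i (<-≤-trans (≤-reflexive (trans (sym (+-suc m N)) (trans (+-comm m (suc N))
        (trans (sym (+-suc N m)) (m∸n+n≡m sm≤n))))) n≤i))

  module _ {n K : ℕ} where
    infix 4 _≈ᵣ_
    _≈ᵣ_ : ∀ {k} → Seq k → Seq k → Set
    F ≈ᵣ G = ∀ m w u → Room n K m w → F m w u ≡ G m w u

    -- Coefficient m sees only states at most m covers away, and every cover lowers both the degree
    -- and the remaining room by one.
    R-cong-room : ∀ {k b} → k ≤ K → k < b → b ≤ n → {F G : Seq k} → F ≈ᵣ G → R k b F ≈ᵣ R k b G
    R-cong-room k≤K k<b b≤n h zero    w u r = h zero w u r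
    R-cong-room {k} {b} k≤K k<b b≤n h (suc m) w u r = cong₂ _+_ (h (suc m) w u r)
      (Z-cong k b w u λ a u′ 1≤a a≤k _ eq → let p = column {n} 1≤a a≤k k<b b≤n in
        R-cong-room k≤K k<b b≤n h m (swapPos a b w) u′ (room-step r p (≤-trans a≤k k≤K) (len⇒cov (isValid r) p eq)))

    RR-cong-room : ∀ {k base} → k ≤ K → k ≤ base → ∀ d → d ℕ.+ base ≤ n → {F G : Seq k} → F ≈ᵣ G → RR k base d F ≈ᵣ RR k base d G
    RR-cong-room k≤K k≤b zero    _   h = h
    RR-cong-room {base = base} k≤K k≤b (suc d) d≤n h =
      R-cong-room k≤K (s≤s (≤-trans k≤b (m≤n+m base d))) d≤n (RR-cong-room k≤K k≤b d (<⇒≤ d≤n) h)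

  tick : ∀ {k} → Seq k → Seq k
  tick F zero    w u = 0ℤ
  tick F (suc m) w u = F m w u

  R-tick : ∀ {k} b (F : Seq k) m w u → R k b (tick F) m w u ≡ tick (R k b F) m w u
  R-tick b F zero          w u = refl
  R-tick {k} b F (suc zero)    w u = trans (cong (F 0 w u +_) (Z-0 k b w u)) (ℤₚ.+-identityʳ _)
  R-tick {k} b F (suc (suc m)) w u = cong (F (suc m) w u +_) (Z-cong-≗ k b (R-tick b F (suc m)) w u)

  R-cong-≗ : ∀ {k b} {F G : Seq k} → (∀ m w u → F m w u ≡ G m w u) → ∀ m w u → R k b F m w u ≡ R k b G m w u
  R-cong-≗ h zero    w u = h zero w u
  R-cong-≗ {k} {b} h (suc m) w u = cong₂ _+_ (h (suc m) w u) (Z-cong-≗ k b (R-cong-≗ h m) w u)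

  RR-tick : ∀ {k} base d (F : Seq k) m w u → RR k base d (tick F) m w u ≡ tick (RR k base d F) m w u
  RR-tick base zero    F m w u = refl
  RR-tick base (suc d) F m w u = trans (R-cong-≗ (RR-tick base d F) m w u) (R-tick _ (RR _ base d F) m w u)

  -- Isolates the innermost column k + 1, the one that disappears when k + 1 becomes an index.
  RR-front : ∀ {k} d (F : Seq k) → RR k k (suc d) F ≡ RR k (suc k) d (R k (suc k) F)
  RR-front         zero    F = refl
  RR-front {k} (suc d) F = cong₂ (R k) (cong suc (sym (+-suc d k))) (RR-front d F)

  pure : ∀ {k} → Functional → Seq k
  pure φ zero    w u = ⟨ φ ⟩ w
  pure φ (suc m) w u = 0ℤ

  Sum-split : ∀ a b g → Sum (a ℕ.+ b) g ≡ Sum a g + Sum b (λ j → g (a ℕ.+ j))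
  Sum-split zero    b g = sym (ℤₚ.+-identityˡ _)
  Sum-split (suc a) b g = trans (cong (g 0 +_) (Sum-split a b (λ j → g (suc j)))) (sym (ℤₚ.+-assoc (g 0) (Sum a (λ j → g (suc j))) _))

  Sum-* : ∀ n c g → Sum n (λ j → c * g j) ≡ c * Sum n g
  Sum-* zero    c g = sym (ℤₚ.*-zeroʳ c)
  Sum-* (suc n) c g = trans (cong (λ z → c * g 0 + z) (Sum-* n c (λ j → g (suc j)))) (sym (ℤₚ.*-distribˡ-+ c (g 0) _))

  Z+Q : ∀ k κ (f : List ℕ → ℤ) w u → Z k κ (λ w _ → f w) w u + Q k κ (λ w _ → f w) w u ≡ Sum k (λ j → T (suc j) κ f w)
  Z+Q zero    κ f w []          = refl
  Z+Q (suc k) κ f w (false ∷ u) = trans (lemma (T (suc k) κ f w) (Z k κ (λ w _ → f w) w u) (Q k κ (λ w _ → f w) w u))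
    (trans (cong (_+ T (suc k) κ f w) (Z+Q k κ f w u)) (sym (Sum-last k (λ j → T (suc j) κ f w))))
    where
    lemma : ∀ x y z → x + y + z ≡ y + z + x
    lemma = solve-∀
  Z+Q (suc k) κ f w (true ∷ u) = trans (lemma (T (suc k) κ f w) (Z k κ (λ w _ → f w) w u) (Q k κ (λ w _ → f w) w u))
    (trans (cong (_+ T (suc k) κ f w) (Z+Q k κ f w u)) (sym (Sum-last k (λ j → T (suc j) κ f w))))
    where
    lemma : ∀ x y z → y + (x + z) ≡ y + z + x
    lemma = solve-∀

  monk′ : ∀ {n} k d → d ℕ.+ suc k ≡ n → suc k < n → ∀ {w} → Valid n w → app w n ≡ n → ∀ φ →
          ⟨ X* k φ ⟩ w + Sum k (λ j → T (suc j) (suc k) ⟨ φ ⟩ w) ≡ Sum d (λ j → T (suc k) (suc (j ℕ.+ suc k)) ⟨ φ ⟩ w)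
  monk′ {n} k d refl κ<n {w} v fix φ = begin
    ⟨ X* k φ ⟩ w + A
      ≡⟨ cong (_+ A) (monk (n ℕ.* n) w v (m≤m+n _ _) fix κ (s≤s z≤n) κ<n φ) ⟩
    Sum n (λ j → term κ (suc j) ⟨ φ ⟩ w) + A
      ≡⟨ cong (_+ A) (trans (cong (λ z → Sum z (λ j → term κ (suc j) ⟨ φ ⟩ w)) (+-comm d κ)) (Sum-split κ d (λ j → term κ (suc j) ⟨ φ ⟩ w))) ⟩
    Sum κ (λ j → term κ (suc j) ⟨ φ ⟩ w) + Sum d (λ j → term κ (suc (κ ℕ.+ j)) ⟨ φ ⟩ w) + A
      ≡⟨ cong₂ (λ x y → x + y + A) below
           (Sum-cong d (λ j _ → trans (cong (λ z → term κ (suc z) ⟨ φ ⟩ w) (+-comm κ j)) (term-< ⟨ φ ⟩ w (s≤s (m≤n+m κ j))))) ⟩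
    -1ℤ * A + Sum d (λ j → T κ (suc (j ℕ.+ κ)) ⟨ φ ⟩ w) + A
      ≡⟨ lemma A (Sum d (λ j → T κ (suc (j ℕ.+ κ)) ⟨ φ ⟩ w)) ⟩
    Sum d (λ j → T κ (suc (j ℕ.+ κ)) ⟨ φ ⟩ w) ∎
    where
    open ≡-Reasoning
    κ = suc k
    A = Sum k (λ j → T (suc j) κ ⟨ φ ⟩ w)
    lemma : ∀ a b → -1ℤ * a + b + a ≡ b
    lemma = solve-∀
    below : Sum κ (λ j → term κ (suc j) ⟨ φ ⟩ w) ≡ -1ℤ * A
    below = trans (Sum-last k (λ j → term κ (suc j) ⟨ φ ⟩ w)) (trans (cong₂ _+_
      (trans (Sum-cong k (λ j j<k → term-> ⟨ φ ⟩ w (s≤s j<k))) (Sum-* k -1ℤ (λ j → T (suc j) κ ⟨ φ ⟩ w)))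
      (term-refl κ ⟨ φ ⟩ w)) (ℤₚ.+-identityʳ _))

  module Pieri {n K : ℕ} where
    module Step (k d : ℕ) (d+κ≡n : d ℕ.+ suc k ≡ n) (κ≤K : suc k ≤ K) (φ : Functional) where
      κ = suc k
      F : Seq k
      F = pure φ
      open Columns {n} {k} κ ≤-refl F

      k≤K : k ≤ K
      k≤K = <⇒≤ κ≤K
      d≤n : d ℕ.+ κ ≤ n
      d≤n = ≤-reflexive d+κ≡n
      κ≤n : κ ≤ n
      κ≤n = ≤-trans (m≤n+m κ d) d≤n

      DK-zero : ∀ d w u → DK d zero w u ≡ 0ℤ
      DK-zero zero    w u = refl
      DK-zero (suc d) w u = trans (ℤₚ.+-identityʳ _) (DK-zero d w u)

      DK-one : ∀ d w u → DK d 1 w u ≡ Sum d (λ j → T κ (suc (j ℕ.+ κ)) ⟨ φ ⟩ w)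
      DK-one zero    w u = refl
      DK-one (suc d) w u = trans (cong (_+ T κ (suc (d ℕ.+ κ)) ⟨ φ ⟩ w) (DK-one d w u)) (sym (Sum-last d (λ j → T κ (suc (j ℕ.+ κ)) ⟨ φ ⟩ w)))

      DK-two : ∀ d m w u → DK d (suc (suc m)) w u ≡ 0ℤ
      DK-two zero    m w u = refl
      DK-two (suc d) m w u = cong₂ _+_ (DK-two d m w u) (T-0 κ (suc (d ℕ.+ κ)) w)

      Q-0 : ∀ k c w u → Q k c (λ _ _ → 0ℤ) w u ≡ 0ℤ
      Q-0 zero    c w []          = refl
      Q-0 (suc k) c w (false ∷ u) = Q-0 k c w u
      Q-0 (suc k) c w (true  ∷ u) = cong₂ _+_ (T-0 (suc k) c w) (Q-0 k c w u)

      -- Monk's rule at κ as an identity of series: the upward covers collected in `DK` are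
      -- multiplication by x_κ plus the covers t_{a,κ} with a < κ, which the marks split into `Q`
      -- and `Z`. The room guarantees that n is still fixed in degree one.
      monk-seq : _≈ᵣ_ {n} {K} (DK d) (tick (pure (X* k φ)) ⊕ sh (Q k κ) F ⊕ sh (Z k κ) F)
      monk-seq zero          w u r = DK-zero d w u
      monk-seq (suc zero)    w u r = trans (DK-one d w u) (trans
        (sym (monk′ k d d+κ≡n (≤-<-trans κ≤K (≤-trans (s≤s (m≤n+m K 1)) (space r))) (isValid r) (fixed r n (m≤n+m n 1)) φ))
        (trans (cong (⟨ X* k φ ⟩ w +_) (sym (Z+Q k κ ⟨ φ ⟩ w u)))
          (lemma (⟨ X* k φ ⟩ w) (Z k κ (λ w _ → ⟨ φ ⟩ w) w u) (Q k κ (λ w _ → ⟨ φ ⟩ w) w u))))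
        where
        lemma : ∀ x y z → x + (y + z) ≡ x + z + y
        lemma = solve-∀
      monk-seq (suc (suc m)) w u r = trans (DK-two d m w u)
        (sym (cong₂ (λ x y → 0ℤ + x + y) (Q-0 k κ w u) (Z-0 k κ w u)))

      RRκ : Seq k → Seq k
      RRκ G = RR k κ d (R k κ G)

      RRκ-⊕ : ∀ G H m w u → RRκ (G ⊕ H) m w u ≡ RRκ G m w u + RRκ H m w u
      RRκ-⊕ G H m w u = trans (RR-cong-≗ d (R-⊕ κ G H) m w u) (RR-⊕ κ d (R k κ G) (R k κ H) m w u)
        where
        RR-cong-≗ : ∀ d {F G : Seq k} → (∀ m w u → F m w u ≡ G m w u) → ∀ m w u → RR k κ d F m w u ≡ RR k κ d G m w u
        RR-cong-≗ zero    h = h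
        RR-cong-≗ (suc d) h = R-cong-≗ (RR-cong-≗ d h)

      RRκ-cong : ∀ {G H : Seq k} → _≈ᵣ_ {n} {K} G H → _≈ᵣ_ {n} {K} (RRκ G) (RRκ H)
      RRκ-cong h = RR-cong-room k≤K (n≤1+n k) d d≤n (R-cong-room k≤K ≤-refl κ≤n h)

      RRκ-F : _≈ᵣ_ {n} {K} (RRκ F) (V₀ d ⊕ RRκ (sh (Z k κ) F))
      RRκ-F m w u r = trans (RR-cong-room k≤K (n≤1+n k) d d≤n (λ m w u r → trans (R-fix κ F m w u)
          (cong (F m w u +_) (sym (R-sh-comm ≤-refl κ≤n (Z-linear ≤-refl κ≤n) (Z-self-comm {n} κ) F m w u (isValid r))))) m w u r)
        (RR-⊕ κ d F (R k κ (sh (Z k κ) F)) m w u)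

      -- Chains over k + 1 indices either avoid κ (`v₀`) or use it once (`v₁`). By `columns` and
      -- Monk's rule v₁ + e = x + e + z, as the other `Q` term vanishes on unmarked states. Then v₀
      -- + z restores the full product with column κ, and x carries the factor t x_κ.
      step : ∀ m w → Room n K m w → RR κ κ d (pure φ) m w (unmarked κ) ≡
             RR k k (suc d) (pure φ) m w (unmarked k) + tick (RR k k (suc d) (pure (X* k φ))) m w (unmarked k)
      step m w r = begin
        RR κ κ d (pure φ) m w (false ∷ ε)
          ≡⟨ RR-cong-room κ≤K ≤-refl d d≤n pure-lift m w (false ∷ ε) r ⟩
        RR κ κ d (lift F) m w (false ∷ ε)
          ≡⟨ RR-lift-false {n} F d m w ε ⟩
        v₀ + v₁
          ≡⟨ ∙-cancelʳ e (v₀ + v₁) (v₀ + z + x) (trans (ℤₚ.+-assoc v₀ v₁ e) (trans (cong (v₀ +_) used) (lemma v₀ x e z))) ⟩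
        v₀ + z + x
          ≡⟨ cong (_+ x) (sym (RRκ-F m w ε r)) ⟩
        RRκ F m w ε + x
          ≡⟨ cong₂ _+_ (cong (λ G → G m w ε) (sym (RR-front d F)))
               (trans (cong (λ G → G m w ε) (sym (RR-front d (tick (pure (X* k φ)))))) (RR-tick k (suc d) (pure (X* k φ)) m w ε)) ⟩
        RR k k (suc d) F m w ε + tick (RR k k (suc d) (pure (X* k φ))) m w ε ∎
        where
        open ≡-Reasoning
        ε = unmarked k
        v₀ = V₀ d m w ε
        v₁ = V₁ d m w ε
        x = RRκ (tick (pure (X* k φ))) m w ε
        e = RRκ (sh (Q k κ) F) m w ε
        z = RRκ (sh (Z k κ) F) m w ε
        pure-lift : _≈ᵣ_ {n} {K} {κ} (pure φ) (lift F)
        pure-lift zero    w (x ∷ u) r = refl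
        pure-lift (suc m) w (x ∷ u) r = refl
        lemma : ∀ v x e z → v + (x + e + z) ≡ v + z + x + e
        lemma = solve-∀
        used : v₁ + e ≡ x + e + z
        used = begin
          v₁ + e
            ≡⟨ sym (columns d d≤n m w ε (isValid r)) ⟩
          RRκ (DK d) m w ε + R k κ (sh (Q k κ) (V₀ d)) m w ε
            ≡⟨ trans (cong (RRκ (DK d) m w ε +_) (RQ-vanish k ≤-refl κ≤n (V₀ d) m ε (isValid r) (λ a u → ⊥-elim (unmarked-unused k u)))) (ℤₚ.+-identityʳ _) ⟩
          RRκ (DK d) m w ε
            ≡⟨ RRκ-cong monk-seq m w ε r ⟩
          RRκ (tick (pure (X* k φ)) ⊕ sh (Q k κ) F ⊕ sh (Z k κ) F) m w ε
            ≡⟨ trans (RRκ-⊕ (tick (pure (X* k φ)) ⊕ sh (Q k κ) F) (sh (Z k κ) F) m w ε) (cong (_+ z) (RRκ-⊕ (tick (pure (X* k φ))) (sh (Q k κ) F) m w ε)) ⟩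
          x + e + z ∎

    -- Induction on k at constant n = d + k: in each step column k + 1 turns into an index, and
    -- `step` has the shape of the recursion of `elementary`. For k = 0 there is no index to use, so
    -- only the constant coefficient 𝔖_w remains.
    pieri : ∀ k d → d ℕ.+ k ≡ n → k ≤ K → ∀ φ m w → Room n K m w →
            RR k k d (pure φ) m w (unmarked k) ≡ ev (at φ) (𝔖 w *P elementary m k)
    pieri zero    d eq k≤K φ m w r = trans (no-columns d m) (value m)
      where
      no-columns : ∀ d m → RR 0 0 d (pure φ) m w [] ≡ pure {0} φ m w []
      no-columns zero    m       = refl
      no-columns (suc d) zero    = no-columns d zero
      no-columns (suc d) (suc m) = trans (ℤₚ.+-identityʳ _) (no-columns d (suc m))
      value : ∀ m → pure {0} φ m w [] ≡ ev (at φ) (𝔖 w *P elementary m 0)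
      value zero    = sym (ev-*P-one φ (𝔖 w))
      value (suc m) = sym (ev-*P-[] (at φ) (𝔖 w))
    pieri (suc k) d eq κ≤K φ zero w r = trans (Step.step k d eq κ≤K φ zero w r)
      (trans (ℤₚ.+-identityʳ _) (pieri k (suc d) (trans (sym (+-suc d k)) eq) (<⇒≤ κ≤K) φ zero w r))
    pieri (suc k) d eq κ≤K φ (suc m) w r = trans (Step.step k d eq κ≤K φ (suc m) w r)
      (trans (cong₂ _+_ (pieri k (suc d) eq′ (<⇒≤ κ≤K) φ (suc m) w r)
          (trans (pieri k (suc d) eq′ (<⇒≤ κ≤K) (X* k φ) m w (room (isValid r) (<⇒≤ (space r)) (λ i n≤i → fixed r i (m≤n⇒m≤1+n n≤i))))
                 (sym (ev-*P-mulX φ (𝔖 w) k (elementary m k)))))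
        (sym (ev-*P-++ (at φ) (𝔖 w) (elementary (suc m) k) (mulX k (elementary m k)))))
      where
      eq′ : suc d ℕ.+ k ≡ n
      eq′ = trans (sym (+-suc d k)) eq

open ElementaryPieri

-- Schubert polynomials of the cycles c[k,m]

module Cycles where
  open import Data.Integer using (_+_; _*_)

  length-cyc : ∀ k m → length (cyc k m) ≡ suc k
  length-cyc k m = length-map-upTo _ (suc k)

  module _ (k m : ℕ) where
    private
      value : ∀ {i} → i < suc k → app (cyc k m) (suc i) ≡ cycleFun k m (suc i)
      value {i} i<n = trans (app-suc (cyc k m) (subst (i <_) (sym (length-cyc k m)) i<n)) (atZ-map-upTo _ (suc k) i<n)

    cyc-low : ∀ i → i ≤ k ∸ m → app (cyc k m) i ≡ i
    cyc-low zero    _   = app-zero (cyc k m)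
    cyc-low (suc i) i≤c = trans (value (m≤n⇒m≤1+n (≤-trans i≤c (m∸n≤m k m)))) compute
      where
      compute : cycleFun k m (suc i) ≡ suc i
      compute rewrite ≤⇒≤ᵇ-true i≤c = refl

    cyc-middle : ∀ i → k ∸ m < i → i ≤ k → app (cyc k m) i ≡ suc i
    cyc-middle (suc i) c<i i≤k = trans (value (m≤n⇒m≤1+n i≤k)) compute
      where
      compute : cycleFun k m (suc i) ≡ suc (suc i)
      compute rewrite >⇒≤ᵇ-false c<i | ≤⇒≤ᵇ-true i≤k = refl

    cyc-top : app (cyc k m) (suc k) ≡ suc (k ∸ m)
    cyc-top = trans (value ≤-refl) compute
      where
      compute : cycleFun k m (suc k) ≡ suc (k ∸ m)
      compute rewrite >⇒≤ᵇ-false (s≤s (m∸n≤m k m)) | >⇒≤ᵇ-false (n<1+n k) = refl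

    cyc-beyond : ∀ {i} → suc k < i → app (cyc k m) i ≡ i
    cyc-beyond {i} k<i = app-> (cyc k m) (subst (_< i) (sym (length-cyc k m)) k<i)

  ev-elementary-zero : ∀ φ {m k} → k < m → ev φ (elementary m k) ≡ 0ℤ
  ev-elementary-zero φ {suc m} {zero}  _         = refl
  ev-elementary-zero φ {suc m} {suc k} (s≤s k<m) = trans (ev-++ φ (elementary (suc m) k) _)
    (cong₂ _+_ (ev-elementary-zero φ (m<n⇒m<1+n k<m)) (trans (ev-mulX φ k (elementary m k)) (ev-elementary-zero _ k<m)))

  app-cyc-0 : ∀ k i → app (cyc k 0) i ≡ i
  app-cyc-0 k i with <-cmp i (suc k)
  ... | tri< i<k _ _  = cyc-low k 0 i (≤-pred i<k)
  ... | tri≈ _ refl _ = cyc-top k 0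
  ... | tri> _ _ k<i  = cyc-beyond k 0 k<i

  valid-cyc-0 : ∀ k → Valid (suc k) (cyc k 0)
  valid-cyc-0 k = valid (length-cyc k 0) λ i j eq → trans (sym (app-cyc-0 k i)) (trans eq (app-cyc-0 k j))

  ⟨⟩-cyc-0 : ∀ k φ → ⟨ φ ⟩ (cyc k 0) ≡ ev (at φ) one
  ⟨⟩-cyc-0 zero    φ = cong (λ z → 1ℤ * z + 0ℤ) (respects φ (same λ { zero → refl ; (suc i) → refl }))
  ⟨⟩-cyc-0 (suc k) φ = trans (cong ⟨ φ ⟩ (app-ext (cyc (suc k) 0) (pad (cyc k 0))
      (trans (length-cyc (suc k) 0) (sym (trans (length-pad (cyc k 0)) (cong suc (length-cyc k 0)))))
      (λ i → trans (app-cyc-0 (suc k) i) (sym (trans (app-pad (cyc k 0) i) (app-cyc-0 k i))))))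
    (trans (⟨⟩-pad (suc k ℕ.* suc k) (cyc k 0) (s≤s z≤n) (valid-cyc-0 k) (m≤m+n _ _) φ) (⟨⟩-cyc-0 k φ))

  module CycleStep (k m : ℕ) (m≤k : m ≤ k) (vc : Valid (suc k) (cyc k m)) where
    c κ N : ℕ
    c = k ∸ m
    κ = suc k
    N = suc κ
    w : List ℕ
    -- The appended fixed point meets the hypothesis of Monk's rule on the last position and gives
    -- the upward cover t_{κ,N} its target.
    w = pad (cyc k m)
    vw : Valid N w
    vw = valid-pad vc
    A : ℕ → ℕ
    A = app w
    c≤k : c ≤ k
    c≤k = m∸n≤m k m

    A-low : ∀ i → i ≤ c → A i ≡ i
    A-low i i≤c = trans (app-pad (cyc k m) i) (cyc-low k m i i≤c)
    A-middle : ∀ i → c < i → i ≤ k → A i ≡ suc i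
    A-middle i c<i i≤k = trans (app-pad (cyc k m) i) (cyc-middle k m i c<i i≤k)
    A-κ : A κ ≡ suc c
    A-κ = trans (app-pad (cyc k m) κ) (cyc-top k m)
    A-beyond : ∀ {i} → κ < i → A i ≡ i
    A-beyond {i} κ<i = trans (app-pad (cyc k m) i) (cyc-beyond k m κ<i)

    up : swapPos κ N w ≡ cyc (suc k) (suc m)
    up = app-ext (swapPos κ N w) (cyc (suc k) (suc m))
      (trans (size (swap-valid (pair (s≤s z≤n) (n<1+n κ) ≤-refl) vw)) (sym (length-cyc (suc k) (suc m)))) λ i →
      trans (app-swapPos κ N w (s≤s z≤n) (s≤s z≤n) i) (go i (position κ N i))
      where
      go : ∀ i → Position κ N i → A (τ κ N i) ≡ app (cyc (suc k) (suc m)) i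
      go i (isˡ refl) = trans (cong A (τ-left κ N)) (trans (A-beyond (n<1+n κ)) (sym (cyc-middle (suc k) (suc m) κ (s≤s c≤k) ≤-refl)))
      go i (isʳ refl) = trans (cong A (τ-right κ N)) (trans A-κ (sym (cyc-top (suc k) (suc m))))
      go i (other i≢κ i≢N) = trans (cong A (τ-other i≢κ i≢N)) (away (≤-<-connex i c) (<-cmp i κ))
        where
        away : i ≤ c ⊎ c < i → _ → A i ≡ app (cyc (suc k) (suc m)) i
        away (inj₁ i≤c) _               = trans (A-low i i≤c) (sym (cyc-low (suc k) (suc m) i i≤c))
        away (inj₂ c<i) (tri< i<κ _ _)  = trans (A-middle i c<i (≤-pred i<κ)) (sym (cyc-middle (suc k) (suc m) i c<i (<⇒≤ i<κ)))
        away (inj₂ c<i) (tri≈ _ i≡κ _)  = ⊥-elim (i≢κ i≡κ)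
        away (inj₂ c<i) (tri> _ _ κ<i)  = trans (A-beyond κ<i) (sym (cyc-beyond (suc k) (suc m) (≤∧≢⇒< κ<i (≢-sym i≢N))))

    T-up : ∀ φ → T κ N ⟨ φ ⟩ w ≡ ⟨ φ ⟩ (cyc (suc k) (suc m))
    T-up φ = trans (T-cov ⟨ φ ⟩ vw (s≤s z≤n) (n<1+n κ) ≤-refl
      (ascent⇒cover w κ (subst₂ _<_ (sym A-κ) (sym (A-beyond (n<1+n κ))) (s≤s (s≤s c≤k))))) (cong ⟨ φ ⟩ up)

    -- Below position c = k ∸ m, the next position carries a value between those at the two ends;
    -- above c, the values exceed the value c + 1 at κ.
    T-away : ∀ φ j → j < k → suc j ≢ c → T (suc j) κ ⟨ φ ⟩ w ≡ 0ℤ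
    T-away φ j j<k j≢c = T-¬cov ⟨ φ ⟩ vw (s≤s z≤n) (s≤s j<k) (n≤1+n κ) (no-cover (<-cmp (suc j) c))
      where
      no-cover : _ → ¬ Cov w (suc j) κ
      no-cover (tri≈ _ eq _)  _  = j≢c eq
      no-cover (tri> _ _ c<j) cv = <-asym c<j (≤-pred (subst₂ _<_ (A-middle (suc j) c<j j<k) A-κ (rise cv)))
      no-cover (tri< j<c _ _) cv = empty cv (suc (suc j)) (n<1+n (suc j)) (s≤s (≤-trans j<c c≤k))
        (subst₂ _<_ (sym (A-low (suc j) (<⇒≤ j<c))) (sym (A-low (suc (suc j)) j<c)) (n<1+n (suc j)) ,
         subst₂ _<_ (sym (A-low (suc (suc j)) j<c)) (sym A-κ) (s≤s j<c))

    module _ (m<k : m < k) where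
      1≤c : 1 ≤ c
      1≤c = m<n⇒0<n∸m m<k

      c≡ : suc (k ∸ suc m) ≡ c
      c≡ = sym (+-∸-assoc 1 m<k)

      low< : k ∸ suc m < c
      low< = ≤-reflexive c≡

      down : swapPos c κ w ≡ pad (cyc k (suc m))
      down = app-ext (swapPos c κ w) (pad (cyc k (suc m)))
        (trans (size (swap-valid (pair 1≤c (s≤s c≤k) (n≤1+n κ)) vw)) (sym (trans (length-pad (cyc k (suc m))) (cong suc (length-cyc k (suc m)))))) λ i →
        trans (app-swapPos c κ w 1≤c (s≤s z≤n) i) (trans (go i (position c κ i)) (sym (app-pad (cyc k (suc m)) i)))
        where
        go : ∀ i → Position c κ i → A (τ c κ i) ≡ app (cyc k (suc m)) i
        go i (isˡ refl) = trans (cong A (τ-left c κ)) (trans A-κ (sym (cyc-middle k (suc m) c low< c≤k)))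
        go i (isʳ refl) = trans (cong A (τ-right c κ)) (trans (A-low c ≤-refl) (sym (trans (cyc-top k (suc m)) c≡)))
        go i (other i≢c i≢κ) = trans (cong A (τ-other i≢c i≢κ)) (away (<-cmp i c) (<-cmp i κ))
          where
          away : _ → _ → A i ≡ app (cyc k (suc m)) i
          away (tri< i<c _ _) _              = trans (A-low i (<⇒≤ i<c)) (sym (cyc-low k (suc m) i (≤-pred (subst (i <_) (sym c≡) i<c))))
          away (tri≈ _ i≡c _) _              = ⊥-elim (i≢c i≡c)
          away (tri> _ _ c<i) (tri< i<κ _ _) = trans (A-middle i c<i (≤-pred i<κ)) (sym (cyc-middle k (suc m) i (<-trans low< c<i) (≤-pred i<κ)))
          away (tri> _ _ c<i) (tri≈ _ i≡κ _) = ⊥-elim (i≢κ i≡κ)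
          away (tri> _ _ c<i) (tri> _ _ κ<i) = trans (A-beyond κ<i) (sym (cyc-beyond k (suc m) κ<i))

      T-down : ∀ φ → T c κ ⟨ φ ⟩ w ≡ ⟨ φ ⟩ (pad (cyc k (suc m)))
      T-down φ = trans (T-cov ⟨ φ ⟩ vw 1≤c (s≤s c≤k) (n≤1+n κ) (cov (subst₂ _<_ (sym (A-low c ≤-refl)) (sym A-κ) (n<1+n c)) none)) (cong ⟨ φ ⟩ down)
        where
        none : ∀ i → c < i → i < κ → ¬ Between (A c) (A κ) (A i)
        none i c<i i<κ (_ , r) = <-asym c<i (≤-pred (subst₂ _<_ (A-middle i c<i (≤-pred i<κ)) A-κ r))

      sum-down : ∀ φ → Sum k (λ j → T (suc j) κ ⟨ φ ⟩ w) ≡ ⟨ φ ⟩ (pad (cyc k (suc m)))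
      sum-down φ = trans (Sum-single k {λ j → T (suc j) κ ⟨ φ ⟩ w} (k ∸ suc m) (<-≤-trans low< c≤k) (λ j j<k j≢ → T-away φ j j<k (λ eq → j≢ (suc-injective (trans eq (sym c≡))))))
        (trans (cong (λ z → T z κ ⟨ φ ⟩ w) c≡) (T-down φ))

    sum-none : k ≤ m → ∀ φ → Sum k (λ j → T (suc j) κ ⟨ φ ⟩ w) ≡ 0ℤ
    sum-none k≤m φ = Sum-zero k (λ j j<k → T-away φ j j<k (λ eq → 1+n≢0 (trans eq (m≤n⇒m∸n≡0 k≤m))))

    valid-up : Valid N (cyc (suc k) (suc m))
    valid-up = subst (Valid N) up (swap-valid (pair (s≤s z≤n) (n<1+n κ) ≤-refl) vw)

    -- Monk's rule at κ has a single upward cover, to c[k+1,m+1], and for m < k a single downward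
    -- transposition, to c[k,m+1]. This is the recursion of the elementary symmetric polynomials;
    -- for m = k the missing term is e_{k+1}(x_1, ..., x_k) = 0.
    recurrence : ∀ φ → ⟨ X* k φ ⟩ (cyc k m) + Sum k (λ j → T (suc j) κ ⟨ φ ⟩ w) ≡ ⟨ φ ⟩ (cyc (suc k) (suc m))
    recurrence φ = trans (cong (_+ Sum k (λ j → T (suc j) κ ⟨ φ ⟩ w)) (sym (⟨⟩-pad (κ ℕ.* κ) (cyc k m) (s≤s z≤n) vc (m≤m+n _ _) (X* k φ))))
      (trans (monk′ k 1 refl (n<1+n κ) vw (A-beyond (n<1+n κ)) φ) (trans (ℤₚ.+-identityʳ _) (T-up φ)))

  valid-cyc : ∀ k m → m ≤ k → Valid (suc k) (cyc k m)
  valid-cyc k       zero    _         = valid-cyc-0 k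
  valid-cyc (suc k) (suc m) (s≤s m≤k) = CycleStep.valid-up k m m≤k (valid-cyc k m m≤k)

  ⟨⟩-cyc : ∀ k m → m ≤ k → ∀ φ → ⟨ φ ⟩ (cyc k m) ≡ ev (at φ) (elementary m k)
  ⟨⟩-cyc k       zero    _         φ = ⟨⟩-cyc-0 k φ
  ⟨⟩-cyc (suc k) (suc m) (s≤s m≤k) φ = trans (sym (recurrence φ)) (trans (cong₂ _+_ X-part (rest (≤-<-connex k m)))
    (trans (ℤₚ.+-comm (ev (at φ) (mulX k (elementary m k))) (ev (at φ) (elementary (suc m) k)))
           (sym (ev-++ (at φ) (elementary (suc m) k) (mulX k (elementary m k))))))
    where
    open CycleStep k m m≤k (valid-cyc k m m≤k) using (recurrence; sum-none; sum-down; w)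
    X-part : ⟨ X* k φ ⟩ (cyc k m) ≡ ev (at φ) (mulX k (elementary m k))
    X-part = trans (⟨⟩-cyc k m m≤k (X* k φ)) (sym (ev-mulX (at φ) k (elementary m k)))
    rest : k ≤ m ⊎ m < k → Sum k (λ j → T (suc j) (suc k) ⟨ φ ⟩ w) ≡ ev (at φ) (elementary (suc m) k)
    rest (inj₁ k≤m) = trans (sum-none k≤m φ) (sym (ev-elementary-zero (at φ) (s≤s k≤m)))
    rest (inj₂ m<k) = trans (sum-down m<k φ) (trans
      (⟨⟩-pad (suc k ℕ.* suc k) (cyc k (suc m)) (s≤s z≤n) (valid-cyc k (suc m) m<k) (m≤m+n _ _) φ) (⟨⟩-cyc k (suc m) m<k φ))

open Cycles

-- Enumeration of the indexing chains

module Chains where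
  open import Data.Integer using (_+_; _*_)

  Chain : Set
  Chain = List (ℕ × ℕ)

  extend : ℕ → ℕ → (List ℕ → List Chain) → List ℕ → List Chain
  extend a b G ω with len (swapPos a b ω) ≟ suc (len ω)
  ... | yes _ = map ((a , b) ∷_) (G (swapPos a b ω))
  ... | no  _ = []

  extendAny : ∀ k → ℕ → (List ℕ → Vec Bool k → List Chain) → List ℕ → Vec Bool k → List Chain
  extendAny zero    b G ω []          = []
  extendAny (suc k) b G ω (true  ∷ u) = extendAny k b (λ ω u → G ω (true ∷ u)) ω u
  extendAny (suc k) b G ω (false ∷ u) = extend (suc k) b (λ ω → G ω (true ∷ u)) ω ++ extendAny k b (λ ω u → G ω (false ∷ u)) ω u

  chains : ∀ k → ℕ → ℕ → List ℕ → Vec Bool k → List Chain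
  chains k zero    zero    ω u = [] ∷ []
  chains k zero    (suc m) ω u = []
  chains k (suc d) zero    ω u = chains k d zero ω u
  chains k (suc d) (suc m) ω u = chains k d (suc m) ω u ++ extendAny k (suc (d ℕ.+ k)) (chains k (suc d) m) ω u

  total : Functional → List ℕ → List Chain → ℤ
  total φ ω []       = 0ℤ
  total φ ω (ch ∷ L) = ⟨ φ ⟩ (endPerm ω ch) + total φ ω L

  total-++ : ∀ φ ω L M → total φ ω (L ++ M) ≡ total φ ω L + total φ ω M
  total-++ φ ω []       M = sym (ℤₚ.+-identityˡ _)
  total-++ φ ω (ch ∷ L) M = trans (cong (⟨ φ ⟩ (endPerm ω ch) +_) (total-++ φ ω L M)) (sym (ℤₚ.+-assoc (⟨ φ ⟩ (endPerm ω ch)) _ _))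

  total-map : ∀ φ ω a b L → total φ ω (map ((a , b) ∷_) L) ≡ total φ (swapPos a b ω) L
  total-map φ ω a b []       = refl
  total-map φ ω a b (ch ∷ L) = cong (⟨ φ ⟩ (endPerm (swapPos a b ω) ch) +_) (total-map φ ω a b L)

  -- A chain is followed in two copies: ω, whose list may grow as in `SatChain`, and w of constant
  -- length n, on which the operators act. Both define one function, so they have the same inversion
  -- count and Schubert polynomial.
  record Padded (n : ℕ) (ω w : List ℕ) : Set where
    constructor padded
    field
      {n₀}   : ℕ
      1≤n₀   : 1 ≤ n₀
      n₀≤n   : n₀ ≤ n
      validω : Valid n₀ ω
      validw : Valid n w
      same-app : ∀ i → app w i ≡ app ω i
  open Padded

  padded-len : ∀ {n ω w} → Padded n ω w → len w ≡ len ω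
  padded-len p = padding-len (validω p) (align (n₀≤n p) (validω p) (validw p) (same-app p))

  padded-⟨⟩ : ∀ {n ω w} → Padded n ω w → ∀ φ → ⟨ φ ⟩ w ≡ ⟨ φ ⟩ ω
  padded-⟨⟩ p = padding-⟨⟩ (1≤n₀ p) (validω p) (align (n₀≤n p) (validω p) (validw p) (same-app p))

  valid-swap-any : ∀ {n a b ω} → 1 ≤ a → 1 ≤ b → Valid n ω → Valid (n ⊔ (a ⊔ b)) (swapPos a b ω)
  valid-swap-any {a = a} {b} {ω} 1≤a 1≤b (valid refl i) = valid (length-swapPos a b ω) (Inj-swapPos {w = ω} 1≤a 1≤b i)

  padded-swap : ∀ {n ω w a b} → Padded n ω w → Pair n a b → Padded n (swapPos a b ω) (swapPos a b w)
  padded-swap {n} {ω} {w} {a} {b} (padded 1≤n₀ n₀≤n vω vw eq) p = padded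
    (≤-trans 1≤n₀ (m≤m⊔n _ _)) (⊔-lub n₀≤n (⊔-lub (Pair.a≤n p) (Pair.b≤n p)))
    (valid-swap-any (Pair.1≤a p) (Pair.1≤b p) vω) (swap-valid p vw)
    λ i → trans (app-swapPos a b w (Pair.1≤a p) (Pair.1≤b p) i)
      (trans (eq (τ a b i)) (sym (app-swapPos a b ω (Pair.1≤a p) (Pair.1≤b p) i)))

  module _ {n : ℕ} (φ : Functional) where
    total-extend : ∀ {a b} → Pair n a b → ∀ G f {ω w} → Padded n ω w →
      (∀ {ω w} → Padded n ω w → total φ ω (G ω) ≡ f w) → total φ ω (extend a b G ω) ≡ T a b f w
    total-extend {a} {b} p G f {ω} {w} pd h with len (swapPos a b ω) ≟ suc (len ω)
    ... | yes eq = trans (total-map φ ω a b (G (swapPos a b ω))) (trans (h (padded-swap pd p))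
      (sym (T-yes a b f w (trans (padded-len (padded-swap pd p)) (trans eq (cong suc (sym (padded-len pd))))))))
    ... | no ne  = sym (T-no a b f w λ eq → ne (trans (sym (padded-len (padded-swap pd p))) (trans eq (cong suc (padded-len pd)))))

    total-extendAny : ∀ k {b} → k < b → b ≤ n → ∀ G (F : State k) {ω w} u → Padded n ω w →
      (∀ {ω w} u → Padded n ω w → total φ ω (G ω u) ≡ F w u) → total φ ω (extendAny k b G ω u) ≡ Z k b F w u
    total-extendAny zero    k<b b≤n G F []          pd h = refl
    total-extendAny (suc k) k<b b≤n G F (true ∷ u)  pd h = total-extendAny k (<⇒≤ k<b) b≤n _ _ u pd (λ u → h (true ∷ u))
    total-extendAny (suc k) {b} k<b b≤n G F {ω} (false ∷ u) pd h =
      trans (total-++ φ ω (extend (suc k) b (λ ω → G ω (true ∷ u)) ω) _)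
        (cong₂ _+_ (total-extend (pair (s≤s z≤n) k<b b≤n) (λ ω → G ω (true ∷ u)) (λ w → F w (true ∷ u)) pd (h (true ∷ u)))
                   (total-extendAny k (<⇒≤ k<b) b≤n _ _ u pd (λ u → h (false ∷ u))))

    total-chains : ∀ k d m → d ℕ.+ k ≤ n → ∀ {ω w} u → Padded n ω w →
                   total φ ω (chains k d m ω u) ≡ RR k k d (pure φ) m w u
    total-chains k zero    zero    d≤n u pd = trans (ℤₚ.+-identityʳ _) (sym (padded-⟨⟩ pd φ))
    total-chains k zero    (suc m) d≤n u pd = refl
    total-chains k (suc d) zero    d≤n u pd = total-chains k d zero (<⇒≤ d≤n) u pd
    total-chains k (suc d) (suc m) d≤n {ω} u pd = trans (total-++ φ ω (chains k d (suc m) ω u) _)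
      (cong₂ _+_ (total-chains k d (suc m) (<⇒≤ d≤n) u pd)
        (total-extendAny k (s≤s (m≤n+m k d)) d≤n (chains k (suc d) m) (RR k k (suc d) (pure φ) m) u pd (total-chains k (suc d) m d≤n)))

  extend-∈⁻ : ∀ a b G ω {ch} → ch ∈ extend a b G ω →
              len (swapPos a b ω) ≡ suc (len ω) × ∃[ ch′ ] ch ≡ (a , b) ∷ ch′ × ch′ ∈ G (swapPos a b ω)
  extend-∈⁻ a b G ω mem with len (swapPos a b ω) ≟ suc (len ω)
  ... | yes eq = let ch′ , mem′ , ch≡ = ∈-map⁻ ((a , b) ∷_) mem in eq , ch′ , ch≡ , mem′

  extend-∈⁺ : ∀ a b G ω {ch} → len (swapPos a b ω) ≡ suc (len ω) → ch ∈ G (swapPos a b ω) → (a , b) ∷ ch ∈ extend a b G ω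
  extend-∈⁺ a b G ω eq mem with len (swapPos a b ω) ≟ suc (len ω)
  ... | yes _ = ∈-map⁺ ((a , b) ∷_) mem
  ... | no ne = ⊥-elim (ne eq)

  record Marks {k} (a : ℕ) (u u′ : Vec Bool k) : Set where
    constructor marks
    field
      fresh : ¬ Used u a
      new   : Used u′ a
      keeps : ∀ {c} → Used u c → Used u′ c
      only  : ∀ {c} → Used u′ c → c ≡ a ⊎ Used u c
  open Marks

  marks-here : ∀ {k} (u : Vec Bool k) → Marks (suc k) (false ∷ u) (true ∷ u)
  marks-here u = marks (λ { (inj₁ ()) ; (inj₂ used) → 1+n≰n (Used-≤ u used) }) (inj₁ (refl , refl))
    (λ { (inj₁ ()) ; (inj₂ used) → inj₂ used }) (λ { (inj₁ (_ , eq)) → inj₁ eq ; (inj₂ used) → inj₂ (inj₂ used) })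

  marks-there : ∀ {k a} {u u′ : Vec Bool k} x → a ≤ k → Marks a u u′ → Marks a (x ∷ u) (x ∷ u′)
  marks-there x a≤k (marks f n k o) = marks (λ { (inj₁ (_ , refl)) → 1+n≰n a≤k ; (inj₂ used) → f used }) (inj₂ n)
    (λ { (inj₁ e) → inj₁ e ; (inj₂ used) → inj₂ (k used) })
    (λ { (inj₁ e) → inj₂ (inj₁ e) ; (inj₂ used) → map₂ inj₂ (o used) })

  record Extension {k} (b : ℕ) (G : List ℕ → Vec Bool k → List Chain) (ω : List ℕ) (u : Vec Bool k) (ch : Chain) : Set where
    constructor extension
    field
      {a}    : ℕ
      {u′}   : Vec Bool k
      {ch′}  : Chain
      1≤a    : 1 ≤ a
      a≤k    : a ≤ k
      mark   : Marks a u u′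
      covers : len (swapPos a b ω) ≡ suc (len ω)
      ch≡    : ch ≡ (a , b) ∷ ch′
      ch′∈   : ch′ ∈ G (swapPos a b ω) u′

  extendAny-∈⁻ : ∀ k b G ω u {ch} → ch ∈ extendAny k b G ω u → Extension b G ω u ch
  extendAny-∈⁻ (suc k) b G ω (true ∷ u) mem with extendAny-∈⁻ k b _ ω u mem
  ... | extension 1≤a a≤k mk eq ch≡ ch′∈ = extension 1≤a (m≤n⇒m≤1+n a≤k) (marks-there true a≤k mk) eq ch≡ ch′∈
  extendAny-∈⁻ (suc k) b G ω (false ∷ u) mem with ∈-++⁻ (extend (suc k) b (λ ω → G ω (true ∷ u)) ω) mem
  ... | inj₁ mem₁ = let eq , ch′ , ch≡ , ch′∈ = extend-∈⁻ (suc k) b (λ ω → G ω (true ∷ u)) ω mem₁ in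
        extension (s≤s z≤n) ≤-refl (marks-here u) eq ch≡ ch′∈
  ... | inj₂ mem₂ with extendAny-∈⁻ k b _ ω u mem₂
  ...   | extension 1≤a a≤k mk eq ch≡ ch′∈ = extension 1≤a (m≤n⇒m≤1+n a≤k) (marks-there false a≤k mk) eq ch≡ ch′∈

  extendAny-∈⁺ : ∀ k b G ω u {a} → 1 ≤ a → a ≤ k → ¬ Used u a → len (swapPos a b ω) ≡ suc (len ω) →
                 ∃[ u′ ] Marks a u u′ × (∀ {ch} → ch ∈ G (swapPos a b ω) u′ → (a , b) ∷ ch ∈ extendAny k b G ω u)
  extendAny-∈⁺ zero    b G ω []      1≤a a≤k unused eq = ⊥-elim (<⇒≱ 1≤a a≤k)
  extendAny-∈⁺ (suc k) b G ω (x ∷ u) {a} 1≤a a≤k unused eq with m≤n⇒m<n∨m≡n a≤k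
  extendAny-∈⁺ (suc k) b G ω (true  ∷ u) 1≤a a≤k unused eq | inj₂ refl = ⊥-elim (unused (inj₁ (refl , refl)))
  extendAny-∈⁺ (suc k) b G ω (false ∷ u) 1≤a a≤k unused eq | inj₂ refl =
    true ∷ u , marks-here u , λ mem → ∈-++⁺ˡ (extend-∈⁺ (suc k) b (λ ω → G ω (true ∷ u)) ω eq mem)
  extendAny-∈⁺ (suc k) b G ω (true ∷ u) 1≤a a≤k unused eq | inj₁ (s≤s a≤k′)
    with extendAny-∈⁺ k b (λ ω u → G ω (true ∷ u)) ω u 1≤a a≤k′ (λ used → unused (inj₂ used)) eq
  ... | u′ , mk , h = true ∷ u′ , marks-there true a≤k′ mk , h
  extendAny-∈⁺ (suc k) b G ω (false ∷ u) 1≤a a≤k unused eq | inj₁ (s≤s a≤k′)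
    with extendAny-∈⁺ k b (λ ω u → G ω (false ∷ u)) ω u 1≤a a≤k′ (λ used → unused (inj₂ used)) eq
  ... | u′ , mk , h = false ∷ u′ , marks-there false a≤k′ mk , λ mem → ∈-++⁺ʳ (extend (suc k) b (λ ω → G ω (true ∷ u)) ω) (h mem)

  -- `InCycleSet` strengthened for the induction: the columns are bounded by the highest one still
  -- allowed, and indices used by earlier steps are excluded.
  record Spec {k} (m B : ℕ) (ω : List ℕ) (u : Vec Bool k) (ch : Chain) : Set where
    constructor spec
    field
      length≡ : length ch ≡ m
      chain   : SatChain k ω ch
      weakly  : WeaklyDecr (map proj₂ ch)
      unique  : Unique (map proj₁ ch)
      bounded : All (λ (_ , b) → b ≤ B) ch
      unused  : All (λ (a , _) → ¬ Used u a) ch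
  open Spec

  WD-∷ : ∀ {b} (ch : Chain) → All (λ (_ , b′) → b′ ≤ b) ch → WeaklyDecr (map proj₂ ch) → WeaklyDecr (b ∷ map proj₂ ch)
  WD-∷ []       _         _  = tt
  WD-∷ (_ ∷ ch) (le ∷ _) wd = le , wd

  WD-all : ∀ {b} (ch : Chain) → WeaklyDecr (b ∷ map proj₂ ch) → All (λ (_ , b′) → b′ ≤ b) ch
  WD-all []       _         = []
  WD-all (x ∷ ch) (le , wd) = le ∷ All.map (λ le′ → ≤-trans le′ le) (WD-all ch wd)

  WD-tail : ∀ {b} (ch : Chain) → WeaklyDecr (b ∷ map proj₂ ch) → WeaklyDecr (map proj₂ ch)
  WD-tail []       _        = tt
  WD-tail (_ ∷ ch) (_ , wd) = wd

  all-firsts : ∀ {P : ℕ → Set} (ch : Chain) → All (λ (a , _) → P a) ch → All P (map proj₁ ch)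
  all-firsts []       []       = []
  all-firsts (_ ∷ ch) (p ∷ ps) = p ∷ all-firsts ch ps

  all-firsts⁻ : ∀ {P : ℕ → Set} (ch : Chain) → All P (map proj₁ ch) → All (λ (a , _) → P a) ch
  all-firsts⁻ []       []       = []
  all-firsts⁻ (_ ∷ ch) (p ∷ ps) = p ∷ all-firsts⁻ ch ps

  chains-∈⁻ : ∀ k d m ω u {ch} → ch ∈ chains k d m ω u → Spec m (d ℕ.+ k) ω u ch
  chains-∈⁻ k zero    zero    ω u (here refl) = spec refl tt tt [] [] []
  chains-∈⁻ k (suc d) zero    ω u mem with chains-∈⁻ k d zero ω u mem
  ... | spec l c w n b v = spec l c w n (All.map m≤n⇒m≤1+n b) v
  chains-∈⁻ k (suc d) (suc m) ω u mem with ∈-++⁻ (chains k d (suc m) ω u) mem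
  ... | inj₁ mem₁ with chains-∈⁻ k d (suc m) ω u mem₁
  ...   | spec l c w n b v = spec l c w n (All.map m≤n⇒m≤1+n b) v
  chains-∈⁻ k (suc d) (suc m) ω u mem | inj₂ mem₂ with extendAny-∈⁻ k (suc (d ℕ.+ k)) (chains k (suc d) m) ω u mem₂
  ... | extension {a} {u′} {ch′} 1≤a a≤k mk eq refl ch′∈ with chains-∈⁻ k (suc d) m (swapPos a _ ω) u′ ch′∈
  ...   | spec l c w n b v = spec (cong suc l) (1≤a , a≤k , s≤s (m≤n+m k d) , eq , c) (WD-∷ ch′ b w)
          (all-firsts ch′ (All.map (λ un eq′ → un (subst (Used u′) eq′ (new mk))) v) ∷ n)
          (≤-refl ∷ b) (fresh mk ∷ All.map (λ un used → un (keeps mk used)) v)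

  chains-∈⁺ : ∀ k d m ω u {ch} → Spec m (d ℕ.+ k) ω u ch → ch ∈ chains k d m ω u
  chains-∈⁺ k zero    zero    ω u {[]}     sp = here refl
  chains-∈⁺ k zero    (suc m) ω u {_ ∷ ch} (spec l (_ , _ , k<b , _) w n (b≤k ∷ _) v) = ⊥-elim (<⇒≱ k<b b≤k)
  chains-∈⁺ k (suc d) zero    ω u {[]}     sp = chains-∈⁺ k d zero ω u (spec refl tt tt [] [] [])
  chains-∈⁺ k (suc d) (suc m) ω u {(a , b) ∷ ch} (spec l (1≤a , a≤k , k<b , eq , c) w n@(a∉ ∷ n′) (b≤ ∷ bs) v@(un ∷ v′)) with m≤n⇒m<n∨m≡n b≤
  -- Once the first step lies below the highest column, weak decrease keeps all later steps below it
  -- too.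
  ... | inj₁ (s≤s b≤d) = ∈-++⁺ˡ (chains-∈⁺ k d (suc m) ω u (spec l (1≤a , a≤k , k<b , eq , c) w n
        (b≤d ∷ All.map (λ le → ≤-trans le b≤d) (WD-all ch w)) v))
  ... | inj₂ refl with extendAny-∈⁺ k (suc (d ℕ.+ k)) (chains k (suc d) m) ω u 1≤a a≤k un eq
  ...   | u′ , mk , h = ∈-++⁺ʳ (chains k d (suc m) ω u) (h (chains-∈⁺ k (suc d) m (swapPos a b ω) u′
          (spec (suc-injective l) c (WD-tail ch w) n′ bs
            (All.zipWith (λ (un′ , a≢) used → not-new un′ a≢ (only mk used)) (v′ , all-firsts⁻ ch a∉)))))
    where
    not-new : ∀ {c} → ¬ Used u c → a ≢ c → c ≡ a ⊎ Used u c → ⊥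
    not-new un′ a≢ (inj₁ eq′)  = a≢ (sym eq′)
    not-new un′ a≢ (inj₂ used) = un′ used

  ∷-injʳ : ∀ {x : ℕ × ℕ} {ch ch′ : Chain} → x ∷ ch ≡ x ∷ ch′ → ch ≡ ch′
  ∷-injʳ refl = refl

  head≡ : ∀ {a b a′ b′ : ℕ} {ch ch′ : Chain} → (a , b) ∷ ch ≡ (a′ , b′) ∷ ch′ → a ≡ a′ × b ≡ b′
  head≡ refl = refl , refl

  extend-unique : ∀ a b G ω → (∀ ω → Unique (G ω)) → Unique (extend a b G ω)
  extend-unique a b G ω h with len (swapPos a b ω) ≟ suc (len ω)
  ... | yes _ = Uniqueₚ.map⁺ ∷-injʳ (h (swapPos a b ω))
  ... | no _  = []

  extendAny-unique : ∀ k b G ω u → (∀ ω u → Unique (G ω u)) → Unique (extendAny k b G ω u)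
  extendAny-unique zero    b G ω []          h = []
  extendAny-unique (suc k) b G ω (true  ∷ u) h = extendAny-unique k b _ ω u (λ ω u → h ω (true ∷ u))
  extendAny-unique (suc k) b G ω (false ∷ u) h = Uniqueₚ.++⁺ (extend-unique (suc k) b _ ω (λ ω → h ω (true ∷ u)))
    (extendAny-unique k b _ ω u (λ ω u → h ω (false ∷ u))) disjoint
    where
    disjoint : ∀ {ch} → ch ∈ extend (suc k) b (λ ω → G ω (true ∷ u)) ω × ch ∈ extendAny k b (λ ω u → G ω (false ∷ u)) ω u → ⊥
    disjoint (mem₁ , mem₂) with extend-∈⁻ (suc k) b (λ ω → G ω (true ∷ u)) ω mem₁ | extendAny-∈⁻ k b (λ ω u → G ω (false ∷ u)) ω u mem₂
    ... | _ , _ , eq₁ , _ | ext = 1+n≰n (subst (_≤ k) (proj₁ (head≡ (trans (sym (Extension.ch≡ ext)) eq₁))) (Extension.a≤k ext))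

  -- The two lists joined at each stage differ in the first step: one takes it in the highest
  -- column, the other strictly below.
  chains-unique : ∀ k d m ω u → Unique (chains k d m ω u)
  chains-unique k zero    zero    ω u = [] ∷ []
  chains-unique k zero    (suc m) ω u = []
  chains-unique k (suc d) zero    ω u = chains-unique k d zero ω u
  chains-unique k (suc d) (suc m) ω u = Uniqueₚ.++⁺ (chains-unique k d (suc m) ω u)
    (extendAny-unique k (suc (d ℕ.+ k)) (chains k (suc d) m) ω u (chains-unique k (suc d) m)) disjoint
    where
    disjoint : ∀ {ch} → ch ∈ chains k d (suc m) ω u × ch ∈ extendAny k (suc (d ℕ.+ k)) (chains k (suc d) m) ω u → ⊥
    disjoint (mem₁ , mem₂) with extendAny-∈⁻ k (suc (d ℕ.+ k)) (chains k (suc d) m) ω u mem₂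
    ... | extension _ _ _ _ refl _ with bounded (chains-∈⁻ k d (suc m) ω u mem₁)
    ...   | b≤ ∷ _ = 1+n≰n b≤

  -- Here b may lie beyond the end of the list, out of reach of `len⇒cover`. Padding to length b + n
  -- brings it into range and changes neither values nor inversions.
  len⇒cov-any : ∀ {n a b ω} → Valid n ω → 1 ≤ a → a < b → len (swapPos a b ω) ≡ suc (len ω) → Cov ω a b
  len⇒cov-any {n} {a} {b} {ω} v 1≤a a<b eq with padding ω b v
  ... | w , _ , vw , same-app with len⇒cov vw p (trans (len≡ (valid-swap-any 1≤a (Pair.1≤b p) v) (swap-valid p vw)
          (⊔-lub (m≤n+m n b) (⊔-lub (Pair.a≤n p) (Pair.b≤n p)))
          λ i → trans (app-swapPos a b w 1≤a (Pair.1≤b p) i) (trans (same-app (τ a b i)) (sym (app-swapPos a b ω 1≤a (Pair.1≤b p) i))))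
        (trans eq (cong suc (sym (len≡ v vw (m≤n+m n b) same-app)))))
      where
      p : Pair (b ℕ.+ n) a b
      p = pair 1≤a a<b (m≤m+n b n)
      len≡ : ∀ {n n′ v w} → Valid n v → Valid n′ w → n ≤ n′ → (∀ i → app w i ≡ app v i) → len w ≡ len v
      len≡ vv vw n≤n′ h = padding-len vv (align n≤n′ vv vw h)
  ... | cov r e = cov (subst₂ _<_ (same-app a) (same-app b) r) λ i a<i i<b btw → e i a<i i<b
        (subst₂ _<_ (sym (same-app a)) (sym (same-app i)) (proj₁ btw) , subst₂ _<_ (sym (same-app i)) (sym (same-app b)) (proj₂ btw))

  -- By `cover-fixed` each step raises the bound N on the support by at most one, so finitely many
  -- columns contain every chain of given length.
  chain-bounded : ∀ {n k} N ω ch → Valid n ω → k ≤ N → (∀ i → N < i → app ω i ≡ i) → SatChain k ω ch → All (λ (_ , b) → b ≤ length ch ℕ.+ N) ch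
  chain-bounded N ω []             v k≤N fix _ = []
  chain-bounded {k = k} N ω ((a , b) ∷ ch) v k≤N fix (1≤a , a≤k , k<b , eq , c) =
    ≤-trans b≤ (s≤s (m≤n+m N (length ch))) ∷
    All.map (λ le → ≤-trans le (≤-reflexive (+-suc (length ch) N)))
      (chain-bounded (suc N) (swapPos a b ω) ch (valid-swap-any 1≤a 1≤b v) (m≤n⇒m≤1+n k≤N)
        (λ i N<i → trans (app-swap-other a b ω i 1≤a 1≤b (≢-sym (<⇒≢ (≤-<-trans a≤k (≤-<-trans k≤N (<⇒≤ N<i))))) (≢-sym (<⇒≢ (≤-<-trans b≤ N<i)))) (fix i (<⇒≤ N<i))) c)
    where
    a<b = ≤-<-trans a≤k k<b
    1≤b = 1≤-< 1≤a a<b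
    b≤ : b ≤ suc N
    b≤ = cover-fixed v (s≤s (≤-trans a≤k k≤N)) a<b fix (len⇒cov-any v 1≤a a<b eq)

  atZ-∈ : ∀ w {j} → j < length w → atZ w j ∈ w
  atZ-∈ (x ∷ w) {zero}  _         = here refl
  atZ-∈ (x ∷ w) {suc j} (s≤s j<n) = there (atZ-∈ w j<n)

  unique-atInj : ∀ {w} → Unique w → AtInj w
  unique-atInj         (x∉ ∷ u) zero    zero    _         _         _  = refl
  unique-atInj {_ ∷ w} (x∉ ∷ u) zero    (suc j) _         (s≤s j<n) eq = ⊥-elim (All.lookup x∉ (atZ-∈ w j<n) eq)
  unique-atInj {_ ∷ w} (x∉ ∷ u) (suc i) zero    (s≤s i<n) _         eq = ⊥-elim (All.lookup x∉ (atZ-∈ w i<n) (sym eq))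
  unique-atInj         (x∉ ∷ u) (suc i) (suc j) (s≤s i<n) (s≤s j<n) eq = cong suc (unique-atInj u i j i<n j<n eq)

open Chains

-- Assembly of the Pieri rule

open import Data.Integer using (_+_)

-- Listed values lie between 1 and n, while 0 and the positions above n are fixed; a collision could
-- only occur inside the list, whose entries are distinct.
perm-valid : ∀ {n w} → IsPerm n w → Valid n w
perm-valid {n} {w} (refl , p) = valid refl injective
  where
  uniq : Unique w
  uniq = PermSetoidₚ.Unique-resp-↭ (setoid ℕ) (↭⇒↭ₛ (↭-sym p)) (Uniqueₚ.map⁺ suc-injective (Uniqueₚ.upTo⁺ n))
  values : ∀ {i} → i < n → 1 ≤ app w (suc i) × app w (suc i) ≤ n
  values {i} i<n with ∈-map⁻ suc (∈-resp-↭ p (atZ-∈ w i<n))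
  ... | j , j∈ , eq rewrite app-suc w i<n | eq = s≤s z≤n , ∈-upTo⁻ j∈
  injective : Inj w
  injective zero    zero    _  = refl
  injective (suc i) (suc j) eq with ≤-<-connex (suc i) n | ≤-<-connex (suc j) n
  ... | inj₁ i<n | inj₁ j<n = cong suc (unique-atInj uniq i j i<n j<n (trans (sym (app-suc w i<n)) (trans eq (app-suc w j<n))))
  ... | inj₁ i<n | inj₂ n≤j = ⊥-elim (<⇒≱ n≤j (subst (_≤ n) (trans eq (app-> w n≤j)) (proj₂ (values i<n))))
  ... | inj₂ n≤i | inj₁ j<n = ⊥-elim (<⇒≱ n≤i (subst (_≤ n) (trans (sym eq) (app-> w n≤i)) (proj₂ (values j<n))))
  ... | inj₂ n≤i | inj₂ n≤j = trans (sym (app-> w n≤i)) (trans eq (app-> w n≤j))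
  injective zero    (suc j) eq with ≤-<-connex (suc j) n
  ... | inj₁ j<n = ⊥-elim (<⇒≱ (proj₁ (values j<n)) (≤-reflexive (trans (sym eq) (app-zero w))))
  ... | inj₂ n≤j = ⊥-elim (0≢1+n (trans (sym (app-zero w)) (trans eq (app-> w n≤j))))
  injective (suc i) zero    eq with ≤-<-connex (suc i) n
  ... | inj₁ i<n = ⊥-elim (<⇒≱ (proj₁ (values i<n)) (≤-reflexive (trans eq (app-zero w))))
  ... | inj₂ n≤i = ⊥-elim (0≢1+n (trans (sym (app-zero w)) (trans (sym eq) (app-> w n≤i))))

addMono-congˡ : ∀ {e f} g → e ∼ f → addMono e g ∼ addMono f g
exponent (addMono-congˡ {e} {f} g e∼f) i = trans (atZ-addMono e g i) (trans (cong (ℕ._+ atZ g i) (exponent e∼f i)) (sym (atZ-addMono f g i)))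

-- Regards the right factor as part of the functional, so that the left factor of a product can be
-- replaced by its padded copy.
timesʳ : Poly → Functional → Functional
timesʳ Q φ = functional (λ e → ev (λ f → at φ (addMono e f)) Q) (λ e∼f → ev-cong (λ g → respects φ (addMono-congˡ g e∼f)) Q)

ev-sum : ∀ φ ω L → ev (at φ) (sumP (map (λ ch → 𝔖 (endPerm ω ch)) L)) ≡ total φ ω L
ev-sum φ ω []       = refl
ev-sum φ ω (ch ∷ L) = trans (ev-++ (at φ) (𝔖 (endPerm ω ch)) _) (cong (⟨ φ ⟩ (endPerm ω ch) +_) (ev-sum φ ω L))

theorem6p9 : (n k m : ℕ) (ω : List ℕ) → 1 ≤ m → m ≤ k → k ≤ n → IsPerm n ω →
    Σ (List (List (ℕ × ℕ))) (λ L →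
    Unique L × (∀ ch → (ch ∈ L) ⇔ InCycleSet k m ω ch) ×
    (𝔖 ω *P 𝔖 (cyc k m) ≈P sumP (map (λ ch → 𝔖 (endPerm ω ch)) L)))
theorem6p9 n k m ω 1≤m m≤k k≤n perm with padding ω (suc m) (perm-valid perm)
... | w , pd , vw , app-eq = L , chains-unique k d m ω ε , (λ ch → mk⇔ (to ch) (from ch)) ,
    ≈P-ext {𝔖 ω *P 𝔖 (cyc k m)} {sumP (map (λ ch → 𝔖 (endPerm ω ch)) L)} equal
  where
  vω = perm-valid perm
  N d : ℕ
  -- A chain of m steps reaches position m + n at most; the additional place keeps the last position
  -- fixed throughout, as Monk's rule demands.
  N = suc m ℕ.+ n
  d = N ∸ k
  d+k≡N : d ℕ.+ k ≡ N
  d+k≡N = m∸n+n≡m (≤-trans k≤n (m≤n+m n (suc m)))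
  ε = unmarked k
  L = chains k d m ω ε

  to : ∀ ch → ch ∈ L → InCycleSet k m ω ch
  to ch ch∈ with chains-∈⁻ k d m ω ε ch∈
  ... | spec l c w n _ _ = l , c , w , n

  from : ∀ ch → InCycleSet k m ω ch → ch ∈ L
  from ch (l , c , w , u) = chains-∈⁺ k d m ω ε (spec l c w u
    (All.map (λ le → ≤-trans le (≤-trans (≤-reflexive (cong (ℕ._+ n) l)) (≤-trans (n≤1+n (m ℕ.+ n)) (≤-reflexive (sym d+k≡N)))))
      (chain-bounded n ω ch vω k≤n (λ i n<i → app-> ω (subst (_< i) (sym (size vω)) n<i)) c))
    (All.universal (λ _ → unmarked-unused k) ch))

  w-padded : Padded N ω w
  w-padded = padded (≤-trans 1≤m (≤-trans m≤k k≤n)) (m≤n+m n (suc m)) vω vw app-eq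

  w-room : Room N k m w
  w-room = room vw (s≤s (+-monoʳ-≤ m k≤n)) λ i N≤i → trans (app-eq i)
    (app-> ω (subst (_< i) (sym (size vω)) (+-cancelˡ-≤ m (suc n) i (≤-trans (≤-reflexive (+-suc m n)) N≤i))))

  equal : ∀ φ → ev (at φ) (𝔖 ω *P 𝔖 (cyc k m)) ≡ ev (at φ) (sumP (map (λ ch → 𝔖 (endPerm ω ch)) L))
  equal φ = begin
    ev (at φ) (𝔖 ω *P 𝔖 (cyc k m))
      ≡⟨ ev-respects φ {𝔖 ω *P 𝔖 (cyc k m)} {𝔖 ω *P elementary m k}
           (*P-congʳ (𝔖 ω) {𝔖 (cyc k m)} {elementary m k} (≈P-ext {𝔖 (cyc k m)} {elementary m k} (⟨⟩-cyc k m m≤k))) ⟩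
    ev (at φ) (𝔖 ω *P elementary m k)
      ≡⟨ ev-*P (at φ) (𝔖 ω) (elementary m k) ⟩
    ⟨ timesʳ (elementary m k) φ ⟩ ω
      ≡⟨ sym (padded-⟨⟩ w-padded (timesʳ (elementary m k) φ)) ⟩
    ⟨ timesʳ (elementary m k) φ ⟩ w
      ≡⟨ sym (ev-*P (at φ) (𝔖 w) (elementary m k)) ⟩
    ev (at φ) (𝔖 w *P elementary m k)
      ≡⟨ sym (Pieri.pieri {N} {k} k d d+k≡N ≤-refl φ m w w-room) ⟩
    RR k k d (pure φ) m w ε
      ≡⟨ sym (total-chains {N} φ k d m (≤-reflexive d+k≡N) ε w-padded) ⟩
    total φ ω L
      ≡⟨ sym (ev-sum φ ω L) ⟩
    ev (at φ) (sumP (map (λ ch → 𝔖 (endPerm ω ch)) L)) ∎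
    where open ≡-Reasoning
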